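{- There is a sequence of unweighted trees $B_h$ ($h\ge1$, all edge weights equal to $1$) of maximum degree at most $3$ (exactly $3$ for $h\ge2$), with $n_h=2^{h+1}-1$ vertices, such that $$\frac{\operatorname{OPT}_{\mathrm{card}}(B_h)}{\operatorname{OPT}_{\mathrm{free}}(B_h)}=\Theta(\log n_h),$$ i.e. there are constants $0<c\le C$ such that the ratio lies in $[c\log n_h,\,C\log n_h]$ for all $h\ge1$. Moreover, for every $h$ and every vertex set $S$ with $|S|\ge2$ inducing a connected subgraph of $B_h$, one has $\operatorname{frag}_{1/3}(S)\le1$.
   Context: For a finite connected graph $G=(V,E,w)$ with positive weights, $d_G$ is the shortest-path metric of $(V,E)$ with every edge of length $1$. $\operatorname{OPT}_{\mathrm{free}}(G)$ is the minimum of $\sum_{xy\in E}w_{xy}u(x,y)$ over all ultrametrics $u$ on $V$ (metrics with $u(x,y)\le\max\{u(x,z),u(z,y)\}$) with $u\ge d_G$ on all pairs. A rooted binary hierarchy $H$ on $V$ is a rooted tree whose leaves are the vertices of $V$ and whose internal nodes have exactly two children; $C_H(x,y)$ is the set of leaves below the lowest common ancestor of $x,y$; $h_H(x,x)=0$ and $h_H(x,y)=|C_H(x,y)|-1$ for $x\ne y$. $\operatorname{OPT}_{\mathrm{card}}(G)$ is the minimum of $\sum_{xy\in E}w_{xy}h_H(x,y)$ over all rooted binary hierarchies $H$ on $V$ with $h_H\ge d_G$ on all pairs. For $S\subseteq V$ with $G[S]$ connected and $|S|\ge2$, and $\alpha\in(0,1/2]$, $\operatorname{frag}_\alpha(S)$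 is the minimum of $(|S|-1)\,w(A,B)/W(S)$ over all bipartitions $S=A\mathbin{\dot\cup}B$ with $G[A],G[B]$ connected (nonempty) and $\max\{|A|-1,|B|-1\}\le(1-\alpha)(|S|-1)$ ($+\infty$ if none exists), where $W(S)$ is the total weight of edges of $G[S]$ and $w(A,B)$ the total weight of edges between $A$ and $B$. -}

module Defs where

open import Data.Bool.Base using (if_then_else_)
import Data.Empty as Empty
open import Data.Fin.Base using (Fin)
import Data.Fin.Properties as Fin
open import Data.Fin.Subset using (Subset; Nonempty; _∈_; _∪_; _∩_; ∣_∣; ⊤; ⊥)
open import Data.Fin.Subset.Properties using (_∈?_; ∈⊤)
open import Data.Integer.Base as ℤ using (+_)
import Data.Integer.Properties as ℤ
open import Data.List.Base using
  (List; []; _∷_; _∷ʳ_; map; foldr; filter; length; allFin; cartesianProduct)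
open import Data.List.Extrema.Nat using (max)
import Data.List.Membership.DecPropositional as DecMembership
open import Data.List.Relation.Binary.Permutation.Propositional using (_↭_)
open import Data.List.Relation.Unary.Linked using (Linked)
open import Data.List.Relation.Unary.Unique.Propositional using (Unique)
open import Data.Nat.Base as ℕ using (ℕ; zero; suc; _∸_; z≤n; s≤s)
import Data.Nat.Properties as ℕ
open import Data.Nat.Induction using (<-rec)
open import Data.Nat.Logarithm
  using (⌊log₂_⌋; ⌊log₂⌋-mono-≤; ⌊log₂[2^n]⌋≡n; ⌊log₂⌊n/2⌋⌋≡⌊log₂n⌋∸1)
open import Data.Product.Base using (Σ; ∃; _×_; _,_; proj₁; proj₂; uncurry)
open import Data.Rational.Base as ℚ using (ℚ; 0ℚ; 1ℚ)
import Data.Rational.Properties as ℚ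
open import Data.Rational.Solver using (module +-*-Solver)
import Data.Rational.Unnormalised.Base as ℚᵘ
import Data.Rational.Unnormalised.Properties as ℚᵘ
open import Data.Sum.Base using (inj₁; inj₂)
import Data.Tree.Binary as Binary
import Data.Unit.Base as Unit
open import Function.Metric.Structures using (IsGeneralMetric)
open import Level using (0ℓ)
open import Relation.Binary.Construct.Closure.ReflexiveTransitive using (Star)
open import Relation.Binary.Core using (Rel)
open import Relation.Binary.Definitions using (Decidable; Symmetric; Irreflexive)
open import Relation.Binary.PropositionalEquality
open import Relation.Nullary using (¬_; Dec; yes; no; does)
open import Relation.Nullary.Construct.Add.Supremum using (_⁺; [_]; ⊤⁺)
open import Relation.Nullary.Decidable using (map′; _×-dec_; _⊎-dec_)

-- A real number is a Cauchy sequence of rationals with a modulus; two of them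
-- are identified by _≃_, not by _≡_.

record ℝ : Set where
  field
    seq    : ℕ → ℚ
    cauchy : ∀ ε → 0ℚ ℚ.< ε → ∃ λ N → ∀ m n → N ℕ.≤ m → N ℕ.≤ n →
             ℚ.∣ seq m ℚ.- seq n ∣ ℚ.≤ ε

open ℝ public

infix 4 _≤ℝ_ _<ℝ_ _≃_

_≤ℝ_ : Rel ℝ 0ℓ
x ≤ℝ y = ∀ ε → 0ℚ ℚ.< ε → ∃ λ N → ∀ n → N ℕ.≤ n → seq x n ℚ.≤ seq y n ℚ.+ ε

_<ℝ_ : Rel ℝ 0ℓ
x <ℝ y = ∃ λ δ → 0ℚ ℚ.< δ × ∃ λ N → ∀ n → N ℕ.≤ n → seq x n ℚ.+ δ ℚ.≤ seq y n

_≃_ : Rel ℝ 0ℓ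
x ≃ y = x ≤ℝ y × y ≤ℝ x

open +-*-Solver using (solve; _:+_; _:-_; _:*_; :-_; _:=_)

close⇒≤ : ∀ p q {ε} → ℚ.∣ p ℚ.- q ∣ ℚ.≤ ε → p ℚ.≤ q ℚ.+ ε
close⇒≤ p q {ε} le = begin
  p                    ≡⟨ solve 2 (λ p q → p := q :+ (p :- q)) refl p q ⟩
  q ℚ.+ (p ℚ.- q)      ≤⟨ ℚ.+-monoʳ-≤ q (p≤∣p∣ (p ℚ.- q)) ⟩
  q ℚ.+ ℚ.∣ p ℚ.- q ∣  ≤⟨ ℚ.+-monoʳ-≤ q le ⟩
  q ℚ.+ ε              ∎
  where
  open ℚ.≤-Reasoning
  p≤∣p∣ : ∀ p → p ℚ.≤ ℚ.∣ p ∣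
  p≤∣p∣ p with ℚ.≤-total 0ℚ p
  ... | inj₁ 0≤p = ℚ.≤-reflexive (sym (ℚ.0≤p⇒∣p∣≡p 0≤p))
  ... | inj₂ p≤0 = ℚ.≤-trans p≤0 (ℚ.0≤∣p∣ p)

≤⇒close : ∀ p q {ε} → p ℚ.≤ q ℚ.+ ε → q ℚ.≤ p ℚ.+ ε → ℚ.∣ p ℚ.- q ∣ ℚ.≤ ε
≤⇒close p q {ε} p≤ q≤ with ℚ.∣p∣≡p∨∣p∣≡-p (p ℚ.- q)
... | inj₁ eq = begin
  ℚ.∣ p ℚ.- q ∣        ≡⟨ eq ⟩
  p ℚ.- q              ≤⟨ ℚ.+-monoˡ-≤ (ℚ.- q) p≤ ⟩
  q ℚ.+ ε ℚ.- q        ≡⟨ solve 2 (λ q ε → q :+ ε :- q := ε) refl q ε ⟩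
  ε                    ∎
  where open ℚ.≤-Reasoning
... | inj₂ eq = begin
  ℚ.∣ p ℚ.- q ∣        ≡⟨ eq ⟩
  ℚ.- (p ℚ.- q)        ≡⟨ solve 2 (λ p q → :- (p :- q) := q :- p) refl p q ⟩
  q ℚ.- p              ≤⟨ ℚ.+-monoˡ-≤ (ℚ.- p) q≤ ⟩
  p ℚ.+ ε ℚ.- p        ≡⟨ solve 2 (λ q ε → q :+ ε :- q := ε) refl p ε ⟩
  ε                    ∎
  where open ℚ.≤-Reasoning

0<½ : 0ℚ ℚ.< ℚ.½
0<½ = ℚ.*<* (ℤ.+<+ (s≤s z≤n))

0<1 : 0ℚ ℚ.< 1ℚ
0<1 = ℚ.*<* (ℤ.+<+ (s≤s z≤n))

p<p+q : ∀ p {q} → 0ℚ ℚ.< q → p ℚ.< p ℚ.+ q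
p<p+q p {q} 0<q = subst (ℚ._< p ℚ.+ q) (ℚ.+-identityʳ p) (ℚ.+-monoʳ-< p 0<q)

half>0 : ∀ {ε} → 0ℚ ℚ.< ε → 0ℚ ℚ.< ℚ.½ ℚ.* ε
half>0 {ε} 0<ε = subst (ℚ._< ℚ.½ ℚ.* ε) (ℚ.*-zeroʳ ℚ.½) (ℚ.*-monoʳ-<-pos ℚ.½ 0<ε)

half+half : ∀ ε → ℚ.½ ℚ.* ε ℚ.+ ℚ.½ ℚ.* ε ≡ ε
half+half ε = trans (sym (ℚ.*-distribʳ-+ ε ℚ.½ ℚ.½)) (ℚ.*-identityˡ ε)

fromℚ : ℚ → ℝ
fromℚ q = record
  { seq    = λ _ → q
  ; cauchy = λ ε 0<ε → 0 , λ _ _ _ _ →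
      subst (ℚ._≤ ε) (sym (cong ℚ.∣_∣ (ℚ.+-inverseʳ q))) (ℚ.<⇒≤ 0<ε)
  }

fromℕ : ℕ → ℝ
fromℕ n = fromℚ (+ n ℚ./ 1)

0ℝ 1ℝ : ℝ
0ℝ = fromℚ 0ℚ
1ℝ = fromℚ 1ℚ

infixl 6 _+ℝ_ _-ℝ_
infixl 7 _*ℝ_
infixl 6 _⊔ℝ_
infix  8 -ℝ_

_+ℝ_ : ℝ → ℝ → ℝ
x +ℝ y = record
  { seq    = λ n → seq x n ℚ.+ seq y n
  ; cauchy = λ ε 0<ε →
      let N , x-close = cauchy x (ℚ.½ ℚ.* ε) (half>0 0<ε)
          M , y-close = cauchy y (ℚ.½ ℚ.* ε) (half>0 0<ε)
      in N ℕ.⊔ M , λ m n N≤m N≤n →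
         subst (ℚ.∣ (seq x m ℚ.+ seq y m) ℚ.- (seq x n ℚ.+ seq y n) ∣ ℚ.≤_) (half+half ε)
           (bound (seq x m) (seq x n) (seq y m) (seq y n)
             (x-close m n (ℕ.m⊔n≤o⇒m≤o N M N≤m) (ℕ.m⊔n≤o⇒m≤o N M N≤n))
             (y-close m n (ℕ.m⊔n≤o⇒n≤o N M N≤m) (ℕ.m⊔n≤o⇒n≤o N M N≤n)))
  }
  where
  bound : ∀ a b c d {ε δ} → ℚ.∣ a ℚ.- b ∣ ℚ.≤ ε → ℚ.∣ c ℚ.- d ∣ ℚ.≤ δ →
          ℚ.∣ (a ℚ.+ c) ℚ.- (b ℚ.+ d) ∣ ℚ.≤ ε ℚ.+ δ
  bound a b c d {ε} {δ} ab cd = begin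
    ℚ.∣ (a ℚ.+ c) ℚ.- (b ℚ.+ d) ∣
      ≡⟨ cong ℚ.∣_∣ (solve 4 (λ a b c d →
           (a :+ c) :- (b :+ d) := (a :- b) :+ (c :- d)) refl a b c d) ⟩
    ℚ.∣ (a ℚ.- b) ℚ.+ (c ℚ.- d) ∣
      ≤⟨ ℚ.∣p+q∣≤∣p∣+∣q∣ (a ℚ.- b) (c ℚ.- d) ⟩
    ℚ.∣ a ℚ.- b ∣ ℚ.+ ℚ.∣ c ℚ.- d ∣
      ≤⟨ ℚ.+-mono-≤ ab cd ⟩
    ε ℚ.+ δ ∎
    where open ℚ.≤-Reasoning

-ℝ_ : ℝ → ℝ
-ℝ x = record
  { seq    = λ n → ℚ.- seq x n
  ; cauchy = λ ε 0<ε →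
      let N , close = cauchy x ε 0<ε
      in N , λ m n N≤m N≤n →
         subst (λ t → ℚ.∣ t ∣ ℚ.≤ ε)
           (solve 2 (λ p q → q :- p := :- p :- (:- q)) refl (seq x m) (seq x n))
           (close n m N≤n N≤m)
  }

_-ℝ_ : ℝ → ℝ → ℝ
x -ℝ y = x +ℝ -ℝ y

_⊔ℝ_ : ℝ → ℝ → ℝ
x ⊔ℝ y = record
  { seq    = λ n → seq x n ℚ.⊔ seq y n
  ; cauchy = λ ε 0<ε →
      let N , x-close = cauchy x ε 0<ε
          M , y-close = cauchy y ε 0<ε
          half = λ m n N≤m N≤n → bound (seq x m) (seq x n) (seq y m) (seq y n)
            (close⇒≤ (seq x m) (seq x n)
              (x-close m n (ℕ.m⊔n≤o⇒m≤o N M N≤m) (ℕ.m⊔n≤o⇒m≤o N M N≤n)))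
            (close⇒≤ (seq y m) (seq y n)
              (y-close m n (ℕ.m⊔n≤o⇒n≤o N M N≤m) (ℕ.m⊔n≤o⇒n≤o N M N≤n)))
      in N ℕ.⊔ M , λ m n N≤m N≤n →
         ≤⇒close (seq x m ℚ.⊔ seq y m) (seq x n ℚ.⊔ seq y n)
           (half m n N≤m N≤n) (half n m N≤n N≤m)
  }
  where
  bound : ∀ a b c d {ε} → a ℚ.≤ b ℚ.+ ε → c ℚ.≤ d ℚ.+ ε → a ℚ.⊔ c ℚ.≤ (b ℚ.⊔ d) ℚ.+ ε
  bound _ b _ d {ε} a≤ c≤ = ℚ.⊔-lub
    (ℚ.≤-trans a≤ (ℚ.+-monoˡ-≤ ε (ℚ.p≤p⊔q b d)))
    (ℚ.≤-trans c≤ (ℚ.+-monoˡ-≤ ε (ℚ.p≤q⊔p b d)))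

bounded : ∀ x → ∃ λ K → 0ℚ ℚ.< K × ∃ λ N → ∀ n → N ℕ.≤ n → ℚ.∣ seq x n ∣ ℚ.≤ K
bounded x =
  let N , close = cauchy x 1ℚ 0<1
  in ℚ.∣ seq x N ∣ ℚ.+ 1ℚ
   , ℚ.≤-<-trans (ℚ.0≤∣p∣ (seq x N)) (p<p+q ℚ.∣ seq x N ∣ 0<1)
   , N , λ n N≤n → begin
       ℚ.∣ seq x n ∣
         ≡⟨ cong ℚ.∣_∣ (solve 2 (λ p q → p := q :+ (p :- q)) refl (seq x n) (seq x N)) ⟩
       ℚ.∣ seq x N ℚ.+ (seq x n ℚ.- seq x N) ∣
         ≤⟨ ℚ.∣p+q∣≤∣p∣+∣q∣ (seq x N) (seq x n ℚ.- seq x N) ⟩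
       ℚ.∣ seq x N ∣ ℚ.+ ℚ.∣ seq x n ℚ.- seq x N ∣
         ≤⟨ ℚ.+-monoʳ-≤ ℚ.∣ seq x N ∣ (close n N N≤n ℕ.≤-refl) ⟩
       ℚ.∣ seq x N ∣ ℚ.+ 1ℚ ∎
  where open ℚ.≤-Reasoning

*-bound : ∀ a b c d {K L δ} → 0ℚ ℚ.< K → 0ℚ ℚ.< L →
          ℚ.∣ a ∣ ℚ.≤ K → ℚ.∣ d ∣ ℚ.≤ L → ℚ.∣ a ℚ.- b ∣ ℚ.≤ δ → ℚ.∣ c ℚ.- d ∣ ℚ.≤ δ →
          ℚ.∣ a ℚ.* c ℚ.- b ℚ.* d ∣ ℚ.≤ (K ℚ.+ L) ℚ.* δ
*-bound a b c d {K} {L} {δ} 0<K 0<L a≤K d≤L ab cd = begin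
  ℚ.∣ a ℚ.* c ℚ.- b ℚ.* d ∣
    ≡⟨ cong ℚ.∣_∣ (solve 4 (λ a b c d →
         a :* c :- b :* d := a :* (c :- d) :+ d :* (a :- b)) refl a b c d) ⟩
  ℚ.∣ a ℚ.* (c ℚ.- d) ℚ.+ d ℚ.* (a ℚ.- b) ∣
    ≤⟨ ℚ.∣p+q∣≤∣p∣+∣q∣ (a ℚ.* (c ℚ.- d)) (d ℚ.* (a ℚ.- b)) ⟩
  ℚ.∣ a ℚ.* (c ℚ.- d) ∣ ℚ.+ ℚ.∣ d ℚ.* (a ℚ.- b) ∣
    ≡⟨ cong₂ ℚ._+_ (ℚ.∣p*q∣≡∣p∣*∣q∣ a (c ℚ.- d)) (ℚ.∣p*q∣≡∣p∣*∣q∣ d (a ℚ.- b)) ⟩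
  ℚ.∣ a ∣ ℚ.* ℚ.∣ c ℚ.- d ∣ ℚ.+ ℚ.∣ d ∣ ℚ.* ℚ.∣ a ℚ.- b ∣
    ≤⟨ ℚ.+-mono-≤ (mono 0<K a≤K cd) (mono 0<L d≤L ab) ⟩
  K ℚ.* δ ℚ.+ L ℚ.* δ
    ≡⟨ ℚ.*-distribʳ-+ δ K L ⟨
  (K ℚ.+ L) ℚ.* δ ∎
  where
  open ℚ.≤-Reasoning
  mono : ∀ {p q K δ} → 0ℚ ℚ.< K → ℚ.∣ p ∣ ℚ.≤ K → ℚ.∣ q ∣ ℚ.≤ δ →
         ℚ.∣ p ∣ ℚ.* ℚ.∣ q ∣ ℚ.≤ K ℚ.* δ
  mono {p} {q} {K} 0<K p≤ q≤ = ℚ.≤-trans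
    (ℚ.*-monoʳ-≤-nonNeg ℚ.∣ q ∣ {{ℚ.∣-∣-nonNeg q}} p≤)
    (ℚ.*-monoˡ-≤-nonNeg K {{ℚ.pos⇒nonNeg K {{ℚ.positive 0<K}}}} q≤)

scale : ∀ M ε → 0ℚ ℚ.< M → 0ℚ ℚ.< ε → ∃ λ δ → 0ℚ ℚ.< δ × M ℚ.* δ ≡ ε
scale M ε 0<M 0<ε = ℚ.1/ M ℚ.* ε
  , subst (ℚ._< ℚ.1/ M ℚ.* ε) (ℚ.*-zeroʳ (ℚ.1/ M)) (ℚ.*-monoʳ-<-pos (ℚ.1/ M) 0<ε)
  , trans (sym (ℚ.*-assoc M (ℚ.1/ M) ε))
      (trans (cong (ℚ._* ε) (ℚ.*-inverseʳ M)) (ℚ.*-identityˡ ε))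
  where
  instance
    M-positive : ℚ.Positive M
    M-positive = ℚ.positive 0<M
    M-nonZero : ℚ.NonZero M
    M-nonZero = ℚ.pos⇒nonZero M
    1/M-positive : ℚ.Positive (ℚ.1/ M)
    1/M-positive = ℚ.1/pos⇒pos M

_*ℝ_ : ℝ → ℝ → ℝ
x *ℝ y = record { seq = λ n → seq x n ℚ.* seq y n ; cauchy = *-cauchy (bounded x) (bounded y) }
  where
  *-cauchy : (∃ λ K → 0ℚ ℚ.< K × ∃ λ N → ∀ n → N ℕ.≤ n → ℚ.∣ seq x n ∣ ℚ.≤ K) →
             (∃ λ L → 0ℚ ℚ.< L × ∃ λ N → ∀ n → N ℕ.≤ n → ℚ.∣ seq y n ∣ ℚ.≤ L) →
             ∀ ε → 0ℚ ℚ.< ε → ∃ λ N → ∀ m n → N ℕ.≤ m → N ℕ.≤ n →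
             ℚ.∣ seq x m ℚ.* seq y m ℚ.- seq x n ℚ.* seq y n ∣ ℚ.≤ ε
  *-cauchy (K , 0<K , N₁ , x≤K) (L , 0<L , N₂ , y≤L) ε 0<ε
    with scale (K ℚ.+ L) ε (ℚ.<-trans 0<K (p<p+q K 0<L)) 0<ε
  ... | δ , 0<δ , eq with cauchy x δ 0<δ | cauchy y δ 0<δ
  ... | N₃ , x-close | N₄ , y-close =
    (N₁ ℕ.⊔ N₂) ℕ.⊔ (N₃ ℕ.⊔ N₄) , λ m n N≤m N≤n →
      subst (ℚ.∣ seq x m ℚ.* seq y m ℚ.- seq x n ℚ.* seq y n ∣ ℚ.≤_) eq
        (*-bound (seq x m) (seq x n) (seq y m) (seq y n) 0<K 0<L
          (x≤K m (ℕ.m⊔n≤o⇒m≤o N₁ N₂ (left N≤m)))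
          (y≤L n (ℕ.m⊔n≤o⇒n≤o N₁ N₂ (left N≤n)))
          (x-close m n (ℕ.m⊔n≤o⇒m≤o N₃ N₄ (right N≤m)) (ℕ.m⊔n≤o⇒m≤o N₃ N₄ (right N≤n)))
          (y-close m n (ℕ.m⊔n≤o⇒n≤o N₃ N₄ (right N≤m)) (ℕ.m⊔n≤o⇒n≤o N₃ N₄ (right N≤n))))
    where
    left : ∀ {k} → (N₁ ℕ.⊔ N₂) ℕ.⊔ (N₃ ℕ.⊔ N₄) ℕ.≤ k → N₁ ℕ.⊔ N₂ ℕ.≤ k
    left = ℕ.m⊔n≤o⇒m≤o (N₁ ℕ.⊔ N₂) (N₃ ℕ.⊔ N₄)
    right : ∀ {k} → (N₁ ℕ.⊔ N₂) ℕ.⊔ (N₃ ℕ.⊔ N₄) ℕ.≤ k → N₃ ℕ.⊔ N₄ ℕ.≤ k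
    right = ℕ.m⊔n≤o⇒n≤o (N₁ ℕ.⊔ N₂) (N₃ ℕ.⊔ N₄)

-- q = a / b.  Inverting a constructive real requires a positivity witness, so
-- division is a relation, which holds only for a positive denominator.

IsQuotient : ℝ → ℝ → ℝ → Set
IsQuotient q a b = 0ℝ <ℝ b × q *ℝ b ≃ a

sumℝ : {A : Set} → (A → ℝ) → List A → ℝ
sumℝ f = foldr (λ a s → f a +ℝ s) 0ℝ

IsMinimum : (ℝ → Set) → ℝ → Set
IsMinimum P m = P m × (∀ v → P v → m ≤ℝ v)

2^⌊log₂⌋≤ : ∀ n → 1 ℕ.≤ n → 2 ℕ.^ ⌊log₂ n ⌋ ℕ.≤ n
2^⌊log₂⌋≤ = <-rec _ step
  where
  double : ∀ n → ℕ.⌊ n /2⌋ ℕ.+ ℕ.⌊ n /2⌋ ℕ.≤ n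
  double n = ℕ.≤-trans (ℕ.+-monoʳ-≤ ℕ.⌊ n /2⌋ (ℕ.⌊n/2⌋≤⌈n/2⌉ n))
                       (ℕ.≤-reflexive (ℕ.⌊n/2⌋+⌈n/2⌉≡n n))

  step : ∀ n → (∀ {m} → m ℕ.< n → 1 ℕ.≤ m → 2 ℕ.^ ⌊log₂ m ⌋ ℕ.≤ m) →
         1 ℕ.≤ n → 2 ℕ.^ ⌊log₂ n ⌋ ℕ.≤ n
  step (suc zero)       rec _ = s≤s z≤n
  step n@(suc (suc n′)) rec _ = twice (⌊log₂ n ⌋ ∸ 1) (subst (λ l → 2 ℕ.^ l ℕ.≤ ℕ.⌊ n /2⌋)
    (⌊log₂⌊n/2⌋⌋≡⌊log₂n⌋∸1 n) (rec (ℕ.⌊n/2⌋<n (suc n′)) (s≤s z≤n)))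
    where
    twice : ∀ l → 2 ℕ.^ l ℕ.≤ ℕ.⌊ n /2⌋ → 2 ℕ.^ suc l ℕ.≤ n
    twice l half = ℕ.≤-trans
      (ℕ.≤-reflexive (cong (2 ℕ.^ l ℕ.+_) (ℕ.+-identityʳ (2 ℕ.^ l))))
      (ℕ.≤-trans (ℕ.+-mono-≤ half half) (double n))

<2^1+⌊log₂⌋ : ∀ n → n ℕ.< 2 ℕ.^ suc ⌊log₂ n ⌋
<2^1+⌊log₂⌋ n = ℕ.≰⇒> λ 2^≤n → ℕ.n≮n ⌊log₂ n ⌋
  (subst (ℕ._≤ ⌊log₂ n ⌋) (⌊log₂[2^n]⌋≡n (suc ⌊log₂ n ⌋)) (⌊log₂⌋-mono-≤ 2^≤n))

/-≤ : ∀ a c k m → a ℕ.* suc m ℕ.≤ suc c ℕ.* suc k →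
      + a ℚ./ suc k ℚ.≤ (+ c ℚ./ suc m) ℚ.+ (+ 1 ℚ./ suc m)
/-≤ a c k m le = ℚ.toℚᵘ-cancel-≤ (begin
  ℚ.toℚᵘ (+ a ℚ./ suc k)
    ≃⟨ ℚ.toℚᵘ-fromℚᵘ (ℚᵘ.mkℚᵘ (+ a) k) ⟩
  ℚᵘ.mkℚᵘ (+ a) k
    ≤⟨ ℚᵘ.*≤* ineq ⟩
  ℚᵘ.mkℚᵘ (+ c) m ℚᵘ.+ ℚᵘ.mkℚᵘ (+ 1) m
    ≃⟨ ℚᵘ.+-cong (ℚ.toℚᵘ-fromℚᵘ (ℚᵘ.mkℚᵘ (+ c) m)) (ℚ.toℚᵘ-fromℚᵘ (ℚᵘ.mkℚᵘ (+ 1) m)) ⟨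
  ℚ.toℚᵘ (+ c ℚ./ suc m) ℚᵘ.+ ℚ.toℚᵘ (+ 1 ℚ./ suc m)
    ≃⟨ ℚ.toℚᵘ-homo-+ (+ c ℚ./ suc m) (+ 1 ℚ./ suc m) ⟨
  ℚ.toℚᵘ ((+ c ℚ./ suc m) ℚ.+ (+ 1 ℚ./ suc m)) ∎)
  where
  open ℚᵘ.≤-Reasoning
  ineq : + a ℤ.* + (suc m ℕ.* suc m) ℤ.≤ (+ c ℤ.* + suc m ℤ.+ + 1 ℤ.* + suc m) ℤ.* + suc k
  ineq = subst₂ ℤ._≤_ (lhs≡ a (suc m)) (rhs≡ c (suc m) (suc k))
           (ℤ.+≤+ (ℕ.*-monoˡ-≤ (suc m) le))
    where
    lhs≡ : ∀ a m → + (a ℕ.* m ℕ.* m) ≡ + a ℤ.* + (m ℕ.* m)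
    lhs≡ a m = trans (cong +_ (ℕ.*-assoc a m m)) (ℤ.pos-* a (m ℕ.* m))
    rhs≡ : ∀ c m k → + (suc c ℕ.* k ℕ.* m) ≡ (+ c ℤ.* + m ℤ.+ + 1 ℤ.* + m) ℤ.* + k
    rhs≡ c m k = trans
      (cong +_ (trans (ℕ.*-assoc (suc c) k m)
        (trans (cong (suc c ℕ.*_) (ℕ.*-comm k m))
          (trans (sym (ℕ.*-assoc (suc c) m k))
            (cong (ℕ._* k) (trans (ℕ.+-comm m (c ℕ.* m))
              (cong (c ℕ.* m ℕ.+_) (sym (ℕ.*-identityˡ m)))))))))
      (trans (ℤ.pos-* (c ℕ.* m ℕ.+ 1 ℕ.* m) k)
        (cong (ℤ._* + k) (trans (ℤ.pos-+ (c ℕ.* m) (1 ℕ.* m))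
          (cong₂ ℤ._+_ (ℤ.pos-* c m) (ℤ.pos-* 1 m)))))

module _ (n : ℕ) where

  power : ℕ → ℕ
  power k = suc n ℕ.^ suc k

  cross : ∀ k m → ⌊log₂ power k ⌋ ℕ.* suc m ℕ.≤ suc ⌊log₂ power m ⌋ ℕ.* suc k
  cross k m = ℕ.<⇒≤ (ℕ.≰⇒> λ le → ℕ.n≮n (suc n ℕ.^ (suc k ℕ.* suc m)) (begin-strict
    suc n ℕ.^ (suc k ℕ.* suc m)               ≡⟨ cong (suc n ℕ.^_) (ℕ.*-comm (suc k) (suc m)) ⟩
    suc n ℕ.^ (suc m ℕ.* suc k)               ≡⟨ ℕ.^-*-assoc (suc n) (suc m) (suc k) ⟨
    power m ℕ.^ suc k                         <⟨ ℕ.^-monoˡ-< (suc k) (<2^1+⌊log₂⌋ (power m)) ⟩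
    (2 ℕ.^ suc ⌊log₂ power m ⌋) ℕ.^ suc k     ≡⟨ ℕ.^-*-assoc 2 (suc ⌊log₂ power m ⌋) (suc k) ⟩
    2 ℕ.^ (suc ⌊log₂ power m ⌋ ℕ.* suc k)     ≤⟨ ℕ.^-monoʳ-≤ 2 le ⟩
    2 ℕ.^ (⌊log₂ power k ⌋ ℕ.* suc m)         ≡⟨ ℕ.^-*-assoc 2 ⌊log₂ power k ⌋ (suc m) ⟨
    (2 ℕ.^ ⌊log₂ power k ⌋) ℕ.^ suc m         ≤⟨ ℕ.^-monoˡ-≤ (suc m)
                                                   (2^⌊log₂⌋≤ (power k) (ℕ.m^n>0 (suc n) (suc k))) ⟩
    power k ℕ.^ suc m                         ≡⟨ ℕ.^-*-assoc (suc n) (suc k) (suc m) ⟩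
    suc n ℕ.^ (suc k ℕ.* suc m)               ∎))
    where open ℕ.≤-Reasoning

  approx : ℕ → ℚ
  approx k = + ⌊log₂ power k ⌋ ℚ./ suc k

  approx-≤ : ∀ k m → approx k ℚ.≤ approx m ℚ.+ (+ 1 ℚ./ suc m)
  approx-≤ k m = /-≤ ⌊log₂ power k ⌋ ⌊log₂ power m ⌋ k m (cross k m)

1/-≤ : ∀ ε → 0ℚ ℚ.< ε → ∃ λ N → ∀ m → N ℕ.≤ m → + 1 ℚ./ suc m ℚ.≤ ε
1/-≤ ε@(ℚ.mkℚ (+ suc p) d _) 0<ε = d , λ m d≤m → ℚ.toℚᵘ-cancel-≤ (begin
  ℚ.toℚᵘ (+ 1 ℚ./ suc m)  ≃⟨ ℚ.toℚᵘ-fromℚᵘ (ℚᵘ.mkℚᵘ (+ 1) m) ⟩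
  ℚᵘ.mkℚᵘ (+ 1) m         ≤⟨ ℚᵘ.*≤* (ℤ.+≤+ (ℕ.*-mono-≤ (s≤s (z≤n {p})) (s≤s d≤m))) ⟩
  ℚ.toℚᵘ ε                ∎)
  where open ℚᵘ.≤-Reasoning
1/-≤ (ℚ.mkℚ (+ zero) d _)   (ℚ.*<* (ℤ.+<+ ()))
1/-≤ (ℚ.mkℚ ℤ.-[1+ p ] d _) (ℚ.*<* ())

-- The binary logarithm (0 at 0), as the limit of ⌊log₂ (n ^ k)⌋ / k:
-- ⌊log₂ (n ^ k)⌋ ≤ k * log₂ n < ⌊log₂ (n ^ k)⌋ + 1 for n ≥ 1, k ≥ 1.

log₂ : ℕ → ℝ
log₂ zero    = 0ℝ
log₂ (suc n) = record { seq = approx n ; cauchy = log-cauchy }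
  where
  log-cauchy : ∀ ε → 0ℚ ℚ.< ε → ∃ λ N → ∀ k m → N ℕ.≤ k → N ℕ.≤ m →
               ℚ.∣ approx n k ℚ.- approx n m ∣ ℚ.≤ ε
  log-cauchy ε 0<ε with 1/-≤ ε 0<ε
  ... | N , 1/≤ε = N , λ k m N≤k N≤m → ≤⇒close (approx n k) (approx n m)
    (ℚ.≤-trans (approx-≤ n k m) (ℚ.+-monoʳ-≤ (approx n m) (1/≤ε m N≤m)))
    (ℚ.≤-trans (approx-≤ n m k) (ℚ.+-monoʳ-≤ (approx n k) (1/≤ε k N≤k)))

InducesConnected : ∀ {n} → Rel (Fin n) 0ℓ → Subset n → Set
InducesConnected Adj S =
  Nonempty S × (∀ {x y} → x ∈ S → y ∈ S → Star (λ a b → Adj a b × a ∈ S × b ∈ S) x y)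

record Graph : Set₁ where
  field
    order      : ℕ
    Adj        : Rel (Fin order) 0ℓ
    adj?       : Decidable Adj
    adj-sym    : Symmetric Adj
    adj-irrefl : Irreflexive _≡_ Adj
    connected  : InducesConnected Adj ⊤
    weight     : Fin order → Fin order → ℝ
    weight-sym : ∀ x y → weight x y ≃ weight y x
    weight-pos : ∀ {x y} → Adj x y → 0ℝ <ℝ weight x y

  V : Set
  V = Fin order

  -- Each edge is listed once, as its increasing pair of endpoints.
  edges : List (V × V)
  edges = filter (λ (x , y) → (x Fin.<? y) ×-dec adj? x y)
                 (cartesianProduct (allFin order) (allFin order))

  edgeSum : (V → V → ℝ) → ℝ
  edgeSum f = sumℝ (λ (x , y) → weight x y *ℝ f x y) edges

  maxDegree : ℕ
  maxDegree = max 0 (map (λ x → length (filter (adj? x) (allFin order))) (allFin order))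

  -- The cyclic sequence of vertices, without repeating the first one.
  IsCycle : List V → Set
  IsCycle []       = Empty.⊥
  IsCycle (x ∷ xs) = 2 ℕ.≤ length xs × Unique (x ∷ xs) × Linked Adj (x ∷ xs ∷ʳ x)

  Acyclic : Set
  Acyclic = ∀ xs → ¬ IsCycle xs

  Unweighted : Set
  Unweighted = ∀ {x y} → Adj x y → weight x y ≃ 1ℝ

  data Walk : V → V → ℕ → Set where
    []  : ∀ {x} → Walk x x 0
    _∷_ : ∀ {x y z k} → Adj x y → Walk y z k → Walk x z (suc k)

  walk? : ∀ x y k → Dec (Walk x y k)
  walk? x y zero    = map′ (λ { refl → [] }) (λ { [] → refl }) (x Fin.≟ y)
  walk? x y (suc k) = map′ (λ (z , a , w) → a ∷ w) (λ { (a ∷ w) → _ , a , w })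
    (Fin.any? λ z → adj? x z ×-dec walk? z y k)

  walk : ∀ x y → ∃ (Walk x y)
  walk x y = toWalk (proj₂ connected ∈⊤ ∈⊤)
    where
    toWalk : ∀ {x y} → Star (λ a b → Adj a b × a ∈ ⊤ × b ∈ ⊤) x y → ∃ (Walk x y)
    toWalk Star.ε             = 0 , []
    toWalk ((a , _) Star.◅ s) = let k , w = toWalk s in suc k , a ∷ w

  shortest : ∀ x y → ∃ λ k → Walk x y k × (∀ j → Walk x y j → k ℕ.≤ j)
  shortest x y =
    let k , w = walk x y
    in search k 0 (λ _ _ → z≤n) (subst (Walk x y) (sym (ℕ.+-identityʳ k)) w)
    where
    search : ∀ fuel k → (∀ j → Walk x y j → k ℕ.≤ j) → Walk x y (fuel ℕ.+ k) →
             ∃ λ k → Walk x y k × (∀ j → Walk x y j → k ℕ.≤ j)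
    search zero       k least w = k , w , least
    search (suc fuel) k least w with walk? x y k
    ... | yes v = k , v , least
    ... | no ¬v = search fuel (suc k)
            (λ j v → ℕ.≤∧≢⇒< (least j v) λ { refl → ¬v v })
            (subst (Walk x y) (sym (ℕ.+-suc fuel k)) w)

  dist : V → V → ℕ
  dist x y = proj₁ (shortest x y)

BinaryTree : ℕ → Set
BinaryTree n = Binary.Tree Unit.⊤ (Fin n)

leaves : ∀ {n} → BinaryTree n → List (Fin n)
leaves = Binary.Leaves.toList

Hierarchy : ℕ → Set
Hierarchy n = Σ (BinaryTree n) λ t → leaves t ↭ allFin n

module ListMembership {n} = DecMembership (Fin._≟_ {n})
open ListMembership public using () renaming (_∈?_ to _∈ᴸ?_)

-- The subtree rooted at the lowest common ancestor of x and y, provided that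
-- both are leaves of the given tree: descend while a child contains both.

lcaSubtree : ∀ {n} → BinaryTree n → Fin n → Fin n → BinaryTree n
lcaSubtree t@(Binary.leaf _)     x y = t
lcaSubtree t@(Binary.node l _ r) x y =
  if does ((x ∈ᴸ? leaves l) ×-dec (y ∈ᴸ? leaves l)) then lcaSubtree l x y else
  if does ((x ∈ᴸ? leaves r) ×-dec (y ∈ᴸ? leaves r)) then lcaSubtree r x y else
  t

cluster : ∀ {n} → Hierarchy n → Fin n → Fin n → List (Fin n)
cluster (t , _) x y = leaves (lcaSubtree t x y)

hierarchyHeight : ∀ {n} → Hierarchy n → Fin n → Fin n → ℕ
hierarchyHeight H x y = if does (x Fin.≟ y) then 0 else length (cluster H x y) ∸ 1

module _ (G : Graph) where
  open Graph G

  -- An ultrametric is a metric whose triangle inequality holds with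
  -- the maximum in place of the sum.

  IsUltrametric : (V → V → ℝ) → Set
  IsUltrametric = IsGeneralMetric _≡_ _≃_ _≤ℝ_ 0ℝ _⊔ℝ_

  FreeCost : ℝ → Set
  FreeCost v = Σ (V → V → ℝ) λ u →
    IsUltrametric u × (∀ x y → fromℕ (dist x y) ≤ℝ u x y) × v ≃ edgeSum u

  CardCost : ℝ → Set
  CardCost v = Σ (Hierarchy order) λ H →
    (∀ x y → dist x y ℕ.≤ hierarchyHeight H x y) ×
    v ≃ edgeSum (λ x y → fromℕ (hierarchyHeight H x y))

  IsOPT-free : ℝ → Set
  IsOPT-free = IsMinimum FreeCost

  IsOPT-card : ℝ → Set
  IsOPT-card = IsMinimum CardCost

  innerWeight : Subset order → ℝ
  innerWeight S = sumℝ (uncurry weight)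
    (filter (λ (x , y) → (x ∈? S) ×-dec (y ∈? S)) edges)

  crossWeight : Subset order → Subset order → ℝ
  crossWeight A B = sumℝ (uncurry weight)
    (filter (λ (x , y) → ((x ∈? A) ×-dec (y ∈? B)) ⊎-dec ((x ∈? B) ×-dec (y ∈? A))) edges)

  record Bipartition (S A B : Subset order) : Set where
    field
      covers      : A ∪ B ≡ S
      disjoint    : A ∩ B ≡ ⊥
      connectedˡ  : InducesConnected Adj A
      connectedʳ  : InducesConnected Adj B

  Balanced : ℝ → (S A B : Subset order) → Set
  Balanced α S A B =
    fromℕ ((∣ A ∣ ∸ 1) ℕ.⊔ (∣ B ∣ ∸ 1)) ≤ℝ (1ℝ -ℝ α) *ℝ fromℕ (∣ S ∣ ∸ 1)

  FragCost : ℝ → Subset order → ℝ → Set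
  FragCost α S v = ∃ λ A → ∃ λ B → Bipartition S A B × Balanced α S A B ×
    IsQuotient v (fromℕ (∣ S ∣ ∸ 1) *ℝ crossWeight A B) (innerWeight S)

  -- frag takes values in the reals extended by a top element ⊤⁺, which is
  -- the value exactly when no bipartition is admissible.

  IsFrag : ℝ → Subset order → ℝ ⁺ → Set
  IsFrag α S [ v ] = IsMinimum (FragCost α S) v
  IsFrag α S ⊤⁺    = ∀ A B → Bipartition S A B → ¬ Balanced α S A B

open import Relation.Binary.Construct.Add.Supremum.NonStrict _≤ℝ_ public
  using (_≤⁺_)

{-# OPTIONS --safe #-}
module Submission where

-- The trees are the complete binary trees B h, with M h edges and
-- N h = M h + 1 = 2 ^ (h + 1) - 1 vertices.  The optima satisfy
--
--   M h ≤ OPT-free ≤ 4 * M h   and   (h + 1) * M h ≤ 2 * OPT-card,  OPT-card ≤ 3 * h * M h,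
--
-- so that their ratio lies between (h + 1) / 8 and 3 * h, whereas
-- h ≤ log₂ (N h) ≤ h + 1; hence c = 1/8 and C = 3.
--
-- OPT-free: every edge costs at least 1 (edgeCost-dominating).  The ultrametric
-- that gives two distinct vertices twice the height of the subtree below their
-- lowest common ancestor dominates distances; about half of the edges end in a
-- leaf and cost 2, a quarter cost 4, and so on, so that the total is at most
-- 4 * M h (edgeCost-lcaUltra).
--
-- OPT-card from above: split off the right subtree, then the left subtree from
-- the root, and recurse.  Each level of the recursion costs at most 3 * M h in
-- total (edgeCost-hierarchy).
--
-- OPT-card from below (treeCost-lower): in any hierarchy over a forest, a
-- cluster with s vertices spanning E edges, of cost c, satisfies for every k
--
--   s * (k + 2) + 2 ^ (k + 1) * E ≤ 2 * c + 2 ^ (k + 1) * s.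
--
-- If s > 2 ^ k, then an edge separated at the top of the cluster costs
-- s - 1 ≥ 2 ^ k, and the inequality follows from those of the two children for
-- the same k.  If s ≤ 2 ^ k, then it follows from the one for k - 1 because
-- E < s in a forest; single vertices are the base case.  For the whole vertex set of B h and k = h it reads
-- (h + 1) * M h + h ≤ 2 * c.
--
-- Both optima are attained.  There are finitely many hierarchies
-- (OPT-card-attained).  Distances are integers, so the integer parts of a
-- dominating real ultrametric form a dominating ultrametric, and truncating that
-- one at the diameter leaves finitely many candidates (OPT-free-attained).  A
-- constructive real has an integer part only under a double negation; this is
-- enough because _≤ℝ_ is stable under double negation.
--
-- Fragmentation: a connected vertex set of a tree has one vertex more than
-- edges (#edges-Top), so exactly one edge crosses a bipartition into connected
-- parts (crossing-1) and the cost of every admissible bipartition is 1.  An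
-- admissible one is found by going down from the topmost vertex of the set to
-- the heavier child until the part below has at most 2/3 of the edges (cut-root);
-- as a vertex has at most two children, that part still has at least a third as
-- many vertices as the set has edges, which bounds the other side.

open import Defs
open import Data.Bool.Base using (Bool; true; false; if_then_else_; _∧_; _∨_; not)
import Data.Bool.Properties as Bool
open import Data.Empty using (⊥; ⊥-elim)
open import Data.Fin.Base as Fin using (Fin; zero; suc; toℕ; fromℕ<; finToFun; funToFin;
  _↑ˡ_; _↑ʳ_; splitAt)
import Data.Fin.Properties as Fin
open import Data.Fin.Subset using (Subset; ∣_∣)
import Data.Fin.Subset as Subset
open import Data.Fin.Subset.Properties using (_∈?_; ∈⊤)
open import Data.Integer.Base using (+_)
import Data.Integer.Base as ℤ
import Data.Integer.Properties as ℤ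
open import Data.List.Base
  using (List; []; _∷_; _++_; _∷ʳ_; map; length; filter; allFin; tabulate;
         cartesianProduct; cartesianProductWith)
open import Data.List.Extrema.Nat using (max≤v⁺; xs≤max)
open import Data.List.Membership.Propositional using (_∈_; _∉_; lose; find)
open import Data.List.Membership.Propositional.Properties
  using (∈-map⁺; ∈-map⁻; ∈-++⁺ˡ; ∈-++⁺ʳ; ∈-++⁻; ∈-∃++; ∈-filter⁺; ∈-filter⁻; ∈-cartesianProduct⁺;
         ∈-cartesianProductWith⁺; ∈-allFin; ∈-tabulate⁺; ∈-tabulate⁻)
open import Data.List.Membership.Propositional.Properties.WithK using (unique∧set⇒bag)
open import Data.List.Properties
  using (length-++; length-map; length-tabulate; ++-assoc; map-cong; map-∘; map-++; map-tabulate;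
         tabulate-cong)
open import Data.List.Relation.Binary.BagAndSetEquality using (∼bag⇒↭)
open import Data.List.Relation.Binary.Disjoint.Propositional using (Disjoint)
open import Data.List.Relation.Binary.Permutation.Propositional using (_↭_; ↭-sym; ↭-reflexive; ↭⇒↭ₛ)
import Data.List.Relation.Binary.Permutation.Propositional.Properties as ↭
import Data.List.Relation.Binary.Permutation.Setoid.Properties as ↭ₛ
open import Data.List.Relation.Unary.All as All using (All; []; _∷_)
import Data.List.Relation.Unary.All.Properties as All
open import Data.List.Relation.Unary.AllPairs using ([]; _∷_)
open import Data.List.Relation.Unary.Any using (here; there; any?)
open import Data.List.Relation.Unary.Linked using (Linked; _∷_)
import Data.List.Relation.Unary.Unique.DecPropositional as UniqueDec
open import Data.List.Relation.Unary.Unique.Propositional using (Unique)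
open import Data.List.Relation.Unary.Unique.Propositional.Properties as Unique using (Unique[x∷xs]⇒x∉xs)
open import Data.Nat.Base using (ℕ; suc; _≤_; _^_; _∸_)
open import Data.Nat.Base as ℕ using (zero; _<_; _+_; _*_; _⊔_; _⊓_; z≤n; s≤s)
open import Data.Nat.Induction using (<-wellFounded)
open import Data.Nat.ListAction using (sum)
open import Data.Nat.ListAction.Properties using (sum-++; sum-↭)
open import Data.Nat.Logarithm using (⌊log₂_⌋; ⌊log₂⌋-mono-≤; ⌊log₂[2^n]⌋≡n)
import Data.Nat.Properties as ℕ
open import Data.Nat.Tactic.RingSolver using (solve-∀)
open import Data.Product.Base using (Σ; ∃; _×_)
open import Data.Product.Base using (_,_; proj₁; proj₂; uncurry)
open import Data.Rational.Base using (_/_)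
open import Data.Rational.Base as ℚ using (ℚ; 0ℚ; 1ℚ; ½)
import Data.Rational.Properties as ℚ
open import Data.Rational.Solver using (module +-*-Solver)
import Data.Rational.Unnormalised.Base as ℚᵘ
import Data.Rational.Unnormalised.Properties as ℚᵘ
open import Data.Sum.Base using (_⊎_; inj₁; inj₂; [_,_]′; swap)
import Data.Tree.Binary as Binary
open import Data.Unit.Base using (tt)
open import Data.Vec.Base as Vec using ([]; _∷_; lookup)
import Data.Vec.Properties as Vec
open import Function.Base using (id; _∘_)
open import Function.Bundles using (mk⇔)
open import Function.Metric.Structures using (IsGeneralMetric)
open import Induction.WellFounded using (Acc; acc)
open import Relation.Binary.Construct.Closure.ReflexiveTransitive as Star using (Star; _◅_; _◅◅_)
import Relation.Binary.Construct.Add.Supremum.NonStrict as ≤⁺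
import Relation.Binary.Reasoning.Setoid as SetoidReasoning
open import Relation.Binary.PropositionalEquality
open import Relation.Nullary using (¬_; Dec; yes; no; does)
open import Relation.Nullary.Construct.Add.Supremum using (_⁺; [_])
open import Relation.Nullary.Decidable using (map′; _×-dec_; _⊎-dec_; dec-true; dec-false)
open import Relation.Unary using (Decidable)

-- The order of the real numbers

pointwise-≤ : ∀ {x y} → (∀ n → seq x n ℚ.≤ seq y n) → x ≤ℝ y
pointwise-≤ {x} {y} le ε 0<ε = 0 , λ n _ → ℚ.≤-trans (le n) (ℚ.<⇒≤ (p<p+q (seq y n) 0<ε))

pointwise-≃ : ∀ {x y} → (∀ n → seq x n ≡ seq y n) → x ≃ y
pointwise-≃ {x} {y} eq = pointwise-≤ {x} {y} (λ n → ℚ.≤-reflexive (eq n)) , pointwise-≤ {y} {x}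
    (λ n → ℚ.≤-reflexive (sym (eq n)))

≤ℝ-refl : ∀ {x} → x ≤ℝ x
≤ℝ-refl {x} = pointwise-≤ {x} {x} λ _ → ℚ.≤-refl

≤ℝ-trans : ∀ {x y z} → x ≤ℝ y → y ≤ℝ z → x ≤ℝ z
≤ℝ-trans {x} {y} {z} x≤y y≤z ε 0<ε =
  let N , p = x≤y (½ ℚ.* ε) (half>0 0<ε)
      M , q = y≤z (½ ℚ.* ε) (half>0 0<ε)
  in N ℕ.⊔ M , λ n N≤n → begin
    seq x n                              ≤⟨ p n (ℕ.m⊔n≤o⇒m≤o N M N≤n) ⟩
    seq y n ℚ.+ ½ ℚ.* ε                  ≤⟨ ℚ.+-monoˡ-≤ (½ ℚ.* ε) (q n (ℕ.m⊔n≤o⇒n≤o N M N≤n)) ⟩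
    seq z n ℚ.+ ½ ℚ.* ε ℚ.+ ½ ℚ.* ε      ≡⟨ ℚ.+-assoc (seq z n) _ _ ⟩
    seq z n ℚ.+ (½ ℚ.* ε ℚ.+ ½ ℚ.* ε)    ≡⟨ cong (seq z n ℚ.+_) (half+half ε) ⟩
    seq z n ℚ.+ ε                        ∎
  where open ℚ.≤-Reasoning

≃-refl : ∀ {x} → x ≃ x
≃-refl {x} = ≤ℝ-refl {x} , ≤ℝ-refl {x}

≃-sym : ∀ {x y} → x ≃ y → y ≃ x
≃-sym (p , q) = q , p

≃-trans : ∀ {x y z} → x ≃ y → y ≃ z → x ≃ z
≃-trans {x} {y} {z} (p , q) (r , s) = ≤ℝ-trans {x} {y} {z} p r , ≤ℝ-trans {z} {y} {x} s q

+ℝ-mono-≤ : ∀ {x x′ y y′} → x ≤ℝ x′ → y ≤ℝ y′ → x +ℝ y ≤ℝ x′ +ℝ y′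
+ℝ-mono-≤ {x} {x′} {y} {y′} x≤ y≤ ε 0<ε =
  let N , p = x≤ (½ ℚ.* ε) (half>0 0<ε)
      M , q = y≤ (½ ℚ.* ε) (half>0 0<ε)
  in N ℕ.⊔ M , λ n N≤n → begin
    seq x n ℚ.+ seq y n
      ≤⟨ ℚ.+-mono-≤ (p n (ℕ.m⊔n≤o⇒m≤o N M N≤n)) (q n (ℕ.m⊔n≤o⇒n≤o N M N≤n)) ⟩
    (seq x′ n ℚ.+ ½ ℚ.* ε) ℚ.+ (seq y′ n ℚ.+ ½ ℚ.* ε)
      ≡⟨ solve 3 (λ a b e → (a :+ e) :+ (b :+ e) := (a :+ b) :+ (e :+ e)) refl
           (seq x′ n) (seq y′ n) (½ ℚ.* ε) ⟩
    seq x′ n ℚ.+ seq y′ n ℚ.+ (½ ℚ.* ε ℚ.+ ½ ℚ.* ε)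
      ≡⟨ cong (seq x′ n ℚ.+ seq y′ n ℚ.+_) (half+half ε) ⟩
    seq x′ n ℚ.+ seq y′ n ℚ.+ ε ∎
  where
  open ℚ.≤-Reasoning
  open +-*-Solver

⊔ℝ-lub : ∀ {x y z} → x ≤ℝ z → y ≤ℝ z → x ⊔ℝ y ≤ℝ z
⊔ℝ-lub x≤ y≤ ε 0<ε =
  let N , p = x≤ ε 0<ε
      M , q = y≤ ε 0<ε
  in N ℕ.⊔ M , λ n N≤n →
     ℚ.⊔-lub (p n (ℕ.m⊔n≤o⇒m≤o N M N≤n)) (q n (ℕ.m⊔n≤o⇒n≤o N M N≤n))

<ℝ⇒≤ℝ : ∀ {x y} → x <ℝ y → x ≤ℝ y
<ℝ⇒≤ℝ {x} {y} (δ , 0<δ , N , lt) ε 0<ε = N , λ n N≤n →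
  ℚ.≤-trans (ℚ.<⇒≤ (p<p+q (seq x n) 0<δ)) (ℚ.≤-trans (lt n N≤n) (ℚ.<⇒≤ (p<p+q (seq y n) 0<ε)))

<ℝ⇒≱ℝ : ∀ {x y} → x <ℝ y → ¬ y ≤ℝ x
<ℝ⇒≱ℝ {x} {y} (δ , 0<δ , N , lt) y≤x with y≤x (½ ℚ.* δ) (half>0 0<δ)
... | M , le = ℚ.<-irrefl refl (begin-strict
  seq x n ℚ.+ ½ ℚ.* δ                  <⟨ p<p+q _ (half>0 0<δ) ⟩
  seq x n ℚ.+ ½ ℚ.* δ ℚ.+ ½ ℚ.* δ      ≡⟨ ℚ.+-assoc (seq x n) _ _ ⟩
  seq x n ℚ.+ (½ ℚ.* δ ℚ.+ ½ ℚ.* δ)    ≡⟨ cong (seq x n ℚ.+_) (half+half δ) ⟩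
  seq x n ℚ.+ δ                        ≤⟨ lt n (ℕ.m≤m⊔n N M) ⟩
  seq y n                              ≤⟨ le n (ℕ.m≤n⊔m N M) ⟩
  seq x n ℚ.+ ½ ℚ.* δ                  ∎)
  where
  open ℚ.≤-Reasoning
  n = N ℕ.⊔ M

-- A constructive substitute for totality: either x ≤ y up to ε, or y < x.
≤ℝ-split : ∀ x y ε → 0ℚ ℚ.< ε →
           (∃ λ N → ∀ n → N ≤ n → seq x n ℚ.≤ seq y n ℚ.+ ε) ⊎ y <ℝ x
≤ℝ-split x y ε 0<ε = result (cauchy x δ 0<δ) (cauchy y δ 0<δ)
  where
  open ℚ.≤-Reasoning
  open +-*-Solver
  η = ½ ℚ.* ε
  q = ½ ℚ.* η
  δ = ½ ℚ.* q
  0<η = half>0 0<ε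
  0<q = half>0 0<η
  0<δ = half>0 0<q
  result : (∃ λ N → ∀ m n → N ≤ m → N ≤ n → ℚ.∣ seq x m ℚ.- seq x n ∣ ℚ.≤ δ) →
           (∃ λ N → ∀ m n → N ≤ m → N ≤ n → ℚ.∣ seq y m ℚ.- seq y n ∣ ℚ.≤ δ) →
           (∃ λ N → ∀ n → N ≤ n → seq x n ℚ.≤ seq y n ℚ.+ ε) ⊎ y <ℝ x
  result (N₁ , x-close) (N₂ , y-close) with ℚ.≤-total (seq x (N₁ ℕ.⊔ N₂)) (seq y (N₁ ℕ.⊔ N₂) ℚ.+ η)
  ... | inj₁ le = inj₁ (N , λ n N≤n → begin
    seq x n
      ≤⟨ close⇒≤ (seq x n) (seq x N) (x-close n N (ℕ.m⊔n≤o⇒m≤o N₁ N₂ N≤n) (ℕ.m≤m⊔n N₁ N₂)) ⟩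
    seq x N ℚ.+ δ                 ≤⟨ ℚ.+-monoˡ-≤ δ le ⟩
    seq y N ℚ.+ η ℚ.+ δ
      ≤⟨ ℚ.+-monoˡ-≤ δ (ℚ.+-monoˡ-≤ η
          (close⇒≤ (seq y N) (seq y n) (y-close N n (ℕ.m≤n⊔m N₁ N₂) (ℕ.m⊔n≤o⇒n≤o N₁ N₂ N≤n)))) ⟩
    seq y n ℚ.+ δ ℚ.+ η ℚ.+ δ
      ≡⟨ solve 3 (λ a d e → a :+ d :+ e :+ d := a :+ (e :+ (d :+ d))) refl (seq y n) δ η ⟩
    seq y n ℚ.+ (η ℚ.+ (δ ℚ.+ δ)) ≡⟨ cong (λ t → seq y n ℚ.+ (η ℚ.+ t)) (half+half q) ⟩
    seq y n ℚ.+ (η ℚ.+ q)         ≤⟨ ℚ.+-monoʳ-≤ (seq y n) (ℚ.+-monoʳ-≤ η (ℚ.<⇒≤ (p<p+q q 0<q))) ⟩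
    seq y n ℚ.+ (η ℚ.+ (q ℚ.+ q)) ≡⟨ cong (λ t → seq y n ℚ.+ (η ℚ.+ t)) (half+half η) ⟩
    seq y n ℚ.+ (η ℚ.+ η)         ≡⟨ cong (seq y n ℚ.+_) (half+half ε) ⟩
    seq y n ℚ.+ ε                 ∎)
    where N = N₁ ℕ.⊔ N₂
  ... | inj₂ ge = inj₂ (q , 0<q , N , λ n N≤n → begin
    seq y n ℚ.+ q
      ≤⟨ ℚ.+-monoˡ-≤ q (close⇒≤ (seq y n) (seq y N)
          (y-close n N (ℕ.m⊔n≤o⇒n≤o N₁ N₂ N≤n) (ℕ.m≤n⊔m N₁ N₂))) ⟩
    seq y N ℚ.+ δ ℚ.+ q
      ≡⟨ solve 3 (λ a d q → a :+ d :+ q := a :+ (q :+ q) :+ d :- q) refl (seq y N) δ q ⟩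
    seq y N ℚ.+ (q ℚ.+ q) ℚ.+ δ ℚ.- q   ≡⟨ cong (λ t → seq y N ℚ.+ t ℚ.+ δ ℚ.- q) (half+half η) ⟩
    seq y N ℚ.+ η ℚ.+ δ ℚ.- q           ≤⟨ ℚ.+-monoˡ-≤ (ℚ.- q) (ℚ.+-monoˡ-≤ δ ge) ⟩
    seq x N ℚ.+ δ ℚ.- q
      ≤⟨ ℚ.+-monoˡ-≤ (ℚ.- q) (ℚ.+-monoˡ-≤ δ
          (close⇒≤ (seq x N) (seq x n) (x-close N n (ℕ.m≤m⊔n N₁ N₂) (ℕ.m⊔n≤o⇒m≤o N₁ N₂ N≤n)))) ⟩
    seq x n ℚ.+ δ ℚ.+ δ ℚ.- q
      ≡⟨ solve 3 (λ a d q → a :+ d :+ d :- q := a :+ (d :+ d) :- q) refl (seq x n) δ q ⟩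
    seq x n ℚ.+ (δ ℚ.+ δ) ℚ.- q         ≡⟨ cong (λ t → seq x n ℚ.+ t ℚ.- q) (half+half q) ⟩
    seq x n ℚ.+ q ℚ.- q                 ≡⟨ solve 2 (λ a q → a :+ q :- q := a) refl (seq x n) q ⟩
    seq x n                             ∎)
    where N = N₁ ℕ.⊔ N₂

≤ℝ-stable : ∀ {x y} → ¬ ¬ x ≤ℝ y → x ≤ℝ y
≤ℝ-stable {x} {y} ¬¬le ε 0<ε =
  [ id , (λ y<x → ⊥-elim (¬¬le (<ℝ⇒≱ℝ {y} {x} y<x))) ]′ (≤ℝ-split x y ε 0<ε)

≰ℝ⇒≥ℝ : ∀ {x y} → ¬ x ≤ℝ y → y ≤ℝ x
≰ℝ⇒≥ℝ {x} {y} ¬le ε 0<ε =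
  [ id , (λ x<y → ⊥-elim (¬le (<ℝ⇒≤ℝ {x} {y} x<y))) ]′ (≤ℝ-split y x ε 0<ε)

-- Only the negative form of x ≤ y ⊔ z ⇒ x ≤ y or x ≤ z holds constructively.
≤ℝ-⊔ℝ-split : ∀ {x y z} → x ≤ℝ y ⊔ℝ z → ¬ x ≤ℝ y → ¬ x ≤ℝ z → ⊥
≤ℝ-⊔ℝ-split {x} {y} {z} x≤ x≰y x≰z = x≰y (via y (≤ℝ-refl {y}) (≰ℝ⇒≥ℝ {y} {z} y≰z))
  where
  via : ∀ w → y ≤ℝ w → z ≤ℝ w → x ≤ℝ w
  via w y≤ z≤ = ≤ℝ-trans {x} {y ⊔ℝ z} {w} x≤ (⊔ℝ-lub {y} {z} {w} y≤ z≤)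
  y≰z : ¬ y ≤ℝ z
  y≰z y≤z = x≰z (via z y≤z (≤ℝ-refl {z}))

-- Natural numbers as rational and as real numbers

-- The embedding of ℕ in ℚ; fromℕ n is the constant sequence with value ι n.
ι : ℕ → ℚ
ι n = + n ℚ./ 1

toℚᵘ-/ : ∀ a k → ℚ.toℚᵘ (+ a ℚ./ suc k) ℚᵘ.≃ ℚᵘ.mkℚᵘ (+ a) k
toℚᵘ-/ a k = ℚ.toℚᵘ-fromℚᵘ (ℚᵘ.mkℚᵘ (+ a) k)

/-mono-≤ : ∀ a c k m → a ℕ.* suc m ≤ c ℕ.* suc k → + a ℚ./ suc k ℚ.≤ + c ℚ./ suc m
/-mono-≤ a c k m le = ℚ.toℚᵘ-cancel-≤ (begin
  ℚ.toℚᵘ (+ a ℚ./ suc k)  ≃⟨ toℚᵘ-/ a k ⟩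
  ℚᵘ.mkℚᵘ (+ a) k         ≤⟨ ℚᵘ.*≤* (subst₂ ℤ._≤_ (ℤ.pos-* a (suc m)) (ℤ.pos-* c (suc k)) (ℤ.+≤+ le)) ⟩
  ℚᵘ.mkℚᵘ (+ c) m         ≃⟨ toℚᵘ-/ c m ⟨
  ℚ.toℚᵘ (+ c ℚ./ suc m)  ∎)
  where open ℚᵘ.≤-Reasoning

ι-mono-≤ : ∀ {m n} → m ≤ n → ι m ℚ.≤ ι n
ι-mono-≤ {m} {n} m≤n = /-mono-≤ m n 0 0 (ℕ.*-monoˡ-≤ 1 m≤n)

ι-cancel-≤ : ∀ {m n} → ι m ℚ.≤ ι n → m ≤ n
ι-cancel-≤ {m} {n} le with ℚᵘ.≤-trans (ℚᵘ.≤-respˡ-≃ (toℚᵘ-/ m 0) (ℚ.toℚᵘ-mono-≤ le))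
    (ℚᵘ.≤-reflexive (toℚᵘ-/ n 0))
... | ℚᵘ.*≤* p = ℤ.drop‿+≤+ (subst₂ ℤ._≤_ (ℤ.*-identityʳ (+ m)) (ℤ.*-identityʳ (+ n)) p)

ι-+ : ∀ m n → ι (m ℕ.+ n) ≡ ι m ℚ.+ ι n
ι-+ m n = ℚ.toℚᵘ-injective (begin
  ℚ.toℚᵘ (ι (m ℕ.+ n))                     ≈⟨ toℚᵘ-/ (m ℕ.+ n) 0 ⟩
  ℚᵘ.mkℚᵘ (+ (m ℕ.+ n)) 0
    ≈⟨ ℚᵘ.*≡* (cong (ℤ._* + 1) (sym (cong₂ ℤ._+_ (ℤ.*-identityʳ (+ m)) (ℤ.*-identityʳ (+ n))))) ⟩
  ℚᵘ.mkℚᵘ (+ m) 0 ℚᵘ.+ ℚᵘ.mkℚᵘ (+ n) 0     ≈⟨ ℚᵘ.+-cong (toℚᵘ-/ m 0) (toℚᵘ-/ n 0) ⟨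
  ℚ.toℚᵘ (ι m) ℚᵘ.+ ℚ.toℚᵘ (ι n)           ≈⟨ ℚ.toℚᵘ-homo-+ (ι m) (ι n) ⟨
  ℚ.toℚᵘ (ι m ℚ.+ ι n)                     ∎)
  where open SetoidReasoning ℚᵘ.≃-setoid

ι-* : ∀ m n → ι (m ℕ.* n) ≡ ι m ℚ.* ι n
ι-* m n = ℚ.toℚᵘ-injective (begin
  ℚ.toℚᵘ (ι (m ℕ.* n))                     ≈⟨ toℚᵘ-/ (m ℕ.* n) 0 ⟩
  ℚᵘ.mkℚᵘ (+ (m ℕ.* n)) 0                  ≈⟨ ℚᵘ.*≡* (cong (ℤ._* + 1) (ℤ.pos-* m n)) ⟩
  ℚᵘ.mkℚᵘ (+ m) 0 ℚᵘ.* ℚᵘ.mkℚᵘ (+ n) 0     ≈⟨ ℚᵘ.*-cong (toℚᵘ-/ m 0) (toℚᵘ-/ n 0) ⟨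
  ℚ.toℚᵘ (ι m) ℚᵘ.* ℚ.toℚᵘ (ι n)           ≈⟨ ℚ.toℚᵘ-homo-* (ι m) (ι n) ⟨
  ℚ.toℚᵘ (ι m ℚ.* ι n)                     ∎)
  where open SetoidReasoning ℚᵘ.≃-setoid

/-*-cancel : ∀ a k → (+ a ℚ./ suc k) ℚ.* ι (suc k) ≡ ι a
/-*-cancel a k = ℚ.toℚᵘ-injective (begin
  ℚ.toℚᵘ ((+ a ℚ./ suc k) ℚ.* ι (suc k))   ≈⟨ ℚ.toℚᵘ-homo-* (+ a ℚ./ suc k) (ι (suc k)) ⟩
  ℚ.toℚᵘ (+ a ℚ./ suc k) ℚᵘ.* ℚ.toℚᵘ (ι (suc k)) ≈⟨ ℚᵘ.*-cong (toℚᵘ-/ a k) (toℚᵘ-/ (suc k) 0) ⟩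
  ℚᵘ.mkℚᵘ (+ a) k ℚᵘ.* ℚᵘ.mkℚᵘ (+ suc k) 0
    ≈⟨ ℚᵘ.*≡* (trans (ℤ.*-identityʳ _) (cong (λ t → + a ℤ.* + suc t) (sym (ℕ.*-identityʳ k)))) ⟩
  ℚᵘ.mkℚᵘ (+ a) 0                          ≈⟨ toℚᵘ-/ a 0 ⟨
  ℚ.toℚᵘ (ι a)                             ∎)
  where open SetoidReasoning ℚᵘ.≃-setoid

ι-⊔ : ∀ k m n → k ≤ m ⊔ n → ι k ℚ.≤ ι m ℚ.⊔ ι n
ι-⊔ k m n le = [ (λ eq → ℚ.≤-trans (ι-mono-≤ (subst (k ≤_) eq le)) (ℚ.p≤p⊔q (ι m) (ι n)))
                     , (λ eq → ℚ.≤-trans (ι-mono-≤ (subst (k ≤_) eq le)) (ℚ.p≤q⊔p (ι m) (ι n))) ]′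
                         (ℕ.⊔-sel m n)

fromℕ-mono-≤ : ∀ m n → m ≤ n → fromℕ m ≤ℝ fromℕ n
fromℕ-mono-≤ m n m≤n = pointwise-≤ {fromℕ m} {fromℕ n} λ _ → ι-mono-≤ m≤n

0<ι : ∀ {n} → 1 ≤ n → 0ℚ ℚ.< ι n
0<ι 1≤n = ℚ.<-≤-trans 0<1 (ι-mono-≤ 1≤n)

fromℕ-mono-< : ∀ m n → m < n → fromℕ m <ℝ fromℕ n
fromℕ-mono-< m n m<n = 1ℚ , 0<1 , 0 , λ _ _ →
  ℚ.≤-trans (ℚ.≤-reflexive (trans (sym (ι-+ m 1)) (cong ι (ℕ.+-comm m 1)))) (ι-mono-≤ m<n)

fromℕ-cancel-≤ : ∀ m n → fromℕ m ≤ℝ fromℕ n → m ≤ n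
fromℕ-cancel-≤ m n le = ℕ.≮⇒≥ λ n<m → <ℝ⇒≱ℝ {fromℕ n} {fromℕ m} (fromℕ-mono-< n m n<m) le

archimedean : ∀ x → ∃ λ K → x ≤ℝ fromℕ K
archimedean x = fromBound (bounded x)
  where
  open ℚ.≤-Reasoning
  p≤∣p∣ : ∀ p → p ℚ.≤ ℚ.∣ p ∣
  p≤∣p∣ p = [ (λ 0≤p → ℚ.≤-reflexive (sym (ℚ.0≤p⇒∣p∣≡p 0≤p)))
            , (λ p≤0 → ℚ.≤-trans p≤0 (ℚ.0≤∣p∣ p)) ]′ (ℚ.≤-total 0ℚ p)

  ceil : ∀ q → ∃ λ k → q ℚ.≤ ι k
  ceil (ℚ.mkℚ (+ n) d c) = n , ℚ.toℚᵘ-cancel-≤ {ℚ.mkℚ (+ n) d c} (ℚᵘ.≤-trans {ℚᵘ.mkℚᵘ (+ n) d}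
    (ℚᵘ.*≤* (ℤ.*-monoˡ-≤-nonNeg (+ n) (ℤ.+≤+ (s≤s z≤n))))
    (ℚᵘ.≤-reflexive (ℚᵘ.≃-sym (toℚᵘ-/ n 0))))
  ceil (ℚ.mkℚ ℤ.-[1+ n ] d _) = 0 , ℚ.*≤* ℤ.-≤+

  fromBound : (∃ λ K → 0ℚ ℚ.< K × ∃ λ N → ∀ n → N ≤ n → ℚ.∣ seq x n ∣ ℚ.≤ K) →
              ∃ λ K → x ≤ℝ fromℕ K
  fromBound (K , 0<K , N , le) = proj₁ (ceil K) , λ ε 0<ε → N , λ n N≤n → begin
    seq x n                  ≤⟨ p≤∣p∣ (seq x n) ⟩
    ℚ.∣ seq x n ∣            ≤⟨ le n N≤n ⟩
    K                        ≤⟨ proj₂ (ceil K) ⟩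
    ι (proj₁ (ceil K))       ≤⟨ ℚ.<⇒≤ (p<p+q _ 0<ε) ⟩
    ι (proj₁ (ceil K)) ℚ.+ ε ∎

-- Integer parts

-- k is the integer part of x.
IsFloor : ℕ → ℝ → Set
IsFloor k x = fromℕ k ≤ℝ x × ¬ fromℕ (suc k) ≤ℝ x

¬¬floor : ∀ {x} → 0ℝ ≤ℝ x → ¬ ¬ ∃ λ k → IsFloor k x
¬¬floor {x} 0≤x none = <ℝ⇒≱ℝ {fromℕ K} {fromℕ (suc K)} (fromℕ-mono-< K (suc K) (ℕ.n<1+n K))
                  (≤ℝ-trans {fromℕ (suc K)} {x} {fromℕ K} (all≤ (suc K)) (proj₂ (archimedean x)))
  where
  K = proj₁ (archimedean x)
  all≤ : ∀ k → fromℕ k ≤ℝ x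
  all≤ zero    = 0≤x
  all≤ (suc k) = ≤ℝ-stable {fromℕ (suc k)} {x} λ ¬le → none (k , all≤ k , ¬le)

-- Sums of real numbers

sumℝ-fromℕ : ∀ {A : Set} (f : A → ℝ) (g : A → ℕ) → (∀ a → f a ≃ fromℕ (g a)) →
             ∀ as → sumℝ f as ≃ fromℕ (sum (map g as))
sumℝ-fromℕ f g eq []       = ≃-refl {0ℝ}
sumℝ-fromℕ f g eq (a ∷ as) with eq a | sumℝ-fromℕ f g eq as
... | p , q | r , s = ≃-trans {f a +ℝ sumℝ f as} {fromℕ (g a) +ℝ fromℕ T} {fromℕ (g a ℕ.+ T)}
  (+ℝ-mono-≤ {f a} {fromℕ (g a)} {sumℝ f as} {fromℕ T} p r ,
   +ℝ-mono-≤ {fromℕ (g a)} {f a} {fromℕ T} {sumℝ f as} q s)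
  (pointwise-≃ {fromℕ (g a) +ℝ fromℕ T} {fromℕ (g a ℕ.+ T)} λ _ → sym (ι-+ (g a) T))
  where T = sum (map g as)

sumℝ-mono-≤ : ∀ {A : Set} (f g : A → ℝ) → (∀ a → f a ≤ℝ g a) → ∀ as → sumℝ f as ≤ℝ sumℝ g as
sumℝ-mono-≤ f g le []       = ≤ℝ-refl {0ℝ}
sumℝ-mono-≤ f g le (a ∷ as) =
  +ℝ-mono-≤ {f a} {g a} {sumℝ f as} {sumℝ g as} (le a) (sumℝ-mono-≤ f g le as)

1ℝ*ℝ : ∀ x → 1ℝ *ℝ x ≃ x
1ℝ*ℝ x = pointwise-≃ {1ℝ *ℝ x} {x} λ n → ℚ.*-identityˡ (seq x n)

-- Bounds on the binary logarithm

-- The bounds hold for every term of the sequence that defines log₂.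
≤log₂ : ∀ h n → 2 ℕ.^ h ≤ suc n → ∀ k → ι h ℚ.≤ seq (log₂ (suc n)) k
≤log₂ h n le k = /-mono-≤ h ⌊log₂ power n k ⌋ 0 k (begin
  h ℕ.* suc k                        ≡⟨ ⌊log₂[2^n]⌋≡n (h ℕ.* suc k) ⟨
  ⌊log₂ (2 ℕ.^ (h ℕ.* suc k)) ⌋      ≡⟨ cong ⌊log₂_⌋ (ℕ.^-*-assoc 2 h (suc k)) ⟨
  ⌊log₂ ((2 ℕ.^ h) ℕ.^ suc k) ⌋      ≤⟨ ⌊log₂⌋-mono-≤ (ℕ.^-monoˡ-≤ (suc k) le) ⟩
  ⌊log₂ power n k ⌋                  ≡⟨ ℕ.*-identityʳ _ ⟨
  ⌊log₂ power n k ⌋ ℕ.* 1            ∎)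
  where open ℕ.≤-Reasoning

log₂≤ : ∀ h n → suc n ≤ 2 ℕ.^ h → ∀ k → seq (log₂ (suc n)) k ℚ.≤ ι h
log₂≤ h n le k = /-mono-≤ ⌊log₂ power n k ⌋ h k 0 (begin
  ⌊log₂ power n k ⌋ ℕ.* 1            ≡⟨ ℕ.*-identityʳ _ ⟩
  ⌊log₂ power n k ⌋                  ≤⟨ ⌊log₂⌋-mono-≤ (ℕ.^-monoˡ-≤ (suc k) le) ⟩
  ⌊log₂ ((2 ℕ.^ h) ℕ.^ suc k) ⌋      ≡⟨ cong ⌊log₂_⌋ (ℕ.^-*-assoc 2 h (suc k)) ⟩
  ⌊log₂ (2 ℕ.^ (h ℕ.* suc k)) ⌋      ≡⟨ ⌊log₂[2^n]⌋≡n (h ℕ.* suc k) ⟩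
  h ℕ.* suc k                        ∎)
  where open ℕ.≤-Reasoning

-- Finite search and lists

least : {P : ℕ → Set} → (∀ k → Dec (P k)) → ∃ P → ∃ λ m → P m × ∀ k → P k → m ≤ k
least {P} P? (k , p) = search k 0 (λ _ _ → z≤n) (subst P (sym (ℕ.+-identityʳ k)) p)
  where
  search : ∀ fuel m → (∀ k → P k → m ≤ k) → P (fuel ℕ.+ m) → ∃ λ m → P m × ∀ k → P k → m ≤ k
  search zero       m low p = m , p , low
  search (suc fuel) m low p with P? m
  ... | yes q = m , q , low
  ... | no ¬q = search fuel (suc m)
          (λ k q → ℕ.≤∧≢⇒< (low k q) λ { refl → ¬q q })
          (subst P (sym (ℕ.+-suc fuel m)) p)

-- Double negation commutes with finite conjunctions.
¬¬-∀ : ∀ {n} {P : Fin n → Set} → (∀ i → ¬ ¬ P i) → ¬ ¬ (∀ i → P i)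
¬¬-∀ {zero}  _   k = k λ ()
¬¬-∀ {suc n} ¬¬p k = ¬¬p zero λ p → ¬¬-∀ (¬¬p ∘ suc) λ ps →
  k λ { zero → p ; (suc i) → ps i }

bounded-Fin : ∀ {n} (f : Fin n → ℕ) → ∃ λ K → ∀ i → f i ≤ K
bounded-Fin {zero}  f = 0 , λ ()
bounded-Fin {suc n} f with bounded-Fin (f ∘ suc)
... | K , le = f zero ⊔ K , λ where
  zero    → ℕ.m≤m⊔n (f zero) K
  (suc i) → ℕ.≤-trans (le i) (ℕ.m≤n⊔m (f zero) K)

unique-↭ : {A : Set} {xs ys : List A} → Unique xs → Unique ys →
           (∀ {x} → x ∈ xs → x ∈ ys) → (∀ {x} → x ∈ ys → x ∈ xs) → xs ↭ ys
unique-↭ u v f g = ∼bag⇒↭ (unique∧set⇒bag u v (mk⇔ f g))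

↭-unique : {A : Set} {xs ys : List A} → xs ↭ ys → Unique xs → Unique ys
↭-unique p = ↭ₛ.Unique-resp-↭ (setoid _) (↭⇒↭ₛ p)

length-⊆ : {A : Set} {xs ys : List A} → Unique xs → (∀ {x} → x ∈ xs → x ∈ ys) → length xs ≤ length ys
length-⊆ {xs = []}     _        _  = z≤n
length-⊆ {A} {xs = x ∷ xs} u@(_ ∷ u′) xs⊆ with ∈-∃++ (xs⊆ (here refl))
... | as , bs , refl = begin
  suc (length xs)                ≤⟨ s≤s (length-⊆ u′ remove) ⟩
  suc (length (as ++ bs))        ≡⟨ cong suc (length-++ as) ⟩
  suc (length as ℕ.+ length bs)  ≡⟨ ℕ.+-suc (length as) (length bs) ⟨
  length as ℕ.+ suc (length bs)  ≡⟨ length-++ as ⟨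
  length (as ++ x ∷ bs)          ∎
  where
  open ℕ.≤-Reasoning
  remove : ∀ {y} → y ∈ xs → y ∈ as ++ bs
  remove y∈xs with ∈-++⁻ as (xs⊆ (there y∈xs))
  ... | inj₁ y∈as         = ∈-++⁺ˡ y∈as
  ... | inj₂ (there y∈bs) = ∈-++⁺ʳ as y∈bs
  ... | inj₂ (here refl)  = ⊥-elim (Unique[x∷xs]⇒x∉xs u y∈xs)

-- Binary trees

-- leaves is computed with an accumulator.
leaves-acc : ∀ {n} (t : BinaryTree n) xs → Binary.Leaves.toDiffList t xs ≡ leaves t ++ xs
leaves-acc (Binary.leaf x)     xs = refl
leaves-acc (Binary.node l _ r) xs = begin
  Binary.Leaves.toDiffList l (Binary.Leaves.toDiffList r xs) ≡⟨ leaves-acc l _ ⟩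
  leaves l ++ Binary.Leaves.toDiffList r xs                  ≡⟨ cong (leaves l ++_) (leaves-acc r xs) ⟩
  leaves l ++ leaves r ++ xs                                 ≡⟨ ++-assoc (leaves l) (leaves r) xs ⟨
  (leaves l ++ leaves r) ++ xs                               ≡⟨ cong (_++ xs) (leaves-acc l (leaves r)) ⟨
  leaves (Binary.node l _ r) ++ xs                           ∎
  where open ≡-Reasoning

leaves-node : ∀ {n} (l r : BinaryTree n) {u} → leaves (Binary.node l u r) ≡ leaves l ++ leaves r
leaves-node l r = leaves-acc l (leaves r)

length-leaves-node : ∀ {n} (l r : BinaryTree n) {u} →
                     length (leaves (Binary.node l u r)) ≡ length (leaves l) ℕ.+ length (leaves r)
length-leaves-node l r = trans (cong length (leaves-node l r)) (length-++ (leaves l))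

depth : ∀ {n} → BinaryTree n → ℕ
depth (Binary.leaf _)     = 0
depth (Binary.node l _ r) = suc (depth l ⊔ depth r)

depth<leaves : ∀ {n} (t : BinaryTree n) → depth t < length (leaves t)
depth<leaves (Binary.leaf _)     = s≤s z≤n
depth<leaves (Binary.node l u r) = subst (suc (depth (Binary.node l u r)) ≤_)
    (sym (length-leaves-node l r))
  (ℕ.≤-trans (s≤s (s≤s (ℕ.⊔-lub (ℕ.m≤m+n (depth l) (depth r)) (ℕ.m≤n+m (depth r) (depth l)))))
    (ℕ.≤-trans (ℕ.≤-reflexive (cong suc (sym (ℕ.+-suc (depth l) (depth r)))))
       (ℕ.+-mono-≤ (depth<leaves l) (depth<leaves r))))

-- All binary trees of depth at most d with leaves in Fin n.
trees : ∀ {n} → ℕ → List (BinaryTree n)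
trees {n} zero    = map Binary.leaf (allFin n)
trees {n} (suc d) = map Binary.leaf (allFin n) ++
                    cartesianProductWith (λ l r → Binary.node l tt r) (trees d) (trees d)

∈-trees : ∀ {n} (t : BinaryTree n) d → depth t ≤ d → t ∈ trees d
∈-trees (Binary.leaf x) zero    _ = ∈-map⁺ _ (∈-allFin x)
∈-trees (Binary.leaf x) (suc d) _ = ∈-++⁺ˡ (∈-map⁺ _ (∈-allFin x))
∈-trees {n} (Binary.node l _ r) (suc d) (s≤s le) = ∈-++⁺ʳ (map Binary.leaf (allFin n))
  (∈-cartesianProductWith⁺ _ (∈-trees l d (ℕ.m⊔n≤o⇒m≤o (depth l) _ le))
                             (∈-trees r d (ℕ.m⊔n≤o⇒n≤o (depth l) _ le)))

↭-allFin? : ∀ {n} (xs : List (Fin n)) → Dec (xs ↭ allFin n)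
↭-allFin? {n} xs = map′
  (λ (u , c) → unique-↭ u (Unique.allFin⁺ n) (λ _ → ∈-allFin _) (λ {i} _ → c i))
  (λ p → ↭-unique (↭-sym p) (Unique.allFin⁺ n) , λ i → ↭.∈-resp-↭ (↭-sym p) (∈-allFin i))
  (UniqueDec.unique? Fin._≟_ xs ×-dec Fin.all? λ i → i ∈ᴸ? xs)

-- hierarchyHeight for a tree in which vertices may be missing or repeated.
treeHeight : ∀ {n} → BinaryTree n → Fin n → Fin n → ℕ
treeHeight t x y = if does (x Fin.≟ y) then 0 else length (leaves (lcaSubtree t x y)) ∸ 1

-- The existence of the two optima

sum-mono : ∀ {A : Set} {f g : A → ℕ} → (∀ a → f a ≤ g a) → ∀ as → sum (map f as) ≤ sum (map g as)
sum-mono le []       = z≤n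
sum-mono le (a ∷ as) = ℕ.+-mono-≤ (le a) (sum-mono le as)

module _ (G : Graph) where
  open Graph G

  -- The cost of an integral function of pairs when all weights are 1.
  edgeCost : (V → V → ℕ) → ℕ
  edgeCost f = sum (map (λ (x , y) → f x y) edges)

  -- f is an integral ultrametric with f ≥ dist.  That f separates points is not
  -- required because dist does.
  record DominatingUltra (f : V → V → ℕ) : Set where
    constructor dominating
    field
      diagonal  : ∀ x → f x x ≡ 0
      symmetric : ∀ x y → f x y ≡ f y x
      ultra     : ∀ x y z → f x z ≤ f x y ⊔ f y z
      dominates : ∀ x y → dist x y ≤ f x y

  dominatingUltra? : ∀ f → Dec (DominatingUltra f)
  dominatingUltra? f = map′
    (λ (a , b , c , d) → dominating a b c d)
    (λ (dominating a b c d) → a , b , c , d)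
    (Fin.all? (λ x → f x x ℕ.≟ 0) ×-dec
     Fin.all? (λ x → Fin.all? λ y → f x y ℕ.≟ f y x) ×-dec
     Fin.all? (λ x → Fin.all? λ y → Fin.all? λ z → f x z ℕ.≤? f x y ⊔ f y z) ×-dec
     Fin.all? (λ x → Fin.all? λ y → dist x y ℕ.≤? f x y))

  dominatingUltra-cong : ∀ {f g} → (∀ x y → f x y ≡ g x y) → DominatingUltra f → DominatingUltra g
  dominatingUltra-cong {f} {g} f≗g (dominating a b c d) = dominating
    (λ x → trans (sym (f≗g x x)) (a x))
    (λ x y → trans (sym (f≗g x y)) (trans (b x y) (f≗g y x)))
    (λ x y z → subst₂ _≤_ (f≗g x z) (cong₂ _⊔_ (f≗g x y) (f≗g y z)) (c x y z))
    (λ x y → subst (dist x y ≤_) (f≗g x y) (d x y))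

  edgeCost-cong : ∀ {f g} → (∀ x y → f x y ≡ g x y) → edgeCost f ≡ edgeCost g
  edgeCost-cong f≗g = cong sum (map-cong (λ (x , y) → f≗g x y) edges)

  edgeCost-mono : ∀ {f g} → (∀ x y → f x y ≤ g x y) → edgeCost f ≤ edgeCost g
  edgeCost-mono f≤g = sum-mono (λ (x , y) → f≤g x y) edges

  dist≡0 : ∀ {x y} → dist x y ≡ 0 → x ≡ y
  dist≡0 {x} {y} eq with subst (Walk x y) eq (proj₁ (proj₂ (shortest x y)))
  ... | [] = refl

  dist≤ : ∀ {x y k} → Walk x y k → dist x y ≤ k
  dist≤ {x} {y} w = proj₂ (proj₂ (shortest x y)) _ w

  -- The integer part of u inherits the ultrametric inequality because rounding
  -- down is monotone, and it dominates because distances are integers.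
  ¬¬integerPart : ∀ {u} → IsUltrametric G u → (∀ x y → fromℕ (dist x y) ≤ℝ u x y) →
                  ¬ ¬ ∃ λ f → DominatingUltra f × ∀ x y → fromℕ (f x y) ≤ℝ u x y
  ¬¬integerPart {u} um dom none =
    ¬¬-∀ (λ x → ¬¬-∀ (λ y → ¬¬floor {u x y} (nonNegative {x} {y}))) λ fl →
      none ((λ x y → proj₁ (fl x y)) , fromFloor _ (λ x y → proj₂ (fl x y)) , λ x y → proj₁
          (proj₂ (fl x y)))
    where
    open IsGeneralMetric um using (nonNegative; ≈⇒0; triangle) renaming (sym to u-sym)
    fromFloor : ∀ f → (∀ x y → IsFloor (f x y) (u x y)) → DominatingUltra f
    fromFloor f fl = dominating
      (λ x → ℕ.n<1⇒n≡0 (below (f x x) x x 1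
          (λ le → fromℕ1≰0 (≤ℝ-trans {fromℕ 1} {u x x} {0ℝ} le (proj₁ (≈⇒0 {x} {x} refl))))
              (proj₁ (fl x x))))
      (λ x y → ℕ.≤-antisym (sym-≤ x y) (sym-≤ y x))
      (λ x y z → ℕ.≮⇒≥ λ lt → ≤ℝ-⊔ℝ-split {fromℕ (suc (f x y ⊔ f y z))} {u x y} {u y z}
        (≤ℝ-trans {fromℕ (suc (f x y ⊔ f y z))} {u x z} {u x y ⊔ℝ u y z}
          (≤ℝ-trans {fromℕ (suc (f x y ⊔ f y z))} {fromℕ (f x z)} {u x z}
              (fromℕ-mono-≤ (suc (f x y ⊔ f y z)) (f x z) lt) (proj₁ (fl x z)))
          (triangle x y z))
        (λ le → proj₂ (fl x y) (≤ℝ-trans {fromℕ (suc (f x y))} {fromℕ (suc (f x y ⊔ f y z))} {u x y}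
           (fromℕ-mono-≤ (suc (f x y)) (suc (f x y ⊔ f y z)) (s≤s (ℕ.m≤m⊔n (f x y) (f y z)))) le))
        (λ le → proj₂ (fl y z) (≤ℝ-trans {fromℕ (suc (f y z))} {fromℕ (suc (f x y ⊔ f y z))} {u y z}
           (fromℕ-mono-≤ (suc (f y z)) (suc (f x y ⊔ f y z)) (s≤s (ℕ.m≤n⊔m (f x y) (f y z)))) le)))
      (λ x y → ℕ.≤-pred (below (dist x y) x y (suc (f x y)) (proj₂ (fl x y)) (dom x y)))
      where
      fromℕ1≰0 : ¬ fromℕ 1 ≤ℝ 0ℝ
      fromℕ1≰0 le = ℕ.1+n≰n (fromℕ-cancel-≤ 1 0 le)
      below : ∀ k x y m → ¬ fromℕ m ≤ℝ u x y → fromℕ k ≤ℝ u x y → k < m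
      below k x y m m≰u k≤u = ℕ.≰⇒> λ m≤k → m≰u
          (≤ℝ-trans {fromℕ m} {fromℕ k} {u x y} (fromℕ-mono-≤ m k m≤k) k≤u)
      sym-≤ : ∀ x y → f x y ≤ f y x
      sym-≤ x y = ℕ.≤-pred (below (f x y) y x (suc (f y x)) (proj₂ (fl y x))
        (≤ℝ-trans {fromℕ (f x y)} {u x y} {u y x} (proj₁ (fl x y)) (proj₁ (u-sym x y))))

  truncate : ∀ {f} K → (∀ x y → dist x y ≤ K) → DominatingUltra f → DominatingUltra (λ x y → f x y ⊓ K)
  truncate {f} K dist≤K (dominating a b c d) = dominating
    (λ x → cong (_⊓ K) (a x))
    (λ x y → cong (_⊓ K) (b x y))
    (λ x y z → ℕ.≤-trans (ℕ.⊓-monoˡ-≤ K (c x y z)) (ℕ.≤-reflexive (ℕ.⊓-distribʳ-⊔ K (f x y) (f y z))))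
    (λ x y → ℕ.⊓-glb (d x y) (dist≤K x y))

  diameter : ∃ λ K → ∀ x y → dist x y ≤ K
  diameter = let K , le = bounded-Fin (λ x → proj₁ (bounded-Fin (dist x)))
             in K , λ x y → ℕ.≤-trans (proj₂ (bounded-Fin (dist x)) y) (le x)

  module _ (K : ℕ) where
    -- Codes of the functions V → V → ℕ with values at most K.
    Code : Set
    Code = Fin ((suc K ℕ.^ order) ℕ.^ order)

    decode : Code → V → V → ℕ
    decode c x y = toℕ (finToFun {suc K} (finToFun {suc K ℕ.^ order} c x) y)

    encode : ∀ (f : V → V → ℕ) → (∀ x y → f x y ≤ K) → ∃ λ c → ∀ x y → f x y ≡ decode c x y
    encode f f≤K = funToFin rows , λ x y → begin
      f x y                                         ≡⟨ Fin.toℕ-fromℕ< (s≤s (f≤K x y)) ⟨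
      toℕ (row x y)                                 ≡⟨ cong toℕ (Fin.finToFun-funToFin (row x) y) ⟨
      toℕ (finToFun (rows x) y)
        ≡⟨ cong (λ r → toℕ (finToFun r y)) (Fin.finToFun-funToFin rows x) ⟨
      decode (funToFin rows) x y                    ∎
      where
      open ≡-Reasoning
      row : V → V → Fin (suc K)
      row x y = fromℕ< (s≤s (f≤K x y))
      rows : V → Fin (suc K ℕ.^ order)
      rows x = funToFin (row x)

  -- The hierarchies that are admissible for OPT-card.
  Dominating : Hierarchy order → Set
  Dominating H = ∀ x y → dist x y ≤ hierarchyHeight H x y

  module _ (unweighted : ∀ x y → weight x y ≡ 1ℝ) where

    edgeSum-fromℕ : ∀ f → edgeSum (λ x y → fromℕ (f x y)) ≃ fromℕ (edgeCost f)
    edgeSum-fromℕ f = sumℝ-fromℕ (λ (x , y) → weight x y *ℝ fromℕ (f x y)) (λ (x , y) → f x y)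
      (λ (x , y) → subst (λ w → w *ℝ fromℕ (f x y) ≃ fromℕ (f x y)) (sym (unweighted x y))
          (1ℝ*ℝ (fromℕ (f x y)))) edges

    edgeSum-mono-≤ : ∀ u v → (∀ x y → u x y ≤ℝ v x y) → edgeSum u ≤ℝ edgeSum v
    edgeSum-mono-≤ u v le = sumℝ-mono-≤ (λ (x , y) → weight x y *ℝ u x y)
        (λ (x , y) → weight x y *ℝ v x y)
      (λ (x , y) → subst (λ w → w *ℝ u x y ≤ℝ w *ℝ v x y) (sym (unweighted x y))
        (≤ℝ-trans {1ℝ *ℝ u x y} {u x y} {1ℝ *ℝ v x y} (proj₁ (1ℝ*ℝ (u x y)))
          (≤ℝ-trans {u x y} {v x y} {1ℝ *ℝ v x y} (le x y) (proj₂ (1ℝ*ℝ (v x y)))))) edges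

    ultra⇒FreeCost : ∀ {f} → DominatingUltra f → FreeCost G (fromℕ (edgeCost f))
    ultra⇒FreeCost {f} (dominating diag symm ult dom) =
        (λ x y → fromℕ (f x y))
      , record
          { isSemiMetric = record
            { isQuasiSemiMetric = record
              { isPreMetric = record
                { isProtoMetric = record
                  { isPartialOrder = record
                    { isPreorder = record
                      { isEquivalence = record
                        { refl  = λ {x} → ≃-refl {x}
                        ; sym   = λ {x} {y} → ≃-sym {x} {y}
                        ; trans = λ {x} {y} {z} → ≃-trans {x} {y} {z} }
                      ; reflexive = proj₁
                      ; trans = λ {x} {y} {z} → ≤ℝ-trans {x} {y} {z} }
                    ; antisym = _,_ }
                  ; ≈-isEquivalence = isEquivalence
                  ; cong = λ { {x} {_} {y} refl refl → ≃-refl {fromℕ (f x y)} }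
                  ; nonNegative = λ {x} {y} → fromℕ-mono-≤ 0 (f x y) z≤n }
                ; ≈⇒0 = λ { {x} refl → subst (λ k → fromℕ k ≃ 0ℝ) (sym (diag x)) (≃-refl {0ℝ}) } }
              ; 0⇒≈ = λ {x} {y} eq → dist≡0
                  (ℕ.n≤0⇒n≡0 (ℕ.≤-trans (dom x y) (fromℕ-cancel-≤ (f x y) 0 (proj₁ eq)))) }
            ; sym = λ x y → subst (λ k → fromℕ (f x y) ≃ fromℕ k) (symm x y) (≃-refl {fromℕ (f x y)}) }
          ; triangle = triangle′ }
      , (λ x y → fromℕ-mono-≤ (dist x y) (f x y) (dom x y))
      , ≃-sym {edgeSum (λ x y → fromℕ (f x y))} {fromℕ (edgeCost f)} (edgeSum-fromℕ f)
      where
      triangle′ : ∀ x y z → fromℕ (f x z) ≤ℝ fromℕ (f x y) ⊔ℝ fromℕ (f y z)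
      triangle′ x y z = pointwise-≤ {fromℕ (f x z)} {fromℕ (f x y) ⊔ℝ fromℕ (f y z)} λ _ → ι-⊔ (f x z)
          (f x y) (f y z) (ult x y z)

    OPT-free-attained : ∃ DominatingUltra →
      ∃ λ f → DominatingUltra f × (∀ g → DominatingUltra g → edgeCost f ≤ edgeCost g) ×
              IsOPT-free G (fromℕ (edgeCost f))
    OPT-free-attained (f₀ , ok₀) = fromLeast
        (least P? (reduce f₀ ok₀ .proj₁ , reduce f₀ ok₀ .proj₂ .proj₁))
      where
      K = proj₁ diameter
      P : ℕ → Set
      P k = ∃ λ c → DominatingUltra (decode K c) × edgeCost (decode K c) ≡ k
      P? : ∀ k → Dec (P k)
      P? k = Fin.any? λ c → dominatingUltra? (decode K c) ×-dec (edgeCost (decode K c) ℕ.≟ k)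
      reduce : ∀ f → DominatingUltra f → ∃ λ k → P k × k ≤ edgeCost f
      reduce f ok = edgeCost g ,
          (proj₁ code , dominatingUltra-cong (proj₂ code) (truncate K (proj₂ diameter) ok) ,
                                  sym (edgeCost-cong (proj₂ code))) , edgeCost-mono
                                      (λ x y → ℕ.m⊓n≤m (f x y) K)
        where
        g = λ x y → f x y ⊓ K
        code = encode K g (λ x y → ℕ.m⊓n≤n (f x y) K)
      fromLeast : (∃ λ m → P m × ∀ k → P k → m ≤ k) →
        ∃ λ f → DominatingUltra f × (∀ g → DominatingUltra g → edgeCost f ≤ edgeCost g) ×
                IsOPT-free G (fromℕ (edgeCost f))
      fromLeast (_ , (c , ok , refl) , low) = f , ok , minimal , ultra⇒FreeCost ok , lower
        where
        f = decode K c
        minimal : ∀ g → DominatingUltra g → edgeCost f ≤ edgeCost g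
        minimal g ok′ = let k , p , k≤ = reduce g ok′ in ℕ.≤-trans (low k p) k≤
        lower : ∀ v → FreeCost G v → fromℕ (edgeCost f) ≤ℝ v
        lower v (u , um , dom , v≃) = ≤ℝ-stable {fromℕ (edgeCost f)} {v} λ ¬le →
          ¬¬integerPart {u} um dom λ (g , ok′ , g≤u) → ¬le
            (≤ℝ-trans {fromℕ (edgeCost f)} {fromℕ (edgeCost g)} {v}
                (fromℕ-mono-≤ (edgeCost f) (edgeCost g) (minimal g ok′))
            (≤ℝ-trans {fromℕ (edgeCost g)} {edgeSum (λ x y → fromℕ (g x y))} {v} (proj₂ (edgeSum-fromℕ g))
            (≤ℝ-trans {edgeSum (λ x y → fromℕ (g x y))} {edgeSum u} {v}
                (edgeSum-mono-≤ (λ x y → fromℕ (g x y)) u g≤u) (proj₂ v≃))))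

    OPT-card-attained : Σ (Hierarchy order) Dominating →
      Σ (Hierarchy order) λ H → Dominating H ×
        (∀ H′ → Dominating H′ → edgeCost (hierarchyHeight H) ≤ edgeCost (hierarchyHeight H′)) ×
        IsOPT-card G (fromℕ (edgeCost (hierarchyHeight H)))
    OPT-card-attained (H₀ , ok₀) = fromLeast (least P? (edgeCost (hierarchyHeight H₀) , H₀ , ok₀ , refl))
      where
      P : ℕ → Set
      P k = Σ (Hierarchy order) λ H → Dominating H × edgeCost (hierarchyHeight H) ≡ k
      Admissible : ℕ → BinaryTree order → Set
      Admissible k t = leaves t ↭ allFin order × (∀ x y → dist x y ≤ treeHeight t x y) × edgeCost
          (treeHeight t) ≡ k
      admissible? : ∀ k t → Dec (Admissible k t)
      admissible? k t = ↭-allFin? (leaves t) ×-dec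
          (Fin.all? λ x → Fin.all? λ y → dist x y ℕ.≤? treeHeight t x y) ×-dec
          (edgeCost (treeHeight t) ℕ.≟ k)
      depth≤ : ∀ t → leaves t ↭ allFin order → depth t ≤ order
      depth≤ t p = ℕ.≤-trans (ℕ.<⇒≤ (depth<leaves t))
        (ℕ.≤-reflexive (trans (↭.↭-length p) (length-tabulate id)))
      height≡ : ∀ H x y → treeHeight (proj₁ H) x y ≡ hierarchyHeight H x y
      height≡ H x y = refl
      toP : ∀ k t → Admissible k t → P k
      toP k t (p , dom , eq) = (t , p) ,
        (λ x y → subst (dist x y ≤_) (height≡ (t , p) x y) (dom x y)) ,
        trans (edgeCost-cong (λ x y → sym (height≡ (t , p) x y))) eq
      fromP : ∀ k → ((H , _) : P k) → Admissible k (proj₁ H)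
      fromP k (H , dom , eq) = proj₂ H ,
        (λ x y → subst (dist x y ≤_) (sym (height≡ H x y)) (dom x y)) ,
        trans (edgeCost-cong (height≡ H)) eq
      P? : ∀ k → Dec (P k)
      P? k = map′ (λ any → toP k (proj₁ (find any)) (proj₂ (proj₂ (find any))))
                  (λ p → lose (∈-trees (proj₁ (proj₁ p)) order
                      (depth≤ (proj₁ (proj₁ p)) (proj₂ (proj₁ p)))) (fromP k p))
                  (any? (admissible? k) (trees order))
      fromLeast : (∃ λ m → P m × ∀ k → P k → m ≤ k) →
        Σ (Hierarchy order) λ H → Dominating H ×
          (∀ H′ → Dominating H′ → edgeCost (hierarchyHeight H) ≤ edgeCost (hierarchyHeight H′)) ×
          IsOPT-card G (fromℕ (edgeCost (hierarchyHeight H)))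
      fromLeast (_ , (H , ok , refl) , low) = H , ok , minimal ,
        (H , ok , ≃-sym {edgeSum (λ x y → fromℕ (hierarchyHeight H x y))}
            {fromℕ (edgeCost (hierarchyHeight H))}
                        (edgeSum-fromℕ (hierarchyHeight H))) , lower
        where
        minimal : ∀ H′ → Dominating H′ → edgeCost (hierarchyHeight H) ≤ edgeCost (hierarchyHeight H′)
        minimal H′ ok′ = low (edgeCost (hierarchyHeight H′)) (H′ , ok′ , refl)
        lower : ∀ v → CardCost G v → fromℕ (edgeCost (hierarchyHeight H)) ≤ℝ v
        lower v (H′ , ok′ , v≃) =
          ≤ℝ-trans {fromℕ c} {fromℕ c′} {v} (fromℕ-mono-≤ c c′ (minimal H′ ok′))
          (≤ℝ-trans {fromℕ c′} {edgeSum (λ x y → fromℕ (hierarchyHeight H′ x y))} {v}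
            (proj₂ (edgeSum-fromℕ (hierarchyHeight H′))) (proj₂ v≃))
          where
          c  = edgeCost (hierarchyHeight H)
          c′ = edgeCost (hierarchyHeight H′)

-- Acyclicity from unique parents

-- A graph whose edges join parents p ◁ c to children, where parents are unique
-- and rank increases, has no cycle: a walk without repetitions goes up to
-- parents for a while and then only down, so that a closed one would leave and
-- enter its starting point through the parent of that point.
module _ {V : Set} (_◁_ : V → V → Set) (rank : V → ℕ)
         (◁⇒< : ∀ {p c} → p ◁ c → rank p < rank c)
         (parent-unique : ∀ {p q c} → p ◁ c → q ◁ c → p ≡ q) where

  private
    _~_ : V → V → Set
    x ~ y = x ◁ y ⊎ y ◁ x

  -- A walk that has just gone down from p to c keeps going down, so that it enters
  -- its end x from the parent of x.
  descend : ∀ {p c} zs {x} → p ◁ c → Linked _~_ (c ∷ (zs ∷ʳ x)) →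
            p ≢ x → p ∉ zs → Unique (c ∷ zs) → x ∉ c ∷ zs →
            rank c < rank x × ∃ λ w → w ∈ c ∷ zs × w ◁ x
  descend []       p◁c (inj₁ c◁x ∷ _) p≢x _    _  _   = ◁⇒< c◁x , _ , here refl , c◁x
  descend []       p◁c (inj₂ x◁c ∷ _) p≢x _    _  _   = ⊥-elim (p≢x (parent-unique p◁c x◁c))
  descend (z ∷ zs) p◁c (inj₂ z◁c ∷ _) _   p∉zs _  _   =
    ⊥-elim (p∉zs (here (parent-unique p◁c z◁c)))
  descend (z ∷ zs) p◁c (inj₁ c◁z ∷ l) p≢x p∉zs u@(_ ∷ u′) x∉ =
    let lt , w , w∈ , w◁x = descend zs c◁z l (λ { refl → x∉ (here refl) })
                              (λ c∈ → Unique[x∷xs]⇒x∉xs u (there c∈)) u′ (x∉ ∘ there)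
    in ℕ.<-trans (◁⇒< c◁z) lt , w , there w∈ , w◁x

  -- A walk that leaves x through its parent y does not return to x without visiting
  -- y again; c is the current vertex, reached from x by going up.
  ascend : ∀ {y c} zs {x} → y ◁ x → Linked _~_ (c ∷ (zs ∷ʳ x)) → rank c < rank x →
           y ∉ zs → Unique (c ∷ zs) → x ∉ c ∷ zs → (y ≡ c → zs ≢ []) → ⊥
  ascend []       y◁x (inj₁ c◁x ∷ _) _  _    _ _ not-last = not-last (parent-unique y◁x c◁x) refl
  ascend []       y◁x (inj₂ x◁c ∷ _) lt _    _ _ _        = ℕ.<-asym lt (◁⇒< x◁c)
  ascend (z ∷ zs) {x} y◁x (inj₁ c◁z ∷ l) _  y∉zs u@(_ ∷ u′) x∉ _
    with descend zs c◁z l (λ { refl → x∉ (here refl) })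
           (λ c∈ → Unique[x∷xs]⇒x∉xs u (there c∈)) u′ (x∉ ∘ there)
  ... | _ , w , w∈ , w◁x = y∉zs (subst (_∈ z ∷ zs) (parent-unique w◁x y◁x) w∈)
  ascend (z ∷ zs) y◁x (inj₂ z◁c ∷ l) lt y∉zs (_ ∷ u) x∉ _ =
    ascend zs y◁x l (ℕ.<-trans (◁⇒< z◁c) lt) (y∉zs ∘ there) u (x∉ ∘ there)
      (λ { refl → ⊥-elim (y∉zs (here refl)) })

  no-cycle : ∀ x xs → 2 ≤ length xs → Unique (x ∷ xs) → ¬ Linked _~_ (x ∷ (xs ∷ʳ x))
  no-cycle x (y ∷ z ∷ zs) _ u@(_ ∷ u′) (inj₂ y◁x ∷ l) =
    ascend (z ∷ zs) y◁x l (◁⇒< y◁x) (Unique[x∷xs]⇒x∉xs u′) u′ (Unique[x∷xs]⇒x∉xs u) (λ _ ())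
  no-cycle x (y ∷ z ∷ zs) _ u@(_ ∷ u′@(_ ∷ u″)) (inj₁ x◁y ∷ inj₂ z◁y ∷ _) =
    Unique[x∷xs]⇒x∉xs u (there (here (parent-unique x◁y z◁y)))
  no-cycle x (y ∷ z ∷ zs) _ u@(_ ∷ u′@(_ ∷ u″)) (inj₁ x◁y ∷ inj₁ y◁z ∷ l) =
    ℕ.<-asym (ℕ.<-trans (◁⇒< x◁y) (◁⇒< y◁z))
      (proj₁ (descend zs y◁z l (λ { refl → Unique[x∷xs]⇒x∉xs u (here refl) })
        (λ y∈ → Unique[x∷xs]⇒x∉xs u′ (there y∈)) u″ (λ x∈ → Unique[x∷xs]⇒x∉xs u (there x∈))))
  no-cycle x []      ()
  no-cycle x (_ ∷ []) (s≤s ())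

-- Complete binary trees

-- The number of edges of the complete binary tree of height h.
M : ℕ → ℕ
M zero    = 0
M (suc h) = suc (M h) ℕ.+ suc (M h)

-- The number of vertices; the form suc (M h) makes Fin (N h) inhabited by zero for
-- every h.
N : ℕ → ℕ
N h = suc (M h)

N-power : ∀ h → suc (N h) ≡ 2 ^ suc h
N-power zero    = refl
N-power (suc h) = begin
  suc (suc (N h ℕ.+ N h))            ≡⟨ double (N h) ⟩
  suc (N h) ℕ.+ (suc (N h) ℕ.+ 0)    ≡⟨ cong (λ k → k ℕ.+ (k ℕ.+ 0)) (N-power h) ⟩
  2 ^ suc (suc h)                    ∎
  where
  open ≡-Reasoning
  double : ∀ k → suc (suc (k ℕ.+ k)) ≡ suc k ℕ.+ (suc k ℕ.+ 0)
  double = solve-∀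

-- The vertices of the complete binary tree of height h, as paths from the root.
data Node : ℕ → Set where
  root  : ∀ {h} → Node h
  left  : ∀ {h} → Node h → Node (suc h)
  right : ∀ {h} → Node h → Node (suc h)

infix 4 _◁_ _~_

-- p ◁ c: the vertex p is the parent of c.
data _◁_ : ∀ {h} → Node h → Node h → Set where
  root◁left  : ∀ {h} → root {suc h} ◁ left root
  root◁right : ∀ {h} → root {suc h} ◁ right root
  left◁      : ∀ {h} {p c : Node h} → p ◁ c → left p ◁ left c
  right◁     : ∀ {h} {p c : Node h} → p ◁ c → right p ◁ right c

_~_ : ∀ {h} → Node h → Node h → Set
x ~ y = x ◁ y ⊎ y ◁ x

_◁?_ : ∀ {h} (p c : Node h) → Dec (p ◁ c)
p               ◁? root                  = no λ ()
root            ◁? left root             = yes root◁left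
root            ◁? left (left _)         = no λ ()
root            ◁? left (right _)        = no λ ()
root            ◁? right root            = yes root◁right
root            ◁? right (left _)        = no λ ()
root            ◁? right (right _)       = no λ ()
left p          ◁? left c                = map′ left◁ (λ { (left◁ e) → e }) (p ◁? c)
left p          ◁? right c               = no λ ()
right p         ◁? left c                = no λ ()
right p         ◁? right c               = map′ right◁ (λ { (right◁ e) → e }) (p ◁? c)

◁-unique : ∀ {h} {p q c : Node h} → p ◁ c → q ◁ c → p ≡ q
◁-unique root◁left  root◁left  = refl
◁-unique root◁right root◁right = refl
◁-unique (left◁ a)  (left◁ b)  = cong left (◁-unique a b)
◁-unique (right◁ a) (right◁ b) = cong right (◁-unique a b)

-- The preorder numbering of the vertices.
enc : ∀ {h} → Node h → Fin (N h)
enc             root      = zero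
enc {h = suc h} (left v)  = suc (enc v ↑ˡ N h)
enc {h = suc h} (right v) = suc (N h ↑ʳ enc v)

-- The inverse of enc.
dec : ∀ h → Fin (N h) → Node h
dec h       zero    = root
dec (suc h) (suc i) = [ left ∘ dec h , right ∘ dec h ]′ (splitAt (N h) i)

dec-enc : ∀ {h} (v : Node h) → dec h (enc v) ≡ v
dec-enc             root      = refl
dec-enc {h = suc h} (left v)  rewrite Fin.splitAt-↑ˡ (N h) (enc v) (N h) = cong left (dec-enc v)
dec-enc {h = suc h} (right v) rewrite Fin.splitAt-↑ʳ (N h) (N h) (enc v) = cong right (dec-enc v)

enc-dec : ∀ h (i : Fin (N h)) → enc (dec h i) ≡ i
enc-dec h       zero    = refl
enc-dec (suc h) (suc i) with splitAt (N h) i in eq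
... | inj₁ j = cong suc (trans (cong (_↑ˡ N h) (enc-dec h j)) (Fin.splitAt⁻¹-↑ˡ eq))
... | inj₂ j = cong suc (trans (cong (N h ↑ʳ_) (enc-dec h j)) (Fin.splitAt⁻¹-↑ʳ eq))

enc-injective : ∀ {h} {v w : Node h} → enc v ≡ enc w → v ≡ w
enc-injective {h} {v} {w} eq = trans (sym (dec-enc v)) (trans (cong (dec h) eq) (dec-enc w))

◁⇒< : ∀ {h} {p c : Node h} → p ◁ c → enc p Fin.< enc c
◁⇒< root◁left  = s≤s z≤n
◁⇒< root◁right = s≤s z≤n
◁⇒< {h = suc h} (left◁ {p = p} {c} e) = s≤s (subst₂ _<_
  (sym (Fin.toℕ-↑ˡ (enc p) (N h))) (sym (Fin.toℕ-↑ˡ (enc c) (N h))) (◁⇒< e))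
◁⇒< {h = suc h} (right◁ {p = p} {c} e) = s≤s (subst₂ _<_
  (sym (Fin.toℕ-↑ʳ (N h) (enc p))) (sym (Fin.toℕ-↑ʳ (N h) (enc c))) (ℕ.+-monoʳ-< (N h) (◁⇒< e)))

infixr 5 _∷_ _++ᵀ_

-- Walks of given length between vertices; Walk is its counterpart for numbers.
data Trail {h} : Node h → Node h → ℕ → Set where
  []  : ∀ {x} → Trail x x 0
  _∷_ : ∀ {x y z k} → x ~ y → Trail y z k → Trail x z (suc k)

_++ᵀ_ : ∀ {h} {x y z : Node h} {j k} → Trail x y j → Trail y z k → Trail x z (j ℕ.+ k)
[]      ++ᵀ s = s
(e ∷ t) ++ᵀ s = e ∷ (t ++ᵀ s)

reverseᵀ : ∀ {h} {x y : Node h} {k} → Trail x y k → Trail y x k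
reverseᵀ []      = []
reverseᵀ {k = suc k} (e ∷ t) = subst (Trail _ _) (ℕ.+-comm k 1) (reverseᵀ t ++ᵀ (swap e ∷ []))

leftᵀ : ∀ {h} {x y : Node h} {k} → Trail x y k → Trail (left x) (left y) k
leftᵀ []      = []
leftᵀ (e ∷ t) = [ inj₁ ∘ left◁ , inj₂ ∘ left◁ ]′ e ∷ leftᵀ t

rightᵀ : ∀ {h} {x y : Node h} {k} → Trail x y k → Trail (right x) (right y) k
rightᵀ []      = []
rightᵀ (e ∷ t) = [ inj₁ ∘ right◁ , inj₂ ∘ right◁ ]′ e ∷ rightᵀ t

toRoot : ∀ {h} (x : Node h) → ∃ λ k → k ≤ h × Trail x root k
toRoot root = 0 , z≤n , []
toRoot (left x)  = let k , k≤h , t = toRoot x in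
  suc k , s≤s k≤h , subst (Trail _ _) (ℕ.+-comm k 1) (leftᵀ t ++ᵀ (inj₂ root◁left ∷ []))
toRoot (right x) = let k , k≤h , t = toRoot x in
  suc k , s≤s k≤h , subst (Trail _ _) (ℕ.+-comm k 1) (rightᵀ t ++ᵀ (inj₂ root◁right ∷ []))

viaRoot : ∀ {h} (x y : Node h) → ∃ λ k → k ≤ h ℕ.+ h × Trail x y k
viaRoot x y = let j , j≤h , s = toRoot x
                  k , k≤h , t = toRoot y
              in j ℕ.+ k , ℕ.+-mono-≤ j≤h k≤h , s ++ᵀ reverseᵀ t

-- The complete binary tree of height h with unit weights, vertices numbered in
-- preorder.
B : ℕ → Graph
B h = record
  { order      = N h
  ; Adj        = λ i j → dec h i ~ dec h j
  ; adj?       = λ i j → (dec h i ◁? dec h j) ⊎-dec (dec h j ◁? dec h i)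
  ; adj-sym    = swap
  ; adj-irrefl = λ { refl → [ irrefl , irrefl ]′ }
  ; connected  = (zero , ∈⊤) , λ {i} {j} _ _ →
      subst₂ (Star _) (enc-dec h i) (enc-dec h j) (star (proj₂ (proj₂ (viaRoot (dec h i) (dec h j)))))
  ; weight     = λ _ _ → 1ℝ
  ; weight-sym = λ _ _ → ≃-refl {1ℝ}
  ; weight-pos = λ _ → fromℕ-mono-< 0 1 (s≤s z≤n)
  }
  where
  irrefl : ∀ {v : Node h} → ¬ v ◁ v
  irrefl e = ℕ.<-irrefl refl (◁⇒< e)
  star : ∀ {v w k} → Trail v w k →
         Star (λ i j → dec h i ~ dec h j × i Subset.∈ Subset.⊤ × j Subset.∈ Subset.⊤) (enc v) (enc w)
  star []      = Star.ε
  star (_∷_ {x} {y} e t) = (subst₂ _~_ (sym (dec-enc x)) (sym (dec-enc y)) e , ∈⊤ , ∈⊤) ◅ star t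

B-unweighted : ∀ h x y → Graph.weight (B h) x y ≡ 1ℝ
B-unweighted h x y = refl

toWalk : ∀ {h} {v w : Node h} {k} → Trail v w k → Graph.Walk (B h) (enc v) (enc w) k
toWalk [] = Graph.Walk.[]
toWalk (_∷_ {x} {y} e t) = subst₂ _~_ (sym (dec-enc x)) (sym (dec-enc y)) e Graph.Walk.∷ toWalk t

dist≤length : ∀ {h} {v w : Node h} {k} → Trail v w k → Graph.dist (B h) (enc v) (enc w) ≤ k
dist≤length {h} t = dist≤ (B h) (toWalk t)

acyclic : ∀ h → Graph.Acyclic (B h)
acyclic h (x ∷ xs) (2≤ , u , l) = no-cycle (λ i j → dec h i ◁ dec h j) toℕ
  (λ {p} {c} e → subst₂ Fin._<_ (enc-dec h p) (enc-dec h c) (◁⇒< e))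
  (λ {p} {q} a b → trans (sym (enc-dec h p)) (trans (cong enc (◁-unique a b)) (enc-dec h q)))
  x xs 2≤ u l

-- Degrees

-- The list of the at most one parent and of the at most two children of a vertex.
parents children : ∀ {h} → Node h → List (Node h)
parents root      = []
parents (left root) = root ∷ []
parents (left v)  = map left (parents v)
parents (right root) = root ∷ []
parents (right v) = map right (parents v)
children {zero}  root      = []
children {suc h} root      = left root ∷ right root ∷ []
children         (left v)  = map left (children v)
children         (right v) = map right (children v)

length-parents : ∀ {h} (v : Node h) → length (parents v) ≤ 1
length-parents root = z≤n
length-parents (left root) = s≤s z≤n
length-parents (left v@(left _))  = subst (_≤ 1) (sym (length-map left (parents v))) (length-parents v)
length-parents (left v@(right _)) = subst (_≤ 1) (sym (length-map left (parents v))) (length-parents v)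
length-parents (right root) = s≤s z≤n
length-parents (right v@(left _))  = subst (_≤ 1) (sym (length-map right (parents v))) (length-parents v)
length-parents (right v@(right _)) = subst (_≤ 1) (sym (length-map right (parents v))) (length-parents v)

length-children : ∀ {h} (v : Node h) → length (children v) ≤ 2
length-children {zero}  root = z≤n
length-children {suc h} root = s≤s (s≤s z≤n)
length-children (left v)  = subst (_≤ 2) (sym (length-map left (children v))) (length-children v)
length-children (right v) = subst (_≤ 2) (sym (length-map right (children v))) (length-children v)

∈-parents : ∀ {h} {p c : Node h} → p ◁ c → p ∈ parents c
∈-parents root◁left  = here refl
∈-parents root◁right = here refl
∈-parents (left◁ {c = left _} e)   = ∈-map⁺ left (∈-parents e)
∈-parents (left◁ {c = right _} e)  = ∈-map⁺ left (∈-parents e)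
∈-parents (right◁ {c = left _} e)  = ∈-map⁺ right (∈-parents e)
∈-parents (right◁ {c = right _} e) = ∈-map⁺ right (∈-parents e)

∈-children : ∀ {h} {p c : Node h} → p ◁ c → c ∈ children p
∈-children root◁left  = here refl
∈-children root◁right = there (here refl)
∈-children (left◁ e)  = ∈-map⁺ left (∈-children e)
∈-children (right◁ e) = ∈-map⁺ right (∈-children e)

degree : ∀ h → Fin (N h) → ℕ
degree h i = length (filter (Graph.adj? (B h) i) (allFin (N h)))

degree≤3 : ∀ h i → degree h i ≤ 3
degree≤3 h i = begin
  degree h i
    ≤⟨ length-⊆ (Unique.filter⁺ (Graph.adj? (B h) i) (Unique.allFin⁺ (N h))) member ⟩
  length (map enc (parents v ++ children v))        ≡⟨ length-map enc (parents v ++ children v) ⟩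
  length (parents v ++ children v)                  ≡⟨ length-++ (parents v) ⟩
  length (parents v) ℕ.+ length (children v)        ≤⟨ ℕ.+-mono-≤ (length-parents v) (length-children v) ⟩
  3                                                 ∎
  where
  open ℕ.≤-Reasoning
  v = dec h i
  neighbour : ∀ {w} → v ~ w → w ∈ parents v ++ children v
  neighbour (inj₁ e) = ∈-++⁺ʳ (parents v) (∈-children e)
  neighbour (inj₂ e) = ∈-++⁺ˡ (∈-parents e)
  member : ∀ {j} → j ∈ filter (Graph.adj? (B h) i) (allFin (N h)) → j ∈ map enc (parents v ++ children v)
  member {j} j∈ = subst (_∈ map enc (parents v ++ children v)) (enc-dec h j)
    (∈-map⁺ enc (neighbour (proj₂ (∈-filter⁻ (Graph.adj? (B h) i) {xs = allFin (N h)} j∈))))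

maxDegree≤3 : ∀ h → Graph.maxDegree (B h) ≤ 3
maxDegree≤3 h = max≤v⁺ z≤n (All.map⁺ (All.universal (degree≤3 h) (allFin (N h))))

length≤maxDegree : ∀ h (v : Node h) ws → Unique ws → (∀ {w} → w ∈ ws → v ~ w) →
                   length ws ≤ Graph.maxDegree (B h)
length≤maxDegree h v ws u adj = begin
  length ws                 ≡⟨ length-map enc ws ⟨
  length (map enc ws)       ≤⟨ length-⊆ (Unique.map⁺ enc-injective u) adjacent ⟩
  degree h (enc v)
    ≤⟨ All.lookup (xs≤max 0 (map (degree h) (allFin (N h)))) (∈-map⁺ (degree h) (∈-allFin (enc v))) ⟩
  Graph.maxDegree (B h)     ∎
  where
  open ℕ.≤-Reasoning
  adjacent : ∀ {i} → i ∈ map enc ws → i ∈ filter (Graph.adj? (B h) (enc v)) (allFin (N h))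
  adjacent i∈ with ∈-map⁻ enc i∈
  ... | w , w∈ , refl = ∈-filter⁺ (Graph.adj? (B h) (enc v)) (∈-allFin (enc w))
    (subst₂ _~_ (sym (dec-enc v)) (sym (dec-enc w)) (adj w∈))

maxDegree≥3 : ∀ h → 2 ≤ h → 3 ≤ Graph.maxDegree (B h)
maxDegree≥3 (suc zero)    (s≤s ())
maxDegree≥3 (suc (suc h)) _ = length≤maxDegree (suc (suc h)) (left root)
  (root ∷ left (left root) ∷ left (right root) ∷ [])
  (((λ ()) ∷ (λ ()) ∷ []) ∷ ((λ ()) ∷ []) ∷ [] ∷ [])
  λ where
    (here refl)                 → inj₂ root◁left
    (there (here refl))         → inj₁ (left◁ root◁left)
    (there (there (here refl))) → inj₁ (left◁ root◁right)

-- Edges of the complete binary tree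

-- The pairs (parent , child), listed along the recursive structure of the tree.
edgeList : ∀ h → List (Node h × Node h)
edgeList zero    = []
edgeList (suc h) = (root , left root) ∷ (root , right root) ∷
  map (λ (p , c) → left p , left c) (edgeList h) ++ map (λ (p , c) → right p , right c) (edgeList h)

∈-edgeList⁺ : ∀ {h} {p c : Node h} → p ◁ c → (p , c) ∈ edgeList h
∈-edgeList⁺ root◁left  = here refl
∈-edgeList⁺ root◁right = there (here refl)
∈-edgeList⁺ (left◁ e)  = there (there (∈-++⁺ˡ (∈-map⁺ _ (∈-edgeList⁺ e))))
∈-edgeList⁺ {suc h} (right◁ e) = there (there (∈-++⁺ʳ (map _ (edgeList h)) (∈-map⁺ _ (∈-edgeList⁺ e))))

∈-edgeList⁻ : ∀ h {p c : Node h} → (p , c) ∈ edgeList h → p ◁ c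
∈-edgeList⁻ (suc h) (here refl)         = root◁left
∈-edgeList⁻ (suc h) (there (here refl)) = root◁right
∈-edgeList⁻ (suc h) (there (there e∈)) with ∈-++⁻ (map _ (edgeList h)) e∈
... | inj₁ l∈ with ∈-map⁻ _ l∈
...   | _ , e∈ , refl = left◁ (∈-edgeList⁻ h e∈)
∈-edgeList⁻ (suc h) (there (there e∈)) | inj₂ r∈ with ∈-map⁻ _ r∈
...   | _ , e∈ , refl = right◁ (∈-edgeList⁻ h e∈)

edgeList-unique : ∀ h → Unique (edgeList h)
edgeList-unique zero    = []
edgeList-unique (suc h) =
  ((λ ()) ∷ All.¬Any⇒All¬ _ (λ e∈ → absurd e∈)) ∷
  All.¬Any⇒All¬ _ (λ e∈ → absurd e∈) ∷
  Unique.++⁺ (Unique.map⁺ (λ { refl → refl }) (edgeList-unique h))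
             (Unique.map⁺ (λ { refl → refl }) (edgeList-unique h))
             λ (l∈ , r∈) → disjoint l∈ r∈
  where
  ls rs : List (Node (suc h) × Node (suc h))
  ls = map (λ (p , c) → left p , left c) (edgeList h)
  rs = map (λ (p , c) → right p , right c) (edgeList h)
  absurd : ∀ {c} → (root , c) ∉ ls ++ rs
  absurd e∈ with ∈-++⁻ ls e∈
  ... | inj₁ l∈ with () ← proj₂ (proj₂ (∈-map⁻ _ l∈))
  ... | inj₂ r∈ with () ← proj₂ (proj₂ (∈-map⁻ _ r∈))
  disjoint : ∀ {e} → e ∈ ls → e ∈ rs → ⊥
  disjoint l∈ r∈ with ∈-map⁻ _ l∈ | ∈-map⁻ _ r∈
  ... | _ , _ , refl | _ , _ , ()

-- The numbering is preorder, so the increasing pair of ends of an edge is the pair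
-- (parent , child).
edges-↭ : ∀ h → Graph.edges (B h) ↭ map (λ (p , c) → enc p , enc c) (edgeList h)
edges-↭ h = unique-↭
  (Unique.filter⁺ edge? (Unique.cartesianProduct⁺ (Unique.allFin⁺ (N h)) (Unique.allFin⁺ (N h))))
  (Unique.map⁺ (λ eq → cong₂ _,_ (enc-injective (cong proj₁ eq)) (enc-injective (cong proj₂ eq)))
    (edgeList-unique h))
  to from
  where
  edge? = λ ((i , j) : Fin (N h) × Fin (N h)) → (i Fin.<? j) ×-dec Graph.adj? (B h) i j
  to : ∀ {e} → e ∈ Graph.edges (B h) → e ∈ map (λ (p , c) → enc p , enc c) (edgeList h)
  to {i , j} e∈ with ∈-filter⁻ edge? {xs = cartesianProduct (allFin (N h)) (allFin (N h))} e∈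
  ... | _ , i<j , inj₁ e = subst₂ (λ a b → (a , b) ∈ map (λ (p , c) → enc p , enc c) (edgeList h))
    (enc-dec h i) (enc-dec h j) (∈-map⁺ (λ (p , c) → enc p , enc c) (∈-edgeList⁺ e))
  ... | _ , i<j , inj₂ e = ⊥-elim (ℕ.<-asym i<j (subst₂ Fin._<_ (enc-dec h j) (enc-dec h i) (◁⇒< e)))
  from : ∀ {e} → e ∈ map (λ (p , c) → enc p , enc c) (edgeList h) → e ∈ Graph.edges (B h)
  from e∈ with ∈-map⁻ (λ (p , c) → enc p , enc c) e∈
  ... | (p , c) , pc∈ , refl = ∈-filter⁺ edge?
    (∈-cartesianProduct⁺ (∈-allFin (enc p)) (∈-allFin (enc c)))
    (◁⇒< e , inj₁ (subst₂ _◁_ (sym (dec-enc p)) (sym (dec-enc c)) e))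
    where e = ∈-edgeList⁻ h pc∈

-- The sum of f over all pairs (parent , child).
Σedges : ∀ {h} → (Node h → Node h → ℕ) → ℕ
Σedges {zero}  f = 0
Σedges {suc h} f = f root (left root) ℕ.+ (f root (right root) ℕ.+
  (Σedges (λ p c → f (left p) (left c)) ℕ.+ Σedges (λ p c → f (right p) (right c))))

Σedges-list : ∀ h (f : Node h → Node h → ℕ) → sum (map (uncurry f) (edgeList h)) ≡ Σedges f
Σedges-list zero    f = refl
Σedges-list (suc h) f = cong (λ t → f root (left root) ℕ.+ (f root (right root) ℕ.+ t)) (begin
  sum (map (uncurry f) (map l (edgeList h) ++ map r (edgeList h)))
    ≡⟨ cong sum (map-++ (uncurry f) (map l (edgeList h)) (map r (edgeList h))) ⟩
  sum (map (uncurry f) (map l (edgeList h)) ++ map (uncurry f) (map r (edgeList h)))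
    ≡⟨ sum-++ (map (uncurry f) (map l (edgeList h))) (map (uncurry f) (map r (edgeList h))) ⟩
  sum (map (uncurry f) (map l (edgeList h))) ℕ.+ sum (map (uncurry f) (map r (edgeList h)))
    ≡⟨ cong₂ (λ a b → sum a ℕ.+ sum b) (map-∘ (edgeList h)) (map-∘ (edgeList h)) ⟨
  sum (map (uncurry f ∘ l) (edgeList h)) ℕ.+ sum (map (uncurry f ∘ r) (edgeList h))
    ≡⟨ cong₂ ℕ._+_ (Σedges-list h (λ p c → f (left p) (left c)))
        (Σedges-list h (λ p c → f (right p) (right c))) ⟩
  Σedges (λ p c → f (left p) (left c)) ℕ.+ Σedges (λ p c → f (right p) (right c)) ∎)
  where
  open ≡-Reasoning
  l r : Node h × Node h → Node (suc h) × Node (suc h)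
  l (p , c) = left p , left c
  r (p , c) = right p , right c

edgeSumℕ : ∀ h (f : Fin (N h) → Fin (N h) → ℕ) →
           sum (map (uncurry f) (Graph.edges (B h))) ≡ Σedges {h} (λ p c → f (enc p) (enc c))
edgeSumℕ h f = begin
  sum (map (uncurry f) (Graph.edges (B h)))
    ≡⟨ sum-↭ (↭.map⁺ (uncurry f) (edges-↭ h)) ⟩
  sum (map (uncurry f) (map (λ (p , c) → enc p , enc c) (edgeList h)))
    ≡⟨ cong sum (map-∘ (edgeList h)) ⟨
  sum (map (uncurry (λ p c → f (enc p) (enc c))) (edgeList h))
    ≡⟨ Σedges-list h (λ p c → f (enc p) (enc c)) ⟩
  Σedges {h} (λ p c → f (enc p) (enc c))                                     ∎
  where open ≡-Reasoning

Σedges-mono : ∀ {h} {f g : Node h → Node h → ℕ} → (∀ {p c} → p ◁ c → f p c ≤ g p c) → Σedges f ≤ Σedges g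
Σedges-mono {zero}  le = z≤n
Σedges-mono {suc h} le = ℕ.+-mono-≤ (le root◁left) (ℕ.+-mono-≤ (le root◁right)
  (ℕ.+-mono-≤ (Σedges-mono (le ∘ left◁)) (Σedges-mono (le ∘ right◁))))

Σedges-cong : ∀ {h} {f g : Node h → Node h → ℕ} → (∀ {p c} → p ◁ c → f p c ≡ g p c) → Σedges f ≡ Σedges g
Σedges-cong {zero}  eq = refl
Σedges-cong {suc h} eq = cong₂ ℕ._+_ (eq root◁left) (cong₂ ℕ._+_ (eq root◁right)
  (cong₂ ℕ._+_ (Σedges-cong (eq ∘ left◁)) (Σedges-cong (eq ∘ right◁))))

Σedges-1 : ∀ h → Σedges {h} (λ _ _ → 1) ≡ M h
Σedges-1 zero    = refl
Σedges-1 (suc h) rewrite Σedges-1 h = cong suc (sym (ℕ.+-suc (M h) (M h)))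

-- Counting with indicators

-- The value of the indicator function.
𝟙 : Bool → ℕ
𝟙 b = if b then 1 else 0

𝟙≤1 : ∀ b → 𝟙 b ≤ 1
𝟙≤1 false = z≤n
𝟙≤1 true  = s≤s z≤n

does⇒ : {A : Set} (d : Dec A) → does d ≡ true → A
does⇒ (yes a) _ = a

length-filter : {A : Set} {P : A → Set} (P? : Decidable P) → ∀ xs →
                length (filter P? xs) ≡ sum (map (𝟙 ∘ does ∘ P?) xs)
length-filter P? []       = refl
length-filter P? (x ∷ xs) with does (P? x)
... | true  = cong suc (length-filter P? xs)
... | false = length-filter P? xs

sum-map-+ : {A : Set} (f g : A → ℕ) → ∀ xs → sum (map (λ x → f x + g x) xs) ≡ sum (map f xs) + sum
    (map g xs)
sum-map-+ f g []       = refl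
sum-map-+ f g (x ∷ xs) rewrite sum-map-+ f g xs = shuffle (f x) (g x) (sum (map f xs)) (sum (map g xs))
  where
  shuffle : ∀ a b c d → a + b + (c + d) ≡ a + c + (b + d)
  shuffle = solve-∀

sum-map-* : {A : Set} (f : A → ℕ) (k : ℕ) → ∀ xs → sum (map (λ x → f x * k) xs) ≡ sum (map f xs) * k
sum-map-* f k []       = refl
sum-map-* f k (x ∷ xs) rewrite sum-map-* f k xs = sym (ℕ.*-distribʳ-+ k (f x) (sum (map f xs)))

sum-map-cong : {A : Set} {f g : A → ℕ} → (∀ x → f x ≡ g x) → ∀ xs → sum (map f xs) ≡ sum (map g xs)
sum-map-cong eq []       = refl
sum-map-cong eq (x ∷ xs) = cong₂ _+_ (eq x) (sum-map-cong eq xs)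

unique-++⁻ : {A : Set} (xs : List A) {ys : List A} → Unique (xs ++ ys) →
             Unique xs × Unique ys × Disjoint xs ys
unique-++⁻ []       u       = [] , u , λ ()
unique-++⁻ (x ∷ xs) (a ∷ u) =
  let u₁ , u₂ , d = unique-++⁻ xs u
  in All.++⁻ˡ xs a ∷ u₁ , u₂ ,
     λ { (here refl , y∈) → All.lookup (All.++⁻ʳ xs a) y∈ refl ; (there x∈ , y∈) → d (x∈ , y∈) }

-- Lower bound on the cost of hierarchies

module _ {n : ℕ} where

  -- Both ends of the edge belong to the list; the test made by lcaSubtree.
  inside : List (Fin n) → Fin n × Fin n → Bool
  inside xs (x , y) = does ((x ∈ᴸ? xs) ×-dec (y ∈ᴸ? xs))

  inside-mono : ∀ {xs ys} e → (∀ {x} → x ∈ xs → x ∈ ys) → inside xs e ≡ true → inside ys e ≡ true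
  inside-mono {xs} {ys} (x , y) sub eq =
    let x∈ , y∈ = does⇒ ((x ∈ᴸ? xs) ×-dec (y ∈ᴸ? xs)) eq
    in dec-true ((x ∈ᴸ? ys) ×-dec (y ∈ᴸ? ys)) (sub x∈ , sub y∈)

  inside-disjoint : ∀ {xs ys} e → Disjoint xs ys → inside xs e ≡ true → ¬ inside ys e ≡ true
  inside-disjoint {xs} {ys} (x , y) d eq eq′ =
    d (proj₁ (does⇒ ((x ∈ᴸ? xs) ×-dec (y ∈ᴸ? xs)) eq) , proj₁ (does⇒ ((x ∈ᴸ? ys) ×-dec (y ∈ᴸ? ys)) eq′))

  -- One less than the size of the smallest cluster with both ends of the edge, and
  -- 0 if an end is not a leaf of the tree.
  edgeHeight : BinaryTree n → Fin n × Fin n → ℕ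
  edgeHeight t e@(x , y) = if inside (leaves t) e then length (leaves (lcaSubtree t x y)) ∸ 1 else 0

  -- The edge is cut by the top split of node l r.
  separates : BinaryTree n → BinaryTree n → Fin n × Fin n → Bool
  separates l r e = inside (leaves (Binary.node l _ r)) e ∧ not (inside (leaves l) e) ∧ not
      (inside (leaves r) e)

  module _ (es : List (Fin n × Fin n)) where

    -- The number of listed edges inside a cluster.
    #inside : List (Fin n) → ℕ
    #inside xs = sum (map (𝟙 ∘ inside xs) es)

    -- The total height of the listed edges inside a tree.
    treeCost : BinaryTree n → ℕ
    treeCost t = sum (map (edgeHeight t) es)

    -- The number of listed edges that the top split of node l r cuts.
    #separated : BinaryTree n → BinaryTree n → ℕ
    #separated l r = sum (map (𝟙 ∘ separates l r) es)

    module _ (l r : BinaryTree n) (u : Unique (leaves (Binary.node l _ r))) where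
      private
        t = Binary.node l _ r
        parts = unique-++⁻ (leaves l) (subst Unique (leaves-node l r) u)
        l⊆ : ∀ {x} → x ∈ leaves l → x ∈ leaves t
        l⊆ x∈ = subst (_ ∈_) (sym (leaves-node l r)) (∈-++⁺ˡ x∈)
        r⊆ : ∀ {x} → x ∈ leaves r → x ∈ leaves t
        r⊆ x∈ = subst (_ ∈_) (sym (leaves-node l r)) (∈-++⁺ʳ (leaves l) x∈)

      unique-left : Unique (leaves l)
      unique-left = proj₁ parts

      unique-right : Unique (leaves r)
      unique-right = proj₁ (proj₂ parts)

      inside-node : ∀ e → 𝟙 (inside (leaves t) e) ≡
                          𝟙 (inside (leaves l) e) + 𝟙 (inside (leaves r) e) + 𝟙 (separates l r e)
      inside-node e = cases (inside (leaves l) e) (inside (leaves r) e) (inside (leaves t) e)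
        (inside-mono e l⊆) (inside-mono e r⊆) (inside-disjoint e (proj₂ (proj₂ parts)))
        where
        cases : ∀ a b c → (a ≡ true → c ≡ true) → (b ≡ true → c ≡ true) → (a ≡ true → ¬ b ≡ true) →
                𝟙 c ≡ 𝟙 a + 𝟙 b + 𝟙 (c ∧ not a ∧ not b)
        cases true  true  c p q d = ⊥-elim (d refl refl)
        cases true  false c p q d rewrite p refl = refl
        cases false true  c p q d rewrite q refl = refl
        cases false false true  p q d = refl
        cases false false false p q d = refl

      edgeHeight-node : ∀ e → edgeHeight t e ≡
        edgeHeight l e + edgeHeight r e + 𝟙 (separates l r e) * (length (leaves t) ∸ 1)
      edgeHeight-node e@(x , y) = cases (inside (leaves l) e) (inside (leaves r) e) (inside (leaves t) e)
        (inside-mono e l⊆) (inside-mono e r⊆) (inside-disjoint e (proj₂ (proj₂ parts)))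
        (lcaSubtree l x y) (lcaSubtree r x y) t
        where
        cases : ∀ a b c → (a ≡ true → c ≡ true) → (b ≡ true → c ≡ true) → (a ≡ true → ¬ b ≡ true) →
                ∀ (A B T : BinaryTree n) →
                (if c then length (leaves (if a then A else if b then B else T)) ∸ 1 else 0) ≡
                (if a then length (leaves A) ∸ 1 else 0) + (if b then length (leaves B) ∸ 1 else 0) +
                𝟙 (c ∧ not a ∧ not b) * (length (leaves T) ∸ 1)
        cases true  true  c p q d A B T = ⊥-elim (d refl refl)
        cases true  false c p q d A B T rewrite p refl = sym (trans (ℕ.+-identityʳ _) (ℕ.+-identityʳ _))
        cases false true  c p q d A B T rewrite q refl = sym (ℕ.+-identityʳ _)
        cases false false true  p q d A B T = sym (ℕ.+-identityʳ _)
        cases false false false p q d A B T = refl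

      #inside-node : #inside (leaves t) ≡ #inside (leaves l) + #inside (leaves r) + #separated l r
      #inside-node = begin
        sum (map (𝟙 ∘ inside (leaves t)) es) ≡⟨ sum-map-cong inside-node es ⟩
        sum (map (λ e → 𝟙 (inside (leaves l) e) + 𝟙 (inside (leaves r) e) + 𝟙 (separates l r e)) es)
          ≡⟨ sum-map-+ (λ e → 𝟙 (inside (leaves l) e) + 𝟙 (inside (leaves r) e)) (𝟙 ∘ separates l r) es ⟩
        sum (map (λ e → 𝟙 (inside (leaves l) e) + 𝟙 (inside (leaves r) e)) es) + #separated l r
          ≡⟨ cong (_+ #separated l r) (sum-map-+ (𝟙 ∘ inside (leaves l)) (𝟙 ∘ inside (leaves r)) es) ⟩
        #inside (leaves l) + #inside (leaves r) + #separated l r ∎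
        where open ≡-Reasoning

      treeCost-node : treeCost t ≡ treeCost l + treeCost r + #separated l r * (length (leaves t) ∸ 1)
      treeCost-node = begin
        sum (map (edgeHeight t) es) ≡⟨ sum-map-cong edgeHeight-node es ⟩
        sum (map (λ e → edgeHeight l e + edgeHeight r e + 𝟙 (separates l r e) * m) es)
          ≡⟨ sum-map-+ (λ e → edgeHeight l e + edgeHeight r e) (λ e → 𝟙 (separates l r e) * m) es ⟩
        sum (map (λ e → edgeHeight l e + edgeHeight r e) es) + sum
            (map (λ e → 𝟙 (separates l r e) * m) es)
          ≡⟨ cong₂ _+_ (sum-map-+ (edgeHeight l) (edgeHeight r) es) (sum-map-* (𝟙 ∘ separates l r) m es) ⟩
        treeCost l + treeCost r + #separated l r * m ∎
        where
        open ≡-Reasoning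
        m = length (leaves t) ∸ 1

    -- The hypothesis says that the listed edges form a forest.
    module _ (forest : ∀ xs → 1 ≤ length xs → suc (#inside xs) ≤ length xs) where

      nonempty : ∀ (t : BinaryTree n) → 1 ≤ length (leaves t)
      nonempty t = ℕ.≤-trans (s≤s z≤n) (depth<leaves t)

      k+2≤2^k+1 : ∀ k → k + 2 ≤ 2 ^ suc k
      k+2≤2^k+1 zero    = ℕ.≤-refl
      k+2≤2^k+1 (suc k) = ℕ.≤-trans
          (ℕ.+-monoˡ-≤ (k + 2) (ℕ.≤-trans (s≤s z≤n) (ℕ.≤-trans (ℕ.m≤n+m 2 k) (k+2≤2^k+1 k))))
        (ℕ.+-monoʳ-≤ (2 ^ suc k) (ℕ.≤-trans (k+2≤2^k+1 k) (ℕ.≤-reflexive (sym (ℕ.+-identityʳ _)))))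

      -- The potential inequality from which the lower bound follows; #inside (leaves t)
      -- is the number E of edges and length (leaves t) the number s of vertices.
      treeCost-lower : ∀ k t → Unique (leaves t) →
        length (leaves t) * (k + 2) + 2 ^ suc k * #inside (leaves t) ≤
        2 * treeCost t + 2 ^ suc k * length (leaves t)
      treeCost-lower k t@(Binary.leaf x) u
        rewrite ℕ.n≤0⇒n≡0 (ℕ.≤-pred (forest (leaves t) (s≤s z≤n))) = begin
          k + 2 + 0 + 2 ^ suc k * 0     ≡⟨ (λ a b → tidy a b) k (2 ^ suc k) ⟩
          k + 2                         ≤⟨ k+2≤2^k+1 k ⟩
          2 ^ suc k                     ≡⟨ ℕ.*-identityʳ (2 ^ suc k) ⟨
          2 ^ suc k * 1                 ≤⟨ ℕ.m≤n+m _ (2 * treeCost t) ⟩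
          2 * treeCost t + 2 ^ suc k * 1 ∎
        where
        open ℕ.≤-Reasoning
        tidy : ∀ a b → a + 2 + 0 + b * 0 ≡ a + 2
        tidy = solve-∀
      treeCost-lower k t@(Binary.node l _ r) u with length (leaves t) ℕ.≤? 2 ^ k
      treeCost-lower zero t@(Binary.node l _ r) u | yes s≤1 = ⊥-elim (ℕ.1+n≰n (ℕ.≤-trans
        (ℕ.+-mono-≤ (nonempty l) (nonempty r))
            (ℕ.≤-trans (ℕ.≤-reflexive (sym (length-leaves-node l r))) s≤1)))
      -- A small cluster: pass to the exponent j.
      treeCost-lower (suc j) t@(Binary.node l _ r) u | yes s≤Q =
        small (length (leaves t)) (#inside (leaves t)) (treeCost t) j (2 ^ suc j)
          s≤Q (forest (leaves t) (nonempty t)) (treeCost-lower j t u)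
        where
        open ℕ.≤-Reasoning
        small : ∀ s E c j Q → s ≤ Q → suc E ≤ s → s * (j + 2) + Q * E ≤ 2 * c + Q * s →
                s * (suc j + 2) + 2 * Q * E ≤ 2 * c + 2 * Q * s
        small s E c j Q s≤Q E<s ih = begin
          s * (suc j + 2) + 2 * Q * E          ≡⟨ lhs s j Q E ⟩
          (s * (j + 2) + Q * E) + (s + Q * E)  ≤⟨ ℕ.+-mono-≤ ih (ℕ.+-monoˡ-≤ (Q * E) s≤Q) ⟩
          (2 * c + Q * s) + (Q + Q * E)        ≡⟨ cong (λ t → 2 * c + Q * s + t) (ℕ.*-suc Q E) ⟨
          (2 * c + Q * s) + Q * suc E          ≤⟨ ℕ.+-monoʳ-≤ (2 * c + Q * s) (ℕ.*-monoʳ-≤ Q E<s) ⟩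
          (2 * c + Q * s) + Q * s              ≡⟨ rhs c Q s ⟩
          2 * c + 2 * Q * s                    ∎
          where
          lhs : ∀ s j Q E → s * (suc j + 2) + 2 * Q * E ≡ (s * (j + 2) + Q * E) + (s + Q * E)
          lhs = solve-∀
          rhs : ∀ c Q s → (2 * c + Q * s) + Q * s ≡ 2 * c + 2 * Q * s
          rhs = solve-∀
      -- A large cluster: an edge cut at the top adds 2 ^ (k + 1) on the left and at
      -- least as much on the right.
      treeCost-lower k t@(Binary.node l _ r) u | no s≰P
        = big (length (leaves l)) (length (leaves r)) (length (leaves t)) (#inside (leaves l))
            (#inside (leaves r))
            (#inside (leaves t)) (treeCost l) (treeCost r) (treeCost t) (#separated l r) k (2 ^ k)
            (length-leaves-node l r) (#inside-node l r u) (treeCost-node l r u)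
            (ℕ.∸-monoˡ-≤ 1 (ℕ.≰⇒> s≰P))
            (treeCost-lower k l (unique-left l r u)) (treeCost-lower k r (unique-right l r u))
        where
        open ℕ.≤-Reasoning
        big : ∀ s₁ s₂ s E₁ E₂ E c₁ c₂ c X k P →
              s ≡ s₁ + s₂ → E ≡ E₁ + E₂ + X → c ≡ c₁ + c₂ + X * (s ∸ 1) → P ≤ s ∸ 1 →
              s₁ * (k + 2) + 2 * P * E₁ ≤ 2 * c₁ + 2 * P * s₁ →
              s₂ * (k + 2) + 2 * P * E₂ ≤ 2 * c₂ + 2 * P * s₂ →
              s * (k + 2) + 2 * P * E ≤ 2 * c + 2 * P * s
        big s₁ s₂ s E₁ E₂ E c₁ c₂ c X k P refl refl refl P≤m ih₁ ih₂ = begin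
          (s₁ + s₂) * (k + 2) + 2 * P * (E₁ + E₂ + X)
            ≡⟨ lhs s₁ s₂ E₁ E₂ X k P ⟩
          (s₁ * (k + 2) + 2 * P * E₁) + (s₂ * (k + 2) + 2 * P * E₂) + 2 * (X * P)
            ≤⟨ ℕ.+-mono-≤ (ℕ.+-mono-≤ ih₁ ih₂) (ℕ.*-monoʳ-≤ 2 (ℕ.*-monoʳ-≤ X P≤m)) ⟩
          (2 * c₁ + 2 * P * s₁) + (2 * c₂ + 2 * P * s₂) + 2 * (X * (s ∸ 1))
            ≡⟨ rhs c₁ c₂ P s₁ s₂ X (s ∸ 1) ⟩
          2 * (c₁ + c₂ + X * (s ∸ 1)) + 2 * P * (s₁ + s₂) ∎
          where
          lhs : ∀ s₁ s₂ E₁ E₂ X k P → (s₁ + s₂) * (k + 2) + 2 * P * (E₁ + E₂ + X) ≡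
                (s₁ * (k + 2) + 2 * P * E₁) + (s₂ * (k + 2) + 2 * P * E₂) + 2 * (X * P)
          lhs = solve-∀
          rhs : ∀ c₁ c₂ P s₁ s₂ X m → (2 * c₁ + 2 * P * s₁) + (2 * c₂ + 2 * P * s₂) + 2 * (X * m) ≡
                2 * (c₁ + c₂ + X * m) + 2 * P * (s₁ + s₂)
          rhs = solve-∀

-- Counting vertices and edges of a vertex set

-- The sum of f over all vertices.
Σnodes : ∀ {h} → (Node h → ℕ) → ℕ
Σnodes {zero}  f = f root
Σnodes {suc h} f = f root + (Σnodes (f ∘ left) + Σnodes (f ∘ right))

sum-tabulate-+ : ∀ m {k} (f : Fin (m + k) → ℕ) →
                 sum (tabulate f) ≡ sum (tabulate (f ∘ (_↑ˡ k))) + sum (tabulate (f ∘ (m ↑ʳ_)))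
sum-tabulate-+ zero    f = refl
sum-tabulate-+ (suc m) f = trans (cong (λ t → f zero + t) (sum-tabulate-+ m (f ∘ suc)))
    (sym (ℕ.+-assoc (f zero) _ _))

Σnodes-tabulate : ∀ h (f : Fin (N h) → ℕ) → sum (tabulate f) ≡ Σnodes {h} (f ∘ enc)
Σnodes-tabulate zero    f = ℕ.+-identityʳ (f zero)
Σnodes-tabulate (suc h) f = cong (λ t → f zero + t) (trans (sum-tabulate-+ (N h) (f ∘ suc))
  (cong₂ _+_ (Σnodes-tabulate h (λ i → f (suc (i ↑ˡ N h)))) (Σnodes-tabulate h (λ i → f (suc (N h ↑ʳ i))))))

-- The numbers of vertices in P and of edges with both ends in P.
#nodes #edges : ∀ {h} → (Node h → Bool) → ℕ
#nodes P = Σnodes (𝟙 ∘ P)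
#edges P = Σedges (λ p c → 𝟙 (P p ∧ P c))

root≤#nodes : ∀ {h} (P : Node h → Bool) → 𝟙 (P root) ≤ #nodes P
root≤#nodes {zero}  P = ℕ.≤-refl
root≤#nodes {suc h} P = ℕ.m≤m+n _ _

#nodes-positive : ∀ {h} (P : Node h → Bool) v → P v ≡ true → 1 ≤ #nodes P
#nodes-positive {zero}  P root      Pv = ℕ.≤-reflexive (cong 𝟙 (sym Pv))
#nodes-positive {suc h} P root      Pv = ℕ.≤-trans (ℕ.≤-reflexive (cong 𝟙 (sym Pv))) (ℕ.m≤m+n _ _)
#nodes-positive {suc h} P (left v)  Pv = ℕ.≤-trans (#nodes-positive (P ∘ left) v Pv)
  (ℕ.≤-trans (ℕ.m≤m+n _ _) (ℕ.m≤n+m _ (𝟙 (P root))))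
#nodes-positive {suc h} P (right v) Pv = ℕ.≤-trans (#nodes-positive (P ∘ right) v Pv)
  (ℕ.≤-trans (ℕ.m≤n+m _ _) (ℕ.m≤n+m _ (𝟙 (P root))))

-- The form of the forest inequality that the recursion preserves: it also covers
-- the empty set, for which 1 ⊓ #nodes P is 0.
forest-⊓ : ∀ {h} (P : Node h → Bool) → #edges P + 1 ⊓ #nodes P ≤ #nodes P
forest-⊓ {zero}  P = ℕ.m⊓n≤n 1 (#nodes P)
forest-⊓ {suc h} P with P root
... | false = combine (#edges (P ∘ left)) (#edges (P ∘ right)) (forest-⊓ (P ∘ left))
    (forest-⊓ (P ∘ right))
  where
  open ℕ.≤-Reasoning
  shuffle : ∀ e₁ e₂ a b → e₁ + e₂ + (a + b) ≡ (e₁ + a) + (e₂ + b)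
  shuffle = solve-∀
  sub : ∀ a b → 1 ⊓ (a + b) ≤ 1 ⊓ a + 1 ⊓ b
  sub zero    b = ℕ.≤-refl
  sub (suc a) b = s≤s z≤n
  combine : ∀ e₁ e₂ {n₁ n₂} → e₁ + 1 ⊓ n₁ ≤ n₁ → e₂ + 1 ⊓ n₂ ≤ n₂ → e₁ + e₂ + 1 ⊓ (n₁ + n₂) ≤ n₁ + n₂
  combine e₁ e₂ {n₁} {n₂} l r = begin
    e₁ + e₂ + 1 ⊓ (n₁ + n₂)          ≤⟨ ℕ.+-monoʳ-≤ (e₁ + e₂) (sub n₁ n₂) ⟩
    e₁ + e₂ + (1 ⊓ n₁ + 1 ⊓ n₂)      ≡⟨ shuffle e₁ e₂ (1 ⊓ n₁) (1 ⊓ n₂) ⟩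
    (e₁ + 1 ⊓ n₁) + (e₂ + 1 ⊓ n₂)    ≤⟨ ℕ.+-mono-≤ l r ⟩
    n₁ + n₂                          ∎
... | true = combine (#edges (P ∘ left)) (#edges (P ∘ right)) (edge (P ∘ left)) (edge (P ∘ right))
                (forest-⊓ (P ∘ left)) (forest-⊓ (P ∘ right))
  where
  open ℕ.≤-Reasoning
  edge : ∀ {h} (P : Node h → Bool) → 𝟙 (P root) ≤ 1 ⊓ #nodes P
  edge P = ℕ.⊓-glb (𝟙≤1 (P root)) (root≤#nodes P)
  shuffle : ∀ e₁ e₂ a b → a + (b + (e₁ + e₂)) + 1 ≡ suc ((e₁ + a) + (e₂ + b))
  shuffle = solve-∀
  combine : ∀ e₁ e₂ {a b n₁ n₂} → a ≤ 1 ⊓ n₁ → b ≤ 1 ⊓ n₂ → e₁ + 1 ⊓ n₁ ≤ n₁ → e₂ + 1 ⊓ n₂ ≤ n₂ →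
            a + (b + (e₁ + e₂)) + 1 ≤ suc (n₁ + n₂)
  combine e₁ e₂ {a} {b} {n₁} {n₂} a≤ b≤ l r = begin
    a + (b + (e₁ + e₂)) + 1          ≡⟨ shuffle e₁ e₂ a b ⟩
    suc ((e₁ + a) + (e₂ + b))        ≤⟨ s≤s (ℕ.+-mono-≤ (ℕ.+-monoʳ-≤ e₁ a≤) (ℕ.+-monoʳ-≤ e₂ b≤)) ⟩
    suc ((e₁ + 1 ⊓ n₁) + (e₂ + 1 ⊓ n₂)) ≤⟨ s≤s (ℕ.+-mono-≤ l r) ⟩
    suc (n₁ + n₂)                    ∎

-- A nonempty vertex set of a tree spans fewer edges than vertices.
forest : ∀ {h} (P : Node h → Bool) → 1 ≤ #nodes P → suc (#edges P) ≤ #nodes P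
forest P 1≤ = subst (_≤ #nodes P)
    (trans (cong (λ t → #edges P + t) (ℕ.m≤n⇒m⊓n≡m 1≤)) (ℕ.+-comm (#edges P) 1)) (forest-⊓ P)

forest-list : ∀ h (xs : List (Fin (N h))) → 1 ≤ length xs →
              suc (#inside (Graph.edges (B h)) xs) ≤ length xs
forest-list h xs@(x ∷ _) _ = begin
  suc (#inside (Graph.edges (B h)) xs)  ≡⟨ cong suc (edgeSumℕ h (λ i j → 𝟙 (inside xs (i , j)))) ⟩
  suc (#edges P)                        ≤⟨ forest P (#nodes-positive P (dec h x) Px) ⟩
  #nodes P                              ≡⟨ Σnodes-tabulate h (𝟙 ∘ Q) ⟨
  sum (tabulate (𝟙 ∘ Q))                ≡⟨ cong sum (map-tabulate id (𝟙 ∘ Q)) ⟨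
  sum (map (𝟙 ∘ Q) (allFin (N h)))      ≡⟨ length-filter (_∈ᴸ? xs) (allFin (N h)) ⟨
  length (filter (_∈ᴸ? xs) (allFin (N h))) ≤⟨ length-⊆ (Unique.filter⁺ (_∈ᴸ? xs) (Unique.allFin⁺ (N h)))
                                                (λ i∈ → proj₂ (∈-filter⁻ (_∈ᴸ? xs) {xs = allFin (N h)}
                                                    i∈)) ⟩
  length xs                             ∎
  where
  open ℕ.≤-Reasoning
  Q : Fin (N h) → Bool
  Q i = does (i ∈ᴸ? xs)
  P : Node h → Bool
  P = Q ∘ enc
  Px : P (dec h x) ≡ true
  Px = dec-true (enc (dec h x) ∈ᴸ? xs) (here (enc-dec h x))

-- A cheap dominating ultrametric

-- Twice the height of the subtree below the lowest common ancestor of two distinct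
-- vertices, and 0 for equal ones.
lcaHeight : ∀ {h} → Node h → Node h → ℕ
lcaHeight             root      root      = 0
lcaHeight             (left x)  (left y)  = lcaHeight x y
lcaHeight             (right x) (right y) = lcaHeight x y
lcaHeight {h = suc h} root      (left _)  = suc h + suc h
lcaHeight {h = suc h} root      (right _) = suc h + suc h
lcaHeight {h = suc h} (left _)  root      = suc h + suc h
lcaHeight {h = suc h} (left _)  (right _) = suc h + suc h
lcaHeight {h = suc h} (right _) root      = suc h + suc h
lcaHeight {h = suc h} (right _) (left _)  = suc h + suc h

lcaHeight≤ : ∀ {h} (x y : Node h) → lcaHeight x y ≤ h + h
lcaHeight≤ root      root      = z≤n
lcaHeight≤ {suc h} (left x)  (left y)  = ℕ.≤-trans (lcaHeight≤ x y) (ℕ.+-mono-≤ (ℕ.n≤1+n h) (ℕ.n≤1+n h))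
lcaHeight≤ {suc h} (right x) (right y) = ℕ.≤-trans (lcaHeight≤ x y) (ℕ.+-mono-≤ (ℕ.n≤1+n h) (ℕ.n≤1+n h))
lcaHeight≤ root      (left _)  = ℕ.≤-refl
lcaHeight≤ root      (right _) = ℕ.≤-refl
lcaHeight≤ (left _)  root      = ℕ.≤-refl
lcaHeight≤ (left _)  (right _) = ℕ.≤-refl
lcaHeight≤ (right _) root      = ℕ.≤-refl
lcaHeight≤ (right _) (left _)  = ℕ.≤-refl

lcaHeight-diagonal : ∀ {h} (x : Node h) → lcaHeight x x ≡ 0
lcaHeight-diagonal root      = refl
lcaHeight-diagonal (left x)  = lcaHeight-diagonal x
lcaHeight-diagonal (right x) = lcaHeight-diagonal x

lcaHeight-sym : ∀ {h} (x y : Node h) → lcaHeight x y ≡ lcaHeight y x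
lcaHeight-sym root      root      = refl
lcaHeight-sym (left x)  (left y)  = lcaHeight-sym x y
lcaHeight-sym (right x) (right y) = lcaHeight-sym x y
lcaHeight-sym root      (left _)  = refl
lcaHeight-sym root      (right _) = refl
lcaHeight-sym (left _)  root      = refl
lcaHeight-sym (left _)  (right _) = refl
lcaHeight-sym (right _) root      = refl
lcaHeight-sym (right _) (left _)  = refl

lcaHeight-ultra : ∀ {h} (x y z : Node h) → lcaHeight x z ≤ lcaHeight x y ⊔ lcaHeight y z
lcaHeight-ultra (left x)    (left y)      (left z)    = lcaHeight-ultra x y z
lcaHeight-ultra (right x)   (right y)     (right z)   = lcaHeight-ultra x y z
lcaHeight-ultra root        y             root        = z≤n
lcaHeight-ultra root        root          z@(left _)  = ℕ.≤-refl
lcaHeight-ultra root        root          z@(right _) = ℕ.≤-refl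
lcaHeight-ultra x@root      y@(left _)    z@(left _)  = ℕ.m≤m⊔n (lcaHeight x y) (lcaHeight y z)
lcaHeight-ultra x@root      y@(left _)    z@(right _) = ℕ.m≤m⊔n (lcaHeight x y) (lcaHeight y z)
lcaHeight-ultra x@root      y@(right _)   z@(left _)  = ℕ.m≤m⊔n (lcaHeight x y) (lcaHeight y z)
lcaHeight-ultra x@root      y@(right _)   z@(right _) = ℕ.m≤m⊔n (lcaHeight x y) (lcaHeight y z)
lcaHeight-ultra x@(left _)  y@root        z           = ℕ.≤-trans (lcaHeight≤ x z)
    (ℕ.m≤m⊔n (lcaHeight x y) (lcaHeight y z))
lcaHeight-ultra x@(left _)  y@(right _)   z           = ℕ.≤-trans (lcaHeight≤ x z)
    (ℕ.m≤m⊔n (lcaHeight x y) (lcaHeight y z))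
lcaHeight-ultra x@(left _)  y@(left _)    z@root      = ℕ.m≤n⊔m (lcaHeight x y) (lcaHeight y z)
lcaHeight-ultra x@(left _)  y@(left _)    z@(right _) = ℕ.m≤n⊔m (lcaHeight x y) (lcaHeight y z)
lcaHeight-ultra x@(right _) y@root        z           = ℕ.≤-trans (lcaHeight≤ x z)
    (ℕ.m≤m⊔n (lcaHeight x y) (lcaHeight y z))
lcaHeight-ultra x@(right _) y@(left _)    z           = ℕ.≤-trans (lcaHeight≤ x z)
    (ℕ.m≤m⊔n (lcaHeight x y) (lcaHeight y z))
lcaHeight-ultra x@(right _) y@(right _)   z@root      = ℕ.m≤n⊔m (lcaHeight x y) (lcaHeight y z)
lcaHeight-ultra x@(right _) y@(right _)   z@(left _)  = ℕ.m≤n⊔m (lcaHeight x y) (lcaHeight y z)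

-- Through the lowest common ancestor.
lcaHeight-trail : ∀ {h} (x y : Node h) → ∃ λ k → k ≤ lcaHeight x y × Trail x y k
lcaHeight-trail root        root        = 0 , z≤n , []
lcaHeight-trail (left x)    (left y)    = let k , le , t = lcaHeight-trail x y in k , le , leftᵀ t
lcaHeight-trail (right x)   (right y)   = let k , le , t = lcaHeight-trail x y in k , le , rightᵀ t
lcaHeight-trail x@root      y@(left _)  = viaRoot x y
lcaHeight-trail x@root      y@(right _) = viaRoot x y
lcaHeight-trail x@(left _)  y@root      = viaRoot x y
lcaHeight-trail x@(left _)  y@(right _) = viaRoot x y
lcaHeight-trail x@(right _) y@root      = viaRoot x y
lcaHeight-trail x@(right _) y@(left _)  = viaRoot x y

dist≤trail : ∀ h (f : Node h → Node h → ℕ) → (∀ x y → ∃ λ k → k ≤ f x y × Trail x y k) →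
             ∀ i j → Graph.dist (B h) i j ≤ f (dec h i) (dec h j)
dist≤trail h f trail i j = let k , k≤ , t = trail (dec h i) (dec h j) in
  subst₂ (λ a b → Graph.dist (B h) a b ≤ f (dec h i) (dec h j)) (enc-dec h i) (enc-dec h j)
    (ℕ.≤-trans (dist≤length t) k≤)

-- lcaHeight on vertex numbers.
lcaUltra : ∀ h → Fin (N h) → Fin (N h) → ℕ
lcaUltra h i j = lcaHeight (dec h i) (dec h j)

lcaUltra-dominating : ∀ h → DominatingUltra (B h) (lcaUltra h)
lcaUltra-dominating h = dominating
  (λ i → lcaHeight-diagonal (dec h i))
  (λ i j → lcaHeight-sym (dec h i) (dec h j))
  (λ i j k → lcaHeight-ultra (dec h i) (dec h j) (dec h k))
  (dist≤trail h lcaHeight lcaHeight-trail)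

-- By M (suc h) = 2 + 2 * M h the cost satisfies this equation exactly.
Σ-lcaHeight : ∀ h → Σedges {h} lcaHeight + 4 * h ≡ 4 * M h
Σ-lcaHeight zero    = refl
Σ-lcaHeight (suc h) = begin
  suc h + suc h + (suc h + suc h + (c + c)) + 4 * suc h   ≡⟨ lhs c h ⟩
  8 + 2 * (c + 4 * h)                                     ≡⟨ cong (λ t → 8 + 2 * t) (Σ-lcaHeight h) ⟩
  8 + 2 * (4 * M h)                                       ≡⟨ rhs (M h) ⟩
  4 * M (suc h)                                           ∎
  where
  open ≡-Reasoning
  c = Σedges {h} lcaHeight
  lhs : ∀ c h → suc h + suc h + (suc h + suc h + (c + c)) + 4 * suc h ≡ 8 + 2 * (c + 4 * h)
  lhs = solve-∀
  rhs : ∀ m → 8 + 2 * (4 * m) ≡ 4 * (suc m + suc m)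
  rhs = solve-∀

edgeCost-lcaUltra : ∀ h → edgeCost (B h) (lcaUltra h) ≤ 4 * M h
edgeCost-lcaUltra h = begin
  edgeCost (B h) (lcaUltra h)                    ≡⟨ edgeSumℕ h (lcaUltra h) ⟩
  Σedges {h} (λ p c → lcaUltra h (enc p) (enc c))
    ≡⟨ Σedges-cong {h} (λ {p} {c} _ → cong₂ lcaHeight (dec-enc p) (dec-enc c)) ⟩
  Σedges {h} lcaHeight                                    ≤⟨ ℕ.m≤m+n _ (4 * h) ⟩
  Σedges {h} lcaHeight + 4 * h                            ≡⟨ Σ-lcaHeight h ⟩
  4 * M h                                                 ∎
  where open ℕ.≤-Reasoning

edgeCost-dominating : ∀ h f → DominatingUltra (B h) f → M h ≤ edgeCost (B h) f
edgeCost-dominating h f (dominating _ _ _ dom) = begin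
  M h                                        ≡⟨ Σedges-1 h ⟨
  Σedges {h} (λ _ _ → 1)                     ≤⟨ Σedges-mono {h} positive ⟩
  Σedges {h} (λ p c → f (enc p) (enc c))     ≡⟨ edgeSumℕ h f ⟨
  edgeCost (B h) f                  ∎
  where
  open ℕ.≤-Reasoning
  positive : ∀ {p c : Node h} → p ◁ c → 1 ≤ f (enc p) (enc c)
  positive {p} {c} e = ℕ.≤-trans
    (ℕ.n≢0⇒n>0 λ d≡0 → ℕ.<-irrefl (cong toℕ (dist≡0 (B h) d≡0)) (◁⇒< e)) (dom (enc p) (enc c))

-- A cheap dominating hierarchy

module _ {n} (l r : BinaryTree n) (x y : Fin n) where
  lca-left : x ∈ leaves l → y ∈ leaves l → lcaSubtree (Binary.node l _ r) x y ≡ lcaSubtree l x y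
  lca-left x∈ y∈ = cong
    (λ b → if b then lcaSubtree l x y else
           if does ((x ∈ᴸ? leaves r) ×-dec (y ∈ᴸ? leaves r)) then lcaSubtree r x y else Binary.node l _ r)
    (dec-true ((x ∈ᴸ? leaves l) ×-dec (y ∈ᴸ? leaves l)) (x∈ , y∈))

  lca-right : ¬ (x ∈ leaves l × y ∈ leaves l) → x ∈ leaves r → y ∈ leaves r →
              lcaSubtree (Binary.node l _ r) x y ≡ lcaSubtree r x y
  lca-right ∉l x∈ y∈ = cong₂
    (λ b c → if b then lcaSubtree l x y else if c then lcaSubtree r x y else Binary.node l _ r)
    (dec-false ((x ∈ᴸ? leaves l) ×-dec (y ∈ᴸ? leaves l)) ∉l)
    (dec-true ((x ∈ᴸ? leaves r) ×-dec (y ∈ᴸ? leaves r)) (x∈ , y∈))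

  lca-here : ¬ (x ∈ leaves l × y ∈ leaves l) → ¬ (x ∈ leaves r × y ∈ leaves r) →
             lcaSubtree (Binary.node l _ r) x y ≡ Binary.node l _ r
  lca-here ∉l ∉r = cong₂
    (λ b c → if b then lcaSubtree l x y else if c then lcaSubtree r x y else Binary.node l _ r)
    (dec-false ((x ∈ᴸ? leaves l) ×-dec (y ∈ᴸ? leaves l)) ∉l)
    (dec-false ((x ∈ᴸ? leaves r) ×-dec (y ∈ᴸ? leaves r)) ∉r)

-- The hierarchy on the image of e: the right subtree against the rest, then the
-- root against the left subtree.
hier : ∀ {n} h → (Node h → Fin n) → BinaryTree n
rootAndLeft : ∀ {n} h → (Node (suc h) → Fin n) → BinaryTree n
hier zero    e = Binary.leaf (e root)
hier (suc h) e = Binary.node (rootAndLeft h e) tt (hier h (e ∘ right))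
rootAndLeft h e = Binary.node (Binary.leaf (e root)) tt (hier h (e ∘ left))

tabulate-+ : ∀ {A : Set} m {k} (f : Fin (m + k) → A) →
             tabulate f ≡ tabulate (f ∘ (_↑ˡ k)) ++ tabulate (f ∘ (m ↑ʳ_))
tabulate-+ zero    f = refl
tabulate-+ (suc m) f = cong (f zero ∷_) (tabulate-+ m (f ∘ suc))

-- The leaves come out in preorder.
leaves-hier : ∀ {n} h (e : Node h → Fin n) → leaves (hier h e) ≡ tabulate (e ∘ dec h)
leaves-hier zero    e = refl
leaves-hier (suc h) e = begin
  leaves (hier (suc h) e)
    ≡⟨ leaves-node (rootAndLeft h e) (hier h (e ∘ right)) ⟩
  e root ∷ leaves (hier h (e ∘ left)) ++ leaves (hier h (e ∘ right))
    ≡⟨ cong₂ (λ a b → e root ∷ a ++ b) (leaves-hier h (e ∘ left)) (leaves-hier h (e ∘ right)) ⟩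
  e root ∷ tabulate (e ∘ left ∘ dec h) ++ tabulate (e ∘ right ∘ dec h)
    ≡⟨ cong₂ (λ a b → e root ∷ a ++ b)
         (tabulate-cong {f = λ i → e (left (dec h i))} {g = λ i → f (i ↑ˡ N h)}
           λ i → cong (e ∘ [ left ∘ dec h , right ∘ dec h ]′) (sym (Fin.splitAt-↑ˡ (N h) i (N h))))
         (tabulate-cong {f = λ i → e (right (dec h i))} {g = λ i → f (N h ↑ʳ i)}
           λ i → cong (e ∘ [ left ∘ dec h , right ∘ dec h ]′) (sym (Fin.splitAt-↑ʳ (N h) (N h) i))) ⟩
  e root ∷ tabulate {n = N h} (λ i → f (i ↑ˡ N h)) ++ tabulate {n = N h} (λ i → f (N h ↑ʳ i))
    ≡⟨ cong (e root ∷_) (tabulate-+ (N h) f) ⟨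
  tabulate (e ∘ dec (suc h)) ∎
  where
  open ≡-Reasoning
  f : Fin (N h + N h) → _
  f i = e (dec (suc h) (suc i))

∈-hier : ∀ {n} {h} (e : Node h → Fin n) v → e v ∈ leaves (hier h e)
∈-hier {h = h} e v = subst₂ _∈_ (cong e (dec-enc v)) (sym (leaves-hier h e))
    (∈-tabulate⁺ {f = e ∘ dec h} (enc v))

∈-hier⁻ : ∀ {n} {h} (e : Node h → Fin n) {x} → x ∈ leaves (hier h e) → ∃ λ v → x ≡ e v
∈-hier⁻ {h = h} e x∈ =
  let i , eq = ∈-tabulate⁻ {f = e ∘ dec h} (subst (_ ∈_) (leaves-hier h e) x∈) in dec h i , eq

length-hier : ∀ {n} h (e : Node h → Fin n) → length (leaves (hier h e)) ≡ N h
length-hier h e = trans (cong length (leaves-hier h e)) (length-tabulate (e ∘ dec h))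

-- The values of hierarchyHeight for hier: clusters have size N h + 1 or
-- N h + N h + 1.
clusterHeight : ∀ {h} → Node h → Node h → ℕ
clusterHeight             root      root      = 0
clusterHeight             (left x)  (left y)  = clusterHeight x y
clusterHeight             (right x) (right y) = clusterHeight x y
clusterHeight {h = suc h} root      (left _)  = N h
clusterHeight {h = suc h} (left _)  root      = N h
clusterHeight {h = suc h} root      (right _) = N h + N h
clusterHeight {h = suc h} (right _) root      = N h + N h
clusterHeight {h = suc h} (left _)  (right _) = N h + N h
clusterHeight {h = suc h} (right _) (left _)  = N h + N h

clusterHeight-diagonal : ∀ {h} (x : Node h) → clusterHeight x x ≡ 0
clusterHeight-diagonal root      = refl
clusterHeight-diagonal (left x)  = clusterHeight-diagonal x
clusterHeight-diagonal (right x) = clusterHeight-diagonal x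

h≤M : ∀ h → h ≤ M h
h≤M zero    = z≤n
h≤M (suc h) = s≤s (ℕ.≤-trans (h≤M h) (ℕ.m≤m+n (M h) (N h)))

viaRoot≤ : ∀ {h} (x y : Node (suc h)) → ∃ λ k → k ≤ N h + N h × Trail x y k
viaRoot≤ {h} x y = let k , le , t = viaRoot x y in
  k , ℕ.≤-trans le (ℕ.+-mono-≤ (s≤s (h≤M h)) (s≤s (h≤M h))) , t

clusterHeight-trail : ∀ {h} (x y : Node h) → ∃ λ k → k ≤ clusterHeight x y × Trail x y k
clusterHeight-trail root        root        = 0 , z≤n , []
clusterHeight-trail (left x)    (left y)    = let k , le , t = clusterHeight-trail x y in k , le , leftᵀ t
clusterHeight-trail (right x)   (right y)   = let k , le , t = clusterHeight-trail x y in k , le , rightᵀ t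
clusterHeight-trail {suc h} root y@(left _) =
  let k , le , t = toRoot y in k , ℕ.≤-trans le (s≤s (h≤M h)) , reverseᵀ t
clusterHeight-trail {suc h} y@(left _) root =
  let k , le , t = toRoot y in k , ℕ.≤-trans le (s≤s (h≤M h)) , t
clusterHeight-trail x@root      y@(right _) = viaRoot≤ x y
clusterHeight-trail x@(right _) y@root      = viaRoot≤ x y
clusterHeight-trail x@(left _)  y@(right _) = viaRoot≤ x y
clusterHeight-trail x@(right _) y@(left _)  = viaRoot≤ x y

-- Also true for x = y, where the cluster is a single leaf.
lca-hier : ∀ {n} {h} (e : Node h → Fin n) → (∀ {v w} → e v ≡ e w → v ≡ w) → ∀ x y →
           length (leaves (lcaSubtree (hier h e) (e x) (e y))) ∸ 1 ≡ clusterHeight x y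
lca-hier {h = zero}  e inj root root = refl
lca-hier {n} {h = suc h} e inj = λ where
    root      root      → cong len
        (trans (inL root root root∈ root∈) (lca-left Lf Lt (e root) (e root) (here refl) (here refl)))
    (left x)  (left y)  → trans (cong len (trans (inL (left x) (left y) (left∈ x) (left∈ y))
                            (lca-right Lf Lt (e (left x)) (e (left y)) (λ (p , _) → left∉Lf x p)
                                (∈-hier (e ∘ left) x) (∈-hier (e ∘ left) y))))
                            (lca-hier (e ∘ left) (left-inj ∘ inj) x y)
    (right x) (right y) → trans
        (cong len (lca-right LL Rt (e (right x)) (e (right y)) (λ (p , _) → right∉ x p)
                            (∈-hier (e ∘ right) x) (∈-hier (e ∘ right) y)))
                            (lca-hier (e ∘ right) (right-inj ∘ inj) x y)
    root      (left y)  → trans (cong len (trans (inL root (left y) root∈ (left∈ y))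
                            (lca-here Lf Lt (e root) (e (left y)) (λ (_ , p) → left∉Lf y p)
                                (λ (p , _) → root∉Lt p)))) len-LL
    (left x)  root      → trans (cong len (trans (inL (left x) root (left∈ x) root∈)
                            (lca-here Lf Lt (e (left x)) (e root) (λ (p , _) → left∉Lf x p)
                                (λ (_ , p) → root∉Lt p)))) len-LL
    root      (right y) → trans
        (cong len (lca-here LL Rt (e root) (e (right y)) (λ (_ , p) → right∉ y p)
            (λ (p , _) → root∉Rt p))) len-top
    (right x) root      → trans
        (cong len (lca-here LL Rt (e (right x)) (e root) (λ (p , _) → right∉ x p)
            (λ (_ , p) → root∉Rt p))) len-top
    (left x)  (right y) → trans
        (cong len (lca-here LL Rt (e (left x)) (e (right y)) (λ (_ , p) → right∉ y p)
            (λ (p , _) → left∉Rt x p))) len-top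
    (right x) (left y)  → trans
        (cong len (lca-here LL Rt (e (right x)) (e (left y)) (λ (p , _) → right∉ x p)
            (λ (_ , p) → left∉Rt y p))) len-top
  where
  len : BinaryTree n → ℕ
  len t = length (leaves t) ∸ 1
  Lf Lt LL Rt : BinaryTree n
  Lf = Binary.leaf (e root)
  Lt = hier h (e ∘ left)
  LL = rootAndLeft h e
  Rt = hier h (e ∘ right)
  left-inj : ∀ {v w : Node h} → Node.left v ≡ left w → v ≡ w
  left-inj refl = refl
  right-inj : ∀ {v w : Node h} → Node.right v ≡ right w → v ≡ w
  right-inj refl = refl
  LL≡ : leaves LL ≡ e root ∷ leaves Lt
  LL≡ = leaves-node Lf Lt
  root∈ : e root ∈ leaves LL
  root∈ = subst (e root ∈_) (sym LL≡) (here refl)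
  left∈ : ∀ x → e (left x) ∈ leaves LL
  left∈ x = subst (e (left x) ∈_) (sym LL≡) (there (∈-hier (e ∘ left) x))
  left∉Lf : ∀ x → e (left x) ∉ leaves Lf
  left∉Lf x (here eq) with () ← inj eq
  root∉Lt : e root ∉ leaves Lt
  root∉Lt p with () ← inj (proj₂ (∈-hier⁻ (e ∘ left) p))
  root∉Rt : e root ∉ leaves Rt
  root∉Rt p with () ← inj (proj₂ (∈-hier⁻ (e ∘ right) p))
  left∉Rt : ∀ x → e (left x) ∉ leaves Rt
  left∉Rt x p with () ← inj (proj₂ (∈-hier⁻ (e ∘ right) p))
  right∉ : ∀ x → e (right x) ∉ leaves LL
  right∉ x p with subst (e (right x) ∈_) LL≡ p
  ... | here eq with () ← inj eq
  ... | there q with () ← inj (proj₂ (∈-hier⁻ (e ∘ left) q))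
  inL : ∀ x y → e x ∈ leaves LL → e y ∈ leaves LL → lcaSubtree (hier (suc h) e) (e x)
      (e y) ≡ lcaSubtree LL (e x) (e y)
  inL x y = lca-left LL Rt (e x) (e y)
  len-LL : len LL ≡ N h
  len-LL = trans (cong (λ xs → length xs ∸ 1) LL≡) (length-hier h (e ∘ left))
  len-top : len (hier (suc h) e) ≡ N h + N h
  len-top = cong (_∸ 1) (length-hier (suc h) e)

-- hier as a hierarchy on the vertices of B h.
hierarchy : ∀ h → Hierarchy (N h)
hierarchy h = hier h enc , ↭-reflexive (trans (leaves-hier h enc) (tabulate-cong (enc-dec h)))

hierarchyHeight-hier : ∀ h (x y : Node h) → hierarchyHeight (hierarchy h) (enc x)
    (enc y) ≡ clusterHeight x y
hierarchyHeight-hier h x y with enc x Fin.≟ enc y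
... | no  _  = lca-hier enc enc-injective x y
... | yes eq = sym (trans (cong (clusterHeight x) (sym (enc-injective eq))) (clusterHeight-diagonal x))

hierarchy-dominating : ∀ h → Dominating (B h) (hierarchy h)
hierarchy-dominating h i j = subst (Graph.dist (B h) i j ≤_)
  (trans (sym (hierarchyHeight-hier h (dec h i) (dec h j)))
    (cong₂ (hierarchyHeight (hierarchy h)) (enc-dec h i) (enc-dec h j)))
  (dist≤trail h clusterHeight clusterHeight-trail i j)

Σ-clusterHeight : ∀ h → Σedges {h} clusterHeight ≤ 3 * h * M h
Σ-clusterHeight zero    = z≤n
Σ-clusterHeight (suc h) = begin
  N h + (N h + N h + (c + c))                      ≡⟨ lhs (M h) c ⟩
  3 + 3 * M h + 2 * c
    ≤⟨ ℕ.+-monoʳ-≤ (3 + 3 * M h) (ℕ.*-monoʳ-≤ 2 (Σ-clusterHeight h)) ⟩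
  3 + 3 * M h + 2 * (3 * h * M h)                  ≤⟨ ℕ.m≤m+n _ (3 + 3 * M h + 6 * h) ⟩
  3 + 3 * M h + 2 * (3 * h * M h) + (3 + 3 * M h + 6 * h) ≡⟨ rhs (M h) h ⟩
  3 * suc h * M (suc h)                            ∎
  where
  open ℕ.≤-Reasoning
  c = Σedges {h} clusterHeight
  lhs : ∀ m c → suc m + (suc m + suc m + (c + c)) ≡ 3 + 3 * m + 2 * c
  lhs = solve-∀
  rhs : ∀ m h → 3 + 3 * m + 2 * (3 * h * m) + (3 + 3 * m + 6 * h) ≡ 3 * suc h * (suc m + suc m)
  rhs = solve-∀

edgeCost-hierarchy : ∀ h → edgeCost (B h) (hierarchyHeight (hierarchy h)) ≤ 3 * h * M h
edgeCost-hierarchy h = begin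
  edgeCost (B h) (hierarchyHeight (hierarchy h))  ≡⟨ edgeSumℕ h (hierarchyHeight (hierarchy h)) ⟩
  Σedges {h} (λ p c → hierarchyHeight (hierarchy h) (enc p) (enc c))
    ≡⟨ Σedges-cong {h} (λ {p} {c} _ → hierarchyHeight-hier h p c) ⟩
  Σedges {h} clusterHeight                                 ≤⟨ Σ-clusterHeight h ⟩
  3 * h * M h                                              ∎
  where open ℕ.≤-Reasoning

edgeCost-lower : ∀ h (H : Hierarchy (N h)) → suc h * M h ≤ 2 * edgeCost (B h) (hierarchyHeight H)
edgeCost-lower h H@(t , p) = cancel (M h) h (2 ^ suc h) (length (leaves t)) (#inside es (leaves t))
    (treeCost es t)
  (edgeCost (B h) (hierarchyHeight H)) (N-power h) size all-inside cost≤
  (treeCost-lower es (forest-list h) h t (↭-unique (↭-sym p) (Unique.allFin⁺ (N h))))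
  where
  open ℕ.≤-Reasoning
  es = Graph.edges (B h)
  member : ∀ i → i ∈ leaves t
  member i = ↭.∈-resp-↭ (↭-sym p) (∈-allFin i)
  size : length (leaves t) ≡ N h
  size = trans (↭.↭-length p) (length-tabulate id)
  all-inside : #inside es (leaves t) ≡ M h
  all-inside = trans (edgeSumℕ h (λ i j → 𝟙 (inside (leaves t) (i , j))))
    (trans (Σedges-cong {h} (λ {p} {c} _ → cong 𝟙
        (dec-true ((enc p ∈ᴸ? leaves t) ×-dec (enc c ∈ᴸ? leaves t)) (member (enc p) , member (enc c)))))
      (Σedges-1 h))
  drop-guard : ∀ a b m → b ≡ false → (if a then m else 0) ≤ (if b then 0 else m)
  drop-guard false _ m refl = z≤n
  drop-guard true  _ m refl = ℕ.≤-refl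
  cost≤ : treeCost es t ≤ edgeCost (B h) (hierarchyHeight H)
  cost≤ = begin
    treeCost es t
      ≡⟨ edgeSumℕ h (λ i j → edgeHeight t (i , j)) ⟩
    Σedges {h} (λ p c → edgeHeight t (enc p , enc c))          ≤⟨ Σedges-mono {h} (λ {p} {c} e →
      drop-guard (inside (leaves t) (enc p , enc c)) (does (enc p Fin.≟ enc c))
          (length (leaves (lcaSubtree t (enc p) (enc c))) ∸ 1)
        (dec-false (enc p Fin.≟ enc c) λ eq → ℕ.<-irrefl (cong toℕ eq) (◁⇒< e))) ⟩
    Σedges {h} (λ p c → hierarchyHeight H (enc p) (enc c))     ≡⟨ edgeSumℕ h (hierarchyHeight H) ⟨
    edgeCost (B h) (hierarchyHeight H)                ∎
  cancel : ∀ m h Q s E c c′ → suc (suc m) ≡ Q → s ≡ suc m → E ≡ m → c ≤ c′ →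
           s * (h + 2) + Q * E ≤ 2 * c + Q * s → suc h * m ≤ 2 * c′
  cancel m h _ _ _ c c′ refl refl refl c≤c′ le = ℕ.+-cancelˡ-≤ (suc (suc m) * m + suc (suc m)) _ _ (begin
    suc (suc m) * m + suc (suc m) + suc h * m           ≤⟨ ℕ.m≤m+n _ h ⟩
    suc (suc m) * m + suc (suc m) + suc h * m + h       ≡⟨ lhs m h ⟩
    suc m * (h + 2) + suc (suc m) * m                   ≤⟨ le ⟩
    2 * c + suc (suc m) * suc m                         ≤⟨ ℕ.+-monoˡ-≤ _ (ℕ.*-monoʳ-≤ 2 c≤c′) ⟩
    2 * c′ + suc (suc m) * suc m                        ≡⟨ rhs m c′ ⟩
    suc (suc m) * m + suc (suc m) + 2 * c′              ∎)
    where
    lhs : ∀ m h → suc (suc m) * m + suc (suc m) + suc h * m + h ≡ suc m * (h + 2) + suc (suc m) * m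
    lhs = solve-∀
    rhs : ∀ m c → 2 * c + suc (suc m) * suc m ≡ suc (suc m) * m + suc (suc m) + 2 * c
    rhs = solve-∀

-- The ratio of the optima

-- The hypotheses on n give h ≤ log₂ (suc n) ≤ h + 1, those on a and b give
-- (h + 1) / 8 ≤ a / b ≤ 3 * h.
quotient-bounds : ∀ a b h n → 1 ≤ b → 2 ^ h ≤ suc n → suc n ≤ 2 ^ suc h → a ≤ 3 * h * b →
    suc h * b ≤ 8 * a →
  ∃ λ ratio → IsQuotient ratio (fromℕ a) (fromℕ b) ×
    fromℚ (+ 1 ℚ./ 8) *ℝ log₂ (suc n) ≤ℝ ratio × ratio ≤ℝ fromℕ 3 *ℝ log₂ (suc n)
quotient-bounds a b@(suc b′) h n _ lo hi a≤ a≥ = fromℚ q ,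
  (fromℕ-mono-< 0 b (s≤s z≤n) , pointwise-≃ {fromℚ q *ℝ fromℕ b} {fromℕ a} (λ _ → /-*-cancel a b′)) ,
  pointwise-≤ {fromℚ (+ 1 ℚ./ 8) *ℝ log₂ (suc n)} {fromℚ q}
    (λ k → ℚ.≤-trans (ℚ.*-monoˡ-≤-nonNeg (+ 1 ℚ./ 8) (log₂≤ (suc h) n hi k)) lower) ,
  pointwise-≤ {fromℚ q} {fromℕ 3 *ℝ log₂ (suc n)}
    (λ k → ℚ.≤-trans upper (ℚ.*-monoˡ-≤-nonNeg (ι 3) (≤log₂ h n lo k)))
  where
  q = + a ℚ./ b
  open ℚ.≤-Reasoning
  instance
    b-positive : ℚ.Positive (ι b)
    b-positive = ℚ.positive (0<ι {b} (s≤s z≤n))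
  upper : q ℚ.≤ ι 3 ℚ.* ι h
  upper = ℚ.*-cancelʳ-≤-pos (ι b) (begin
    q ℚ.* ι b                 ≡⟨ /-*-cancel a b′ ⟩
    ι a                       ≤⟨ ι-mono-≤ {a} {3 * h * b} a≤ ⟩
    ι (3 * h * b)             ≡⟨ ι-* (3 * h) b ⟩
    ι (3 * h) ℚ.* ι b         ≡⟨ cong (ℚ._* ι b) (ι-* 3 h) ⟩
    ι 3 ℚ.* ι h ℚ.* ι b       ∎)
  lower : (+ 1 ℚ./ 8) ℚ.* ι (suc h) ℚ.≤ q
  lower = ℚ.*-cancelʳ-≤-pos (ι b) (begin
    (+ 1 ℚ./ 8) ℚ.* ι (suc h) ℚ.* ι b     ≡⟨ ℚ.*-assoc (+ 1 ℚ./ 8) (ι (suc h)) (ι b) ⟩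
    (+ 1 ℚ./ 8) ℚ.* (ι (suc h) ℚ.* ι b)   ≡⟨ cong ((+ 1 ℚ./ 8) ℚ.*_) (ι-* (suc h) b) ⟨
    (+ 1 ℚ./ 8) ℚ.* ι (suc h * b)
      ≤⟨ ℚ.*-monoˡ-≤-nonNeg (+ 1 ℚ./ 8) (ι-mono-≤ {suc h * b} {8 * a} a≥) ⟩
    (+ 1 ℚ./ 8) ℚ.* ι (8 * a)             ≡⟨ cong ((+ 1 ℚ./ 8) ℚ.*_) (ι-* 8 a) ⟩
    (+ 1 ℚ./ 8) ℚ.* (ι 8 ℚ.* ι a)         ≡⟨ ℚ.*-assoc (+ 1 ℚ./ 8) (ι 8) (ι a) ⟨
    (+ 1 ℚ./ 8) ℚ.* ι 8 ℚ.* ι a           ≡⟨ ℚ.*-identityˡ (ι a) ⟩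
    ι a                                   ≡⟨ /-*-cancel a b′ ⟨
    q ℚ.* ι b                             ∎)

ratio-bounds : ∀ h → 1 ≤ h → ∃ λ card → ∃ λ free → ∃ λ ratio →
  IsOPT-card (B h) card × IsOPT-free (B h) free × IsQuotient ratio card free ×
  fromℚ (+ 1 ℚ./ 8) *ℝ log₂ (N h) ≤ℝ ratio × ratio ≤ℝ fromℕ 3 *ℝ log₂ (N h)
ratio-bounds h 1≤h = combine
  (OPT-card-attained (B h) (B-unweighted h) (hierarchy h , hierarchy-dominating h))
  (OPT-free-attained (B h) (B-unweighted h) (lcaUltra h , lcaUltra-dominating h))
  where
  open ℕ.≤-Reasoning
  cost = edgeCost (B h)
  Goal = ∃ λ card → ∃ λ free → ∃ λ ratio →
    IsOPT-card (B h) card × IsOPT-free (B h) free × IsQuotient ratio card free ×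
    fromℚ (+ 1 ℚ./ 8) *ℝ log₂ (N h) ≤ℝ ratio × ratio ≤ℝ fromℕ 3 *ℝ log₂ (N h)
  lo : 2 ^ h ≤ N h
  lo = ℕ.≤-pred (begin
    1 + 2 ^ h            ≤⟨ ℕ.+-monoˡ-≤ (2 ^ h) (ℕ.m^n>0 2 h) ⟩
    2 ^ h + 2 ^ h        ≡⟨ cong (λ t → 2 ^ h + t) (ℕ.+-identityʳ (2 ^ h)) ⟨
    2 ^ suc h            ≡⟨ N-power h ⟨
    suc (N h)            ∎)
  hi : N h ≤ 2 ^ suc h
  hi = ℕ.≤-trans (ℕ.n≤1+n (N h)) (ℕ.≤-reflexive (N-power h))
  combine : (Σ (Hierarchy (N h)) λ H → Dominating (B h) H ×
              (∀ H′ → Dominating (B h) H′ → cost (hierarchyHeight H) ≤ cost (hierarchyHeight H′)) ×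
              IsOPT-card (B h) (fromℕ (cost (hierarchyHeight H)))) →
            (∃ λ f → DominatingUltra (B h) f ×
              (∀ g → DominatingUltra (B h) g → cost f ≤ cost g) ×
              IsOPT-free (B h) (fromℕ (cost f))) → Goal
  combine (H , _ , H-min , isCard) (f , okf , f-min , isFree) =
    let ratio , isQuot , low , high = quotient-bounds a b h (M h)
          (ℕ.≤-trans (ℕ.≤-trans 1≤h (h≤M h)) M≤b) lo hi a≤ a≥
    in fromℕ a , fromℕ b , ratio , isCard , isFree , isQuot , low , high
    where
    a = cost (hierarchyHeight H)
    b = cost f
    M≤b : M h ≤ b
    M≤b = edgeCost-dominating h f okf
    b≤4M : b ≤ 4 * M h
    b≤4M = ℕ.≤-trans (f-min (lcaUltra h) (lcaUltra-dominating h)) (edgeCost-lcaUltra h)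
    a≤ : a ≤ 3 * h * b
    a≤ = begin
      a              ≤⟨ H-min (hierarchy h) (hierarchy-dominating h) ⟩
      cost (hierarchyHeight (hierarchy h)) ≤⟨ edgeCost-hierarchy h ⟩
      3 * h * M h    ≤⟨ ℕ.*-monoʳ-≤ (3 * h) M≤b ⟩
      3 * h * b      ∎
    shuffle : ∀ h m → suc h * (4 * m) ≡ 4 * (suc h * m)
    shuffle = solve-∀
    a≥ : suc h * b ≤ 8 * a
    a≥ = begin
      suc h * b              ≤⟨ ℕ.*-monoʳ-≤ (suc h) b≤4M ⟩
      suc h * (4 * M h)      ≡⟨ shuffle h (M h) ⟩
      4 * (suc h * M h)      ≤⟨ ℕ.*-monoʳ-≤ 4 (edgeCost-lower h H) ⟩
      4 * (2 * a)            ≡⟨ ℕ.*-assoc 4 2 a ⟨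
      8 * a                  ∎

-- Descendants and connected vertex sets

-- below v x: the vertex x is v or a descendant of v.
below : ∀ {h} → Node h → Node h → Bool
below root      _         = true
below (left v)  (left x)  = below v x
below (right v) (right x) = below v x
below (left _)  root      = false
below (left _)  (right _) = false
below (right _) root      = false
below (right _) (left _)  = false

below-refl : ∀ {h} (v : Node h) → below v v ≡ true
below-refl root      = refl
below-refl (left v)  = below-refl v
below-refl (right v) = below-refl v

below-child : ∀ {h} (v : Node h) {p c} → p ◁ c → below v p ≡ true → below v c ≡ true
below-child root      _          _ = refl
below-child (left v)  (left◁ e)  b = below-child v e b
below-child (right v) (right◁ e) b = below-child v e b

below-parent : ∀ {h} (v : Node h) {p c} → p ◁ c → below v c ≡ true → c ≡ v ⊎ below v p ≡ true
below-parent root         _          _ = inj₂ refl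
below-parent (left root)  root◁left  _ = inj₁ refl
below-parent (right root) root◁right _ = inj₁ refl
below-parent (left v)     (left◁ e)  b = [ inj₁ ∘ cong left , inj₂ ]′ (below-parent v e b)
below-parent (right v)    (right◁ e) b = [ inj₁ ∘ cong right , inj₂ ]′ (below-parent v e b)

below⇒≤ : ∀ {h} (v x : Node h) → below v x ≡ true → enc v Fin.≤ enc x
below⇒≤         root      _         _ = z≤n
below⇒≤ {suc h} (left v)  (left x)  b = s≤s (subst₂ _≤_
  (sym (Fin.toℕ-↑ˡ (enc v) (N h))) (sym (Fin.toℕ-↑ˡ (enc x) (N h))) (below⇒≤ v x b))
below⇒≤ {suc h} (right v) (right x) b = s≤s (subst₂ _≤_
  (sym (Fin.toℕ-↑ʳ (N h) (enc v))) (sym (Fin.toℕ-↑ʳ (N h) (enc x))) (ℕ.+-monoʳ-≤ (N h) (below⇒≤ v x b)))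

parent : ∀ {h} (v : Node h) → v ≡ root ⊎ ∃ λ p → p ◁ v
parent root             = inj₁ refl
parent (left root)      = inj₂ (root , root◁left)
parent (left v@(left _)) with parent v
... | inj₂ (p , e) = inj₂ (left p , left◁ e)
parent (left v@(right _)) with parent v
... | inj₂ (p , e) = inj₂ (left p , left◁ e)
parent (right root)     = inj₂ (root , root◁right)
parent (right v@(left _)) with parent v
... | inj₂ (p , e) = inj₂ (right p , right◁ e)
parent (right v@(right _)) with parent v
... | inj₂ (p , e) = inj₂ (right p , right◁ e)

∧⁻ : ∀ {a b} → a ∧ b ≡ true → a ≡ true × b ≡ true
∧⁻ {true} {true} _ = refl , refl

not⁻ : ∀ {a} → not a ≡ true → a ≡ false
not⁻ {false} _ = refl

true≢false : ∀ {a} → a ≡ true → ¬ a ≡ false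
true≢false refl ()

-- Paths that take all their steps inside P.
Within : ∀ {h} → (Node h → Bool) → Node h → Node h → Set
Within P = Star (λ a b → a ~ b × P a ≡ true × P b ≡ true)

-- A path that leaves the descendants of c visits the parent of c.
escape : ∀ {h} {P : Node h → Bool} {p c} → p ◁ c → ∀ {x y} → Within P x y →
         below c x ≡ true → below c y ≡ false → P p ≡ true
escape p◁c Star.ε inside outside = ⊥-elim (true≢false inside outside)
escape {P = P} {p} {c} p◁c (_◅_ {j = b} (a~b , Pa , Pb) w) inside outside with below c b in eq
... | true  = escape p◁c w eq outside
... | false with a~b
...   | inj₁ a◁b = ⊥-elim (true≢false (below-child c a◁b inside) eq)
...   | inj₂ b◁a with below-parent c b◁a inside
...     | inj₁ refl   = subst (λ q → P q ≡ true) (◁-unique b◁a p◁c) Pb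
...     | inj₂ inside′ = ⊥-elim (true≢false inside′ eq)

-- P induces a connected subtree with topmost vertex t: t is an ancestor of all of
-- P, and P contains with a vertex other than t its parent.
record Top {h} (P : Node h → Bool) (t : Node h) : Set where
  field
    member : P t ≡ true
    under  : ∀ {x} → P x ≡ true → below t x ≡ true
    closed : ∀ {p c} → p ◁ c → P c ≡ true → c ≡ t ⊎ P p ≡ true

open Top

Top-cong : ∀ {h} {P Q : Node h → Bool} {t} → (∀ x → P x ≡ Q x) → Top P t → Top Q t
Top-cong {t = t} eq T = record
  { member = trans (sym (eq t)) (member T)
  ; under  = λ {x} Qx → under T (trans (eq x) Qx)
  ; closed = λ {p} {c} e Qc → [ inj₁ , (λ Pp → inj₂ (trans (sym (eq p)) Pp)) ]′
      (closed T e (trans (eq c) Qc))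
  }

-- The topmost vertex is the one with the least number; a path from a vertex to one
-- that is not below it passes through its parent.
connected⇒Top : ∀ {h} (P : Node h → Bool) → (∃ λ v → P v ≡ true) →
                (∀ {v w} → P v ≡ true → P w ≡ true → Within P v w) → ∃ (Top P)
connected⇒Top {h} P (v , Pv) conn = fromLeast
    (least rank? (_ , enc v , refl , trans (cong P (dec-enc v)) Pv))
  where
  Rank : ℕ → Set
  Rank k = ∃ λ (i : Fin (N h)) → toℕ i ≡ k × P (dec h i) ≡ true
  rank? : ∀ k → Dec (Rank k)
  rank? k = Fin.any? λ i → (toℕ i ℕ.≟ k) ×-dec (P (dec h i) Bool.≟ true)
  fromLeast : (∃ λ m → Rank m × ∀ k → Rank k → m ≤ k) → ∃ (Top P)
  fromLeast (_ , (i , refl , Pt) , low) = t , record { member = Pt ; under = under′ ; closed = closed′ }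
    where
    t = dec h i
    first : ∀ {x} → P x ≡ true → enc t Fin.≤ enc x
    first {x} Px = subst (λ j → toℕ j ≤ toℕ (enc x)) (sym (enc-dec h i))
      (low (toℕ (enc x)) (enc x , refl , trans (cong P (dec-enc x)) Px))
    under′ : ∀ {x} → P x ≡ true → below t x ≡ true
    under′ {x} Px with below t x in eq
    ... | true  = refl
    ... | false with parent t
    ...   | inj₁ t≡root = trans (sym eq) (cong (λ r → below r x) t≡root)
    ...   | inj₂ (q , q◁t) = ⊥-elim (ℕ.<⇒≱ (◁⇒< q◁t) (first (escape q◁t (conn Pt Px) (below-refl t) eq)))
    closed′ : ∀ {p c} → p ◁ c → P c ≡ true → c ≡ t ⊎ P p ≡ true
    closed′ {p} {c} e Pc with below c t in eq
    ... | true  = inj₁ (enc-injective (Fin.toℕ-injective (ℕ.≤-antisym (below⇒≤ c t eq) (first Pc))))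
    ... | false = inj₂ (escape e (conn Pc Pt) (below-refl c) eq)

-- Every vertex climbs to t inside P.
Top⇒connected : ∀ {h} {P : Node h → Bool} {t} → Top P t → ∀ {x} → P x ≡ true → Within P x t
Top⇒connected {P = P} {t} T {x} = climb x (<-wellFounded (toℕ (enc x)))
  where
  climb : ∀ x → Acc _<_ (toℕ (enc x)) → P x ≡ true → Within P x t
  climb x (acc rec) Px with parent x
  ... | inj₁ refl with refl ← enc-injective {v = t} {root}
      (Fin.toℕ-injective (ℕ.n≤0⇒n≡0 (below⇒≤ t root (under T Px)))) = Star.ε
  ... | inj₂ (p , p◁x) with closed T p◁x Px
  ...   | inj₁ refl = Star.ε
  ...   | inj₂ Pp   = (inj₂ p◁x , Px , Pp) ◅ climb p (rec (◁⇒< p◁x)) Pp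

Σnodes-cong : ∀ {h} {f g : Node h → ℕ} → (∀ x → f x ≡ g x) → Σnodes f ≡ Σnodes g
Σnodes-cong {zero}  eq = eq root
Σnodes-cong {suc h} eq = cong₂ _+_ (eq root)
    (cong₂ _+_ (Σnodes-cong (eq ∘ left)) (Σnodes-cong (eq ∘ right)))

Σnodes-0 : ∀ h → Σnodes {h} (λ _ → 0) ≡ 0
Σnodes-0 zero    = refl
Σnodes-0 (suc h) rewrite Σnodes-0 h = refl

Σedges-0 : ∀ h → Σedges {h} (λ _ _ → 0) ≡ 0
Σedges-0 zero    = refl
Σedges-0 (suc h) rewrite Σedges-0 h = refl

#nodes-empty : ∀ {h} {P : Node h → Bool} → (∀ x → P x ≡ false) → #nodes P ≡ 0
#nodes-empty {h} empty = trans (Σnodes-cong (cong 𝟙 ∘ empty)) (Σnodes-0 h)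

#edges-empty : ∀ {h} {P : Node h → Bool} → (∀ x → P x ≡ false) → #edges P ≡ 0
#edges-empty {h} {P} empty = trans (Σedges-cong {h} (λ {p} {c} _ → cong (λ b → 𝟙 (b ∧ P c)) (empty p)))
    (Σedges-0 h)

-- P contains the parent of each of its vertices, so that it is empty or connected
-- with topmost vertex root.
ParentClosed : ∀ {h} → (Node h → Bool) → Set
ParentClosed P = ∀ {p c} → p ◁ c → P c ≡ true → P p ≡ true

closed-edge : ∀ {a b} → (b ≡ true → a ≡ true) → 𝟙 (a ∧ b) ≡ 𝟙 b
closed-edge {true}  {b}     f = refl
closed-edge {false} {true}  f with () ← f refl
closed-edge {false} {false} f = refl

#edges-closed : ∀ {h} (P : Node h → Bool) → ParentClosed P → #edges P + 𝟙 (P root) ≡ #nodes P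
#edges-closed {zero}  P pc = refl
#edges-closed {suc h} P pc
  rewrite closed-edge {P root} {P (left root)} (pc root◁left)
        | closed-edge {P root} {P (right root)} (pc root◁right)
        | sym (#edges-closed (P ∘ left) (pc ∘ left◁))
        | sym (#edges-closed (P ∘ right) (pc ∘ right◁)) =
  shuffle (𝟙 (P (left root))) (𝟙 (P (right root))) (#edges (P ∘ left)) (#edges (P ∘ right)) (𝟙 (P root))
  where
  shuffle : ∀ l r a b x → l + (r + (a + b)) + x ≡ x + (a + l + (b + r))
  shuffle = solve-∀

Top-root : ∀ {h} {P : Node h → Bool} → Top P root → ParentClosed P
Top-root T e Pc with closed T e Pc
... | inj₂ Pp = Pp
Top-root T () Pc | inj₁ refl

-- If the topmost vertex lies in a subtree of the root, then so does all of P.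
module _ {h} {P : Node (suc h) → Bool} where

  not-under : ∀ {t x} → Top P t → below t x ≡ false → P x ≡ false
  not-under {t} {x} T out with P x in eq
  ... | true  = ⊥-elim (true≢false (under T eq) out)
  ... | false = refl

  Top-left : ∀ {t} → Top P (left t) → Top (P ∘ left) t
  Top-left T = record
    { member = member T
    ; under  = under T
    ; closed = λ e Pc → [ (λ { refl → inj₁ refl }) , inj₂ ]′ (closed T (left◁ e) Pc) }

  Top-right : ∀ {t} → Top P (right t) → Top (P ∘ right) t
  Top-right T = record
    { member = member T
    ; under  = under T
    ; closed = λ e Pc → [ (λ { refl → inj₁ refl }) , inj₂ ]′ (closed T (right◁ e) Pc) }

  #nodes-left : ∀ {t} → Top P (left t) → #nodes P ≡ #nodes (P ∘ left)
  #nodes-left T rewrite not-under {x = root} T refl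
    | #nodes-empty {P = P ∘ right} (λ x → not-under T refl) = ℕ.+-identityʳ _

  #nodes-right : ∀ {t} → Top P (right t) → #nodes P ≡ #nodes (P ∘ right)
  #nodes-right T rewrite not-under {x = root} T refl
    | #nodes-empty {P = P ∘ left} (λ x → not-under T refl) = refl

  #edges-left : ∀ {t} → Top P (left t) → #edges P ≡ #edges (P ∘ left)
  #edges-left T rewrite not-under {x = root} T refl
    | #edges-empty {P = P ∘ right} (λ x → not-under T refl) = ℕ.+-identityʳ _

  #edges-right : ∀ {t} → Top P (right t) → #edges P ≡ #edges (P ∘ right)
  #edges-right T rewrite not-under {x = root} T refl
    | #edges-empty {P = P ∘ left} (λ x → not-under T refl) = refl

-- A subtree has one edge fewer than vertices.
#edges-Top : ∀ {h} {P : Node h → Bool} {t} → Top P t → suc (#edges P) ≡ #nodes P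
#edges-Top {P = P} {root} T = begin
  suc (#edges P)             ≡⟨ ℕ.+-comm 1 (#edges P) ⟩
  #edges P + 1               ≡⟨ cong (λ b → #edges P + 𝟙 b) (member T) ⟨
  #edges P + 𝟙 (P root)      ≡⟨ #edges-closed P (Top-root T) ⟩
  #nodes P                   ∎
  where open ≡-Reasoning
#edges-Top {t = left t}  T = trans (cong suc (#edges-left T))
    (trans (#edges-Top (Top-left T)) (sym (#nodes-left T)))
#edges-Top {t = right t} T = trans (cong suc (#edges-right T))
    (trans (#edges-Top (Top-right T)) (sym (#nodes-right T)))

-- Balanced cuts

-- The number of vertices of P below v.
#below : ∀ {h} → (Node h → Bool) → Node h → ℕ
#below P v = #nodes (λ x → below v x ∧ P x)

#below-left : ∀ {h} (P : Node (suc h) → Bool) v → #below P (left v) ≡ #below (P ∘ left) v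
#below-left {h} P v rewrite Σnodes-0 h = ℕ.+-identityʳ _

#below-right : ∀ {h} (P : Node (suc h) → Bool) v → #below P (right v) ≡ #below (P ∘ right) v
#below-right {h} P v rewrite Σnodes-0 h = refl

-- An edge inside P such that the part of P below it has a vertices, where m ≤ 3 * a
-- and 3 * (a - 1) ≤ 2 * m.  For m + 1 = #nodes P, both sides of the edge then have
-- at most 2/3 * m edges.
record Cut {h} (P : Node h → Bool) (m : ℕ) : Set where
  field
    {upper lower} : Node h
    edge      : upper ◁ lower
    upper∈    : P upper ≡ true
    lower∈    : P lower ≡ true
    not-small : m ≤ 3 * #below P lower
    not-large : 3 * #below P lower ≤ 2 * m + 3

Cut-left : ∀ {h} {P : Node (suc h) → Bool} {m} → Cut (P ∘ left) m → Cut P m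
Cut-left {P = P} {m} c = record
  { edge = left◁ edge ; upper∈ = upper∈ ; lower∈ = lower∈
  ; not-small = subst (λ a → m ≤ 3 * a) (sym (#below-left P lower)) not-small
  ; not-large = subst (λ a → 3 * a ≤ 2 * m + 3) (sym (#below-left P lower)) not-large }
  where open Cut c

Cut-right : ∀ {h} {P : Node (suc h) → Bool} {m} → Cut (P ∘ right) m → Cut P m
Cut-right {P = P} {m} c = record
  { edge = right◁ edge ; upper∈ = upper∈ ; lower∈ = lower∈
  ; not-small = subst (λ a → m ≤ 3 * a) (sym (#below-right P lower)) not-small
  ; not-large = subst (λ a → 3 * a ≤ 2 * m + 3) (sym (#below-right P lower)) not-large }
  where open Cut c

closed-root : ∀ {h} (P : Node h → Bool) → ParentClosed P → 1 ≤ #nodes P → P root ≡ true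
closed-root P pc 1≤ with P root in eq
... | true  = refl
... | false = ⊥-elim (ℕ.1+n≰n (ℕ.≤-trans (forest P 1≤) (ℕ.≤-reflexive (begin
  #nodes P                   ≡⟨ #edges-closed P pc ⟨
  #edges P + 𝟙 (P root)      ≡⟨ cong (λ b → #edges P + 𝟙 b) eq ⟩
  #edges P + 0               ≡⟨ ℕ.+-identityʳ _ ⟩
  #edges P                   ∎))))
  where open ≡-Reasoning

-- The heavier of two parts that together exceed 2/3 of m is at least m/3.
heavier : ∀ m a b → 2 * m < 3 * (a + b) → b ≤ a → m ≤ 3 * a
heavier m a b heavy b≤a = ℕ.*-cancelˡ-≤ 2 (begin
  2 * m             ≤⟨ ℕ.<⇒≤ heavy ⟩
  3 * (a + b)       ≤⟨ ℕ.*-monoʳ-≤ 3 (ℕ.+-monoʳ-≤ a b≤a) ⟩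
  3 * (a + a)       ≡⟨ twice a ⟩
  2 * (3 * a)       ∎)
  where
  open ℕ.≤-Reasoning
  twice : ∀ a → 3 * (a + a) ≡ 2 * (3 * a)
  twice = solve-∀

large : ∀ m a → ¬ 3 * a ≤ 2 * m + 3 → 2 * m < 3 * (a ∸ 1)
large m zero    ¬le = ⊥-elim (¬le z≤n)
large m (suc a) ¬le = ℕ.+-cancelʳ-< 3 (2 * m) (3 * a) (ℕ.<-≤-trans (ℕ.≰⇒> ¬le) (ℕ.≤-reflexive (tidy a)))
  where
  tidy : ∀ a → 3 * suc a ≡ 3 * a + 3
  tidy = solve-∀

-- P has more than 2/3 * m edges; the part below the heavier child of the root
-- either gives the cut or has more than 2/3 * m edges again.
cut-root : ∀ {h} (P : Node h → Bool) m → P root ≡ true → ParentClosed P →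
           2 * m < 3 * (#nodes P ∸ 1) → Cut P m
cut-root {zero}  P m Pr pc heavy rewrite Pr with () ← heavy
cut-root {suc h} P m Pr pc heavy = [ (λ r≤l → goLeft r≤l) , (λ l≤r → goRight l≤r) ]′
    (ℕ.≤-total (#nodes (P ∘ right)) (#nodes (P ∘ left)))
  where
  l = #nodes (P ∘ left)
  r = #nodes (P ∘ right)
  heavyˡ : 2 * m < 3 * (l + r)
  heavyˡ = subst (λ b → 2 * m < 3 * (𝟙 b + (l + r) ∸ 1)) Pr heavy
  heavyʳ : 2 * m < 3 * (r + l)
  heavyʳ = subst (λ a → 2 * m < 3 * a) (ℕ.+-comm l r) heavyˡ
  positive : ∀ a b → 2 * m < 3 * (a + b) → b ≤ a → 1 ≤ a
  positive zero    zero    lt _ = ⊥-elim (ℕ.n≮0 lt)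
  positive (suc a) b       _  _ = s≤s z≤n
  goLeft : r ≤ l → Cut P m
  goLeft r≤l with 3 * l ℕ.≤? 2 * m + 3
  ... | yes le = record
    { edge = root◁left ; upper∈ = Pr
    ; lower∈ = closed-root (P ∘ left) (pc ∘ left◁) (positive l r heavyˡ r≤l)
    ; not-small = subst (λ a → m ≤ 3 * a) (sym (#below-left P root)) (heavier m l r heavyˡ r≤l)
    ; not-large = subst (λ a → 3 * a ≤ 2 * m + 3) (sym (#below-left P root)) le }
  ... | no ¬le = Cut-left (cut-root (P ∘ left) m
      (closed-root (P ∘ left) (pc ∘ left◁) (positive l r heavyˡ r≤l)) (pc ∘ left◁) (large m l ¬le))
  goRight : l ≤ r → Cut P m
  goRight l≤r with 3 * r ℕ.≤? 2 * m + 3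
  ... | yes le = record
    { edge = root◁right ; upper∈ = Pr
    ; lower∈ = closed-root (P ∘ right) (pc ∘ right◁) (positive r l heavyʳ l≤r)
    ; not-small = subst (λ a → m ≤ 3 * a) (sym (#below-right P root)) (heavier m r l heavyʳ l≤r)
    ; not-large = subst (λ a → 3 * a ≤ 2 * m + 3) (sym (#below-right P root)) le }
  ... | no ¬le = Cut-right (cut-root (P ∘ right) m
      (closed-root (P ∘ right) (pc ∘ right◁) (positive r l heavyʳ l≤r)) (pc ∘ right◁) (large m r ¬le))

cut-heavy : ∀ {h} {P : Node h → Bool} {t} m → Top P t → 2 * m < 3 * (#nodes P ∸ 1) → Cut P m
cut-heavy {P = P} {root} m T heavy = cut-root P m (member T) (Top-root T) heavy
cut-heavy {t = left t}  m T heavy =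
    Cut-left  (cut-heavy m (Top-left T)  (subst (λ a → 2 * m < 3 * (a ∸ 1)) (#nodes-left T) heavy))
cut-heavy {t = right t} m T heavy = Cut-right
    (cut-heavy m (Top-right T) (subst (λ a → 2 * m < 3 * (a ∸ 1)) (#nodes-right T) heavy))

-- The whole of P has m edges, which is more than 2/3 * m.
balanced-cut : ∀ {h} {P : Node h → Bool} {t} → Top P t → 2 ≤ #nodes P → Cut P (#nodes P ∸ 1)
balanced-cut {P = P} T 2≤ = cut-heavy (#nodes P ∸ 1) T
    (ℕ.*-monoˡ-< (#nodes P ∸ 1) {{ℕ.>-nonZero (ℕ.∸-monoˡ-≤ 1 2≤)}} (ℕ.n<1+n 2))

-- Both sides of a cut are connected.
module _ {h} {P : Node h → Bool} {t p v} (T : Top P t) (p◁v : p ◁ v) (Pp : P p ≡ true) (Pv : P v ≡ true) where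

  private
    v≰t : ¬ enc v Fin.≤ enc t
    v≰t v≤t = ℕ.<-irrefl refl (ℕ.<-≤-trans (◁⇒< p◁v) (ℕ.≤-trans v≤t (below⇒≤ t p (under T Pp))))

  Top-below : Top (λ x → below v x ∧ P x) v
  Top-below = record
    { member = cong₂ _∧_ (below-refl v) Pv
    ; under  = λ Ax → proj₁ (∧⁻ Ax)
    ; closed = closed′ }
    where
    closed′ : ∀ {q c} → q ◁ c → below v c ∧ P c ≡ true → c ≡ v ⊎ below v q ∧ P q ≡ true
    closed′ {q} {c} e Ac with below-parent v e (proj₁ (∧⁻ Ac)) | closed T e (proj₂ (∧⁻ {below v c} Ac))
    ... | inj₁ c≡v | _         = inj₁ c≡v
    ... | inj₂ _   | inj₁ refl = ⊥-elim (v≰t (below⇒≤ v t (proj₁ (∧⁻ Ac))))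
    ... | inj₂ b   | inj₂ Pq   = inj₂ (cong₂ _∧_ b Pq)

  Top-rest : Top (λ x → not (below v x) ∧ P x) t
  Top-rest = record
    { member = cong₂ (λ a b → not a ∧ b) (Bool.¬-not λ b → v≰t (below⇒≤ v t b)) (member T)
    ; under  = λ {x} Bx → under T (proj₂ (∧⁻ {not (below v x)} Bx))
    ; closed = closed′ }
    where
    closed′ : ∀ {q c} → q ◁ c → not (below v c) ∧ P c ≡ true → c ≡ t ⊎ not (below v q) ∧ P q ≡ true
    closed′ {q} {c} e Bc with closed T e (proj₂ (∧⁻ {not (below v c)} Bc))
    ... | inj₁ c≡t = inj₁ c≡t
    ... | inj₂ Pq  = inj₂ (cong₂ (λ a b → not a ∧ b)
          (Bool.¬-not λ b → true≢false (below-child v e b) (not⁻ (proj₁ (∧⁻ Bc)))) Pq)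

-- Vertex sets as subsets

∈?-lookup : ∀ {n} (i : Fin n) (S : Subset n) → does (i ∈? S) ≡ lookup S i
∈?-lookup i S with i ∈? S
... | yes i∈ = sym (Vec.[]=⇒lookup i∈)
... | no  i∉ = sym (Bool.¬-not λ eq → i∉ (Vec.lookup⇒[]= i S eq))

card-sum : ∀ {n} (S : Subset n) → ∣ S ∣ ≡ sum (tabulate (𝟙 ∘ lookup S))
card-sum []          = refl
card-sum (true ∷ S)  = cong suc (card-sum S)
card-sum (false ∷ S) = card-sum S

subset-ext : ∀ {n} {S T : Subset n} → (∀ i → lookup S i ≡ lookup T i) → S ≡ T
subset-ext {S = S} {T} eq = trans (sym (Vec.tabulate∘lookup S))
    (trans (Vec.tabulate-cong eq) (Vec.tabulate∘lookup T))

-- A set of vertex numbers as a set of vertices.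
members : ∀ {h} → Subset (N h) → Node h → Bool
members S v = lookup S (enc v)

card-nodes : ∀ {h} (S : Subset (N h)) → ∣ S ∣ ≡ #nodes {h} (members S)
card-nodes {h} S = trans (card-sum S) (Σnodes-tabulate h (𝟙 ∘ lookup S))

InducesConnected⇒Top : ∀ h (S : Subset (N h)) → InducesConnected (Graph.Adj (B h)) S →
    ∃ (Top {h} (members S))
InducesConnected⇒Top h S ((i , i∈) , conn) = connected⇒Top (members S)
  (dec h i , trans (cong (lookup S) (enc-dec h i)) (Vec.[]=⇒lookup i∈))
  λ {v} {w} Pv Pw → subst₂ (Within (members S)) (dec-enc v) (dec-enc w)
    (Star.gmap (dec h) (λ {a} {b} (e , a∈ , b∈) → e ,
        trans (cong (lookup S) (enc-dec h a)) (Vec.[]=⇒lookup a∈) ,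
        trans (cong (lookup S) (enc-dec h b)) (Vec.[]=⇒lookup b∈))
      (conn (Vec.lookup⇒[]= (enc v) S Pv) (Vec.lookup⇒[]= (enc w) S Pw)))

Top⇒InducesConnected : ∀ h (S : Subset (N h)) {t} → Top {h} (members S) t → InducesConnected
    (Graph.Adj (B h)) S
Top⇒InducesConnected h S {t} T = (enc t , Vec.lookup⇒[]= (enc t) S (member T)) ,
  λ {x} {y} x∈ y∈ → up x∈ ◅◅ Star.reverse (λ (e , a∈ , b∈) → swap e , b∈ , a∈) (up y∈)
  where
  up : ∀ {x} → x Subset.∈ S → Star (λ a b → Graph.Adj (B h) a b × a Subset.∈ S × b Subset.∈ S) x (enc t)
  up {x} x∈ = subst (λ i → Star _ i (enc t)) (enc-dec h x)
    (Star.gmap enc (λ {a} {b} (e , Pa , Pb) →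
        subst₂ _~_ (sym (dec-enc a)) (sym (dec-enc b)) e ,
        Vec.lookup⇒[]= (enc a) S Pa , Vec.lookup⇒[]= (enc b) S Pb)
      (Top⇒connected T (trans (cong (lookup S) (enc-dec h x)) (Vec.[]=⇒lookup x∈))))

-- Fragmentation

module _ (h : ℕ) where
  open Graph (B h)

  -- The number of edges inside S; all weights are 1.
  inner : Subset order → ℕ
  inner S = length (filter (λ (x , y) → (x ∈? S) ×-dec (y ∈? S)) edges)

  -- The number of edges between A and C.
  crossing : Subset order → Subset order → ℕ
  crossing A C = length (filter
      (λ (x , y) → ((x ∈? A) ×-dec (y ∈? C)) ⊎-dec ((x ∈? C) ×-dec (y ∈? A))) edges)

  inner-edges : ∀ S → inner S ≡ #edges {h} (members S)
  inner-edges S = begin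
    inner S ≡⟨ length-filter (λ (x , y) → (x ∈? S) ×-dec (y ∈? S)) edges ⟩
    sum (map (λ (x , y) → 𝟙 (does (x ∈? S) ∧ does (y ∈? S))) edges)
      ≡⟨ edgeSumℕ h (λ x y → 𝟙 (does (x ∈? S) ∧ does (y ∈? S))) ⟩
    Σedges {h} (λ p c → 𝟙 (does (enc p ∈? S) ∧ does (enc c ∈? S)))
      ≡⟨ Σedges-cong {h} (λ {p} {c} _ → cong₂ (λ a b → 𝟙 (a ∧ b)) (∈?-lookup (enc p) S)
          (∈?-lookup (enc c) S)) ⟩
    #edges {h} (members S) ∎
    where open ≡-Reasoning

  inner-connected : ∀ S → InducesConnected Adj S → suc (inner S) ≡ ∣ S ∣
  inner-connected S conn = trans (cong suc (inner-edges S))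
    (trans (#edges-Top (proj₂ (InducesConnected⇒Top h S conn))) (sym (card-nodes {h} S)))

  module _ {S A C : Subset order} (bip : Bipartition (B h) S A C) where
    open Bipartition bip

    private
      either : ∀ i → lookup S i ≡ lookup A i ∨ lookup C i
      either i = trans (cong (λ T → lookup T i) (sym covers)) (Vec.lookup-zipWith _∨_ i A C)

      not-both : ∀ i → lookup A i ∧ lookup C i ≡ false
      not-both i = trans (sym (Vec.lookup-zipWith _∧_ i A C))
        (trans (cong (λ T → lookup T i) disjoint) (Vec.lookup-replicate i false))

    card-bipartition : ∣ S ∣ ≡ ∣ A ∣ + ∣ C ∣
    card-bipartition = begin
      ∣ S ∣                                           ≡⟨ size S ⟩
      sum (map (𝟙 ∘ lookup S) (allFin order))
        ≡⟨ sum-map-cong (λ i → trans (cong 𝟙 (either i)) (count (lookup A i) (lookup C i) (not-both i)))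
            (allFin order) ⟩
      sum (map (λ i → 𝟙 (lookup A i) + 𝟙 (lookup C i)) (allFin order))
        ≡⟨ sum-map-+ (𝟙 ∘ lookup A) (𝟙 ∘ lookup C) (allFin order) ⟩
      sum (map (𝟙 ∘ lookup A) (allFin order)) + sum (map (𝟙 ∘ lookup C) (allFin order))
        ≡⟨ cong₂ _+_ (size A) (size C) ⟨
      ∣ A ∣ + ∣ C ∣                                   ∎
      where
      open ≡-Reasoning
      size : ∀ T → ∣ T ∣ ≡ sum (map (𝟙 ∘ lookup T) (allFin order))
      size T = trans (card-sum T) (cong sum (sym (map-tabulate id (𝟙 ∘ lookup T))))
      count : ∀ a c → a ∧ c ≡ false → 𝟙 (a ∨ c) ≡ 𝟙 a + 𝟙 c
      count true  false _ = refl
      count false c     _ = refl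

    inner-bipartition : inner S ≡ inner A + inner C + crossing A C
    inner-bipartition = begin
      inner S ≡⟨ length-filter (λ (x , y) → (x ∈? S) ×-dec (y ∈? S)) edges ⟩
      sum (map (λ (x , y) → 𝟙 (does (x ∈? S) ∧ does (y ∈? S))) edges)
        ≡⟨ sum-map-cong pointwise edges ⟩
      sum (map (λ e → a e + c e + x e) edges)
        ≡⟨ sum-map-+ (λ e → a e + c e) x edges ⟩
      sum (map (λ e → a e + c e) edges) + sum (map x edges)
        ≡⟨ cong (_+ sum (map x edges)) (sum-map-+ a c edges) ⟩
      sum (map a edges) + sum (map c edges) + sum (map x edges)
        ≡⟨ cong₂ _+_ (cong₂ _+_
             (length-filter (λ (x , y) → (x ∈? A) ×-dec (y ∈? A)) edges)
             (length-filter (λ (x , y) → (x ∈? C) ×-dec (y ∈? C)) edges))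
             (length-filter (λ (x , y) → ((x ∈? A) ×-dec (y ∈? C)) ⊎-dec ((x ∈? C) ×-dec (y ∈? A)))
                 edges) ⟨
      inner A + inner C + crossing A C ∎
      where
      open ≡-Reasoning
      a c x : V × V → ℕ
      a (i , j) = 𝟙 (does (i ∈? A) ∧ does (j ∈? A))
      c (i , j) = 𝟙 (does (i ∈? C) ∧ does (j ∈? C))
      x (i , j) = 𝟙 ((does (i ∈? A) ∧ does (j ∈? C)) ∨ (does (i ∈? C) ∧ does (j ∈? A)))
      table : ∀ a c a′ c′ → a ∧ c ≡ false → a′ ∧ c′ ≡ false →
              𝟙 ((a ∨ c) ∧ (a′ ∨ c′)) ≡ 𝟙 (a ∧ a′) + 𝟙 (c ∧ c′) + 𝟙 ((a ∧ c′) ∨ (c ∧ a′))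
      table true  false true  false _ _ = refl
      table true  false false true  _ _ = refl
      table true  false false false _ _ = refl
      table false true  true  false _ _ = refl
      table false true  false true  _ _ = refl
      table false true  false false _ _ = refl
      table false false _     _     _ _ = refl
      pointwise : ∀ e → 𝟙 (does (proj₁ e ∈? S) ∧ does (proj₂ e ∈? S)) ≡ a e + c e + x e
      pointwise (i , j)
        rewrite ∈?-lookup i S | ∈?-lookup j S | ∈?-lookup i A | ∈?-lookup j A | ∈?-lookup i C | ∈?-lookup
            j C
              | either i | either j = table (lookup A i) (lookup C i) (lookup A j) (lookup C j)
                  (not-both i) (not-both j)

    -- S, A and C each have one vertex more than edges.
    crossing-1 : InducesConnected Adj S → crossing A C ≡ 1
    crossing-1 conn = arith′ (inner S) (inner A) (inner C) (crossing A C) inner-bipartition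
      (trans (inner-connected S conn) (trans card-bipartition
        (cong₂ _+_ (sym (inner-connected A connectedˡ)) (sym (inner-connected C connectedʳ)))))
      where
      arith′ : ∀ s a c x → s ≡ a + c + x → suc s ≡ suc a + suc c → x ≡ 1
      arith′ s a c x refl eq = ℕ.+-cancelˡ-≡ (a + c) x 1
        (ℕ.suc-injective (trans eq (tidy a c)))
        where
        tidy : ∀ a c → suc a + suc c ≡ suc (a + c + 1)
        tidy = solve-∀

  -- Weights are constant sequences, so their sums are too.
  seq-sum : ∀ xs k → seq (sumℝ (uncurry weight) xs) k ≡ ι (length xs)
  seq-sum []       k = refl
  seq-sum (e ∷ xs) k = trans (cong (1ℚ ℚ.+_) (seq-sum xs k)) (sym (ι-+ 1 (length xs)))

  balanced-bipartition : ∀ S → InducesConnected Adj S → 2 ≤ ∣ S ∣ → ∃ λ A → ∃ λ C → Bipartition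
      (B h) S A C ×
    3 * ((∣ A ∣ ∸ 1) ⊔ (∣ C ∣ ∸ 1)) ≤ 2 * (∣ S ∣ ∸ 1)
  balanced-bipartition S conn 2≤ = A , C , bip , balance
    where
    P = members {h} S
    t = proj₁ (InducesConnected⇒Top h S conn)
    T : Top P t
    T = proj₂ (InducesConnected⇒Top h S conn)
    cut : Cut P (#nodes P ∸ 1)
    cut = balanced-cut T (subst (2 ≤_) (card-nodes {h} S) 2≤)
    open Cut cut renaming (lower to v)
    inA inC : V → Bool
    inA i = below v (dec h i) ∧ lookup S i
    inC i = not (below v (dec h i)) ∧ lookup S i
    A C : Subset order
    A = Vec.tabulate inA
    C = Vec.tabulate inC
    members-A : ∀ x → below v x ∧ P x ≡ members {h} A x
    members-A x = sym (trans (Vec.lookup∘tabulate inA (enc x)) (cong (λ y → below v y ∧ P x) (dec-enc x)))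
    members-C : ∀ x → not (below v x) ∧ P x ≡ members {h} C x
    members-C x = sym (trans (Vec.lookup∘tabulate inC (enc x))
        (cong (λ y → not (below v y) ∧ P x) (dec-enc x)))
    join : ∀ b s → (b ∧ s) ∨ (not b ∧ s) ≡ s
    join true  true  = refl
    join true  false = refl
    join false s     = refl
    meet : ∀ b s → (b ∧ s) ∧ (not b ∧ s) ≡ false
    meet true  s = Bool.∧-zeroʳ s
    meet false s = refl
    bip : Bipartition (B h) S A C
    bip = record
      { covers = subset-ext λ i → trans (Vec.lookup-zipWith _∨_ i A C)
          (trans (cong₂ _∨_ (Vec.lookup∘tabulate inA i) (Vec.lookup∘tabulate inC i))
              (join (below v (dec h i)) (lookup S i)))
      ; disjoint = subset-ext λ i → trans (Vec.lookup-zipWith _∧_ i A C)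
          (trans (cong₂ _∧_ (Vec.lookup∘tabulate inA i) (Vec.lookup∘tabulate inC i))
            (trans (meet (below v (dec h i)) (lookup S i)) (sym (Vec.lookup-replicate i false))))
      ; connectedˡ = Top⇒InducesConnected h A (Top-cong members-A (Top-below T edge upper∈ lower∈))
      ; connectedʳ = Top⇒InducesConnected h C (Top-cong members-C (Top-rest T edge upper∈ lower∈))
      }
    card-A : #below P v ≡ ∣ A ∣
    card-A = trans (Σnodes-cong (cong 𝟙 ∘ members-A)) (sym (card-nodes {h} A))
    arith : ∀ s a c → s ≡ a + c → s ∸ 1 ≤ 3 * a → 3 * a ≤ 2 * (s ∸ 1) + 3 → 3 * ((a ∸ 1) ⊔ (c ∸ 1)) ≤ 2 *
        (s ∸ 1)
    arith s a c refl lo hi = ℕ.≤-trans (ℕ.≤-reflexive (ℕ.*-distribˡ-⊔ 3 (a ∸ 1) (c ∸ 1)))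
        (ℕ.⊔-lub (big a hi) (small a c lo))
      where
      open ℕ.≤-Reasoning
      big : ∀ a → 3 * a ≤ 2 * (s ∸ 1) + 3 → 3 * (a ∸ 1) ≤ 2 * (s ∸ 1)
      big zero    _  = z≤n
      big (suc a) hi = ℕ.+-cancelʳ-≤ 3 (3 * a) (2 * (s ∸ 1)) (ℕ.≤-trans (ℕ.≤-reflexive (tidy a)) hi)
        where
        tidy : ∀ a → 3 * a + 3 ≡ 3 * suc a
        tidy = solve-∀
      small : ∀ a c → a + c ∸ 1 ≤ 3 * a → 3 * (c ∸ 1) ≤ 2 * (a + c ∸ 1)
      small a zero    _  = z≤n
      small a (suc c) lo = ℕ.+-cancelʳ-≤ (a + suc c ∸ 1) (3 * c) (2 * (a + suc c ∸ 1)) (begin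
        3 * c + (a + suc c ∸ 1)                         ≤⟨ ℕ.+-monoʳ-≤ (3 * c) lo ⟩
        3 * c + 3 * a                                   ≡⟨ tidy a c ⟩
        2 * (a + c) + (a + c)
          ≡⟨ cong (λ k → 2 * k + k) (cong (_∸ 1) (sym (ℕ.+-suc a c))) ⟩
        2 * (a + suc c ∸ 1) + (a + suc c ∸ 1)           ∎)
        where
        tidy : ∀ a c → 3 * c + 3 * a ≡ 2 * (a + c) + (a + c)
        tidy = solve-∀
    balance : 3 * ((∣ A ∣ ∸ 1) ⊔ (∣ C ∣ ∸ 1)) ≤ 2 * (∣ S ∣ ∸ 1)
    balance = arith (∣ S ∣) (∣ A ∣) (∣ C ∣) (card-bipartition bip)
      (subst₂ (λ s a → s ∸ 1 ≤ 3 * a) (sym (card-nodes {h} S)) card-A not-small)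
      (subst₂ (λ s a → 3 * a ≤ 2 * (s ∸ 1) + 3) (sym (card-nodes {h} S)) card-A not-large)

  two-thirds : ∀ m s → 3 * m ≤ 2 * s → ι m ℚ.≤ (1ℚ ℚ.- (+ 1 ℚ./ 3)) ℚ.* ι s
  two-thirds m s le = ℚ.*-cancelˡ-≤-pos (ι 3) (begin
    ι 3 ℚ.* ι m                                ≡⟨ ι-* 3 m ⟨
    ι (3 * m)                                  ≤⟨ ι-mono-≤ {3 * m} {2 * s} le ⟩
    ι (2 * s)                                  ≡⟨ ι-* 2 s ⟩
    ι 2 ℚ.* ι s                                ≡⟨ ℚ.*-assoc (ι 3) (1ℚ ℚ.- (+ 1 ℚ./ 3)) (ι s) ⟩
    ι 3 ℚ.* ((1ℚ ℚ.- (+ 1 ℚ./ 3)) ℚ.* ι s)     ∎)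
    where open ℚ.≤-Reasoning

  frag≡1 : ∀ S → 2 ≤ ∣ S ∣ → InducesConnected Adj S → IsFrag (B h) (fromℚ (+ 1 ℚ./ 3)) S [ 1ℝ ]
  frag≡1 S 2≤ conn = attained (balanced-bipartition S conn 2≤) , lower
    where
    s = ∣ S ∣ ∸ 1
    inner≡ : inner S ≡ s
    inner≡ = cong (_∸ 1) (inner-connected S conn)
    1≤s : 1 ≤ s
    1≤s = ℕ.∸-monoˡ-≤ 1 2≤
    seq-inner : ∀ k → seq (innerWeight (B h) S) k ≡ ι s
    seq-inner k = trans (seq-sum (filter (λ (x , y) → (x ∈? S) ×-dec (y ∈? S)) edges) k) (cong ι inner≡)
    seq-crossing : ∀ {A C} → Bipartition (B h) S A C → ∀ k → seq (crossWeight (B h) A C) k ≡ 1ℚ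
    seq-crossing {A} {C} bip k = trans
      (seq-sum (filter (λ (x , y) → ((x ∈? A) ×-dec (y ∈? C)) ⊎-dec ((x ∈? C) ×-dec (y ∈? A))) edges) k)
      (cong ι (crossing-1 bip conn))
    inner>0 : 0ℝ <ℝ innerWeight (B h) S
    inner>0 = 1ℚ , 0<1 , 0 , λ k _ → ℚ.≤-trans (ι-mono-≤ {1} {s} 1≤s) (ℚ.≤-reflexive (sym (seq-inner k)))
    attained : (∃ λ A → ∃ λ C → Bipartition (B h) S A C × 3 * ((∣ A ∣ ∸ 1) ⊔ (∣ C ∣ ∸ 1)) ≤ 2 * s) →
               FragCost (B h) (fromℚ (+ 1 ℚ./ 3)) S 1ℝ
    attained (A , C , bip , balance) = A , C , bip ,
      pointwise-≤ {fromℕ ((∣ A ∣ ∸ 1) ⊔ (∣ C ∣ ∸ 1))} {(1ℝ -ℝ fromℚ (+ 1 ℚ./ 3)) *ℝ fromℕ s}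
        (λ _ → two-thirds ((∣ A ∣ ∸ 1) ⊔ (∣ C ∣ ∸ 1)) s balance) ,
      inner>0 ,
      pointwise-≃ {1ℝ *ℝ innerWeight (B h) S} {fromℕ s *ℝ crossWeight (B h) A C} λ k → begin
        1ℚ ℚ.* seq (innerWeight (B h) S) k       ≡⟨ ℚ.*-identityˡ _ ⟩
        seq (innerWeight (B h) S) k              ≡⟨ seq-inner k ⟩
        ι s                                      ≡⟨ ℚ.*-identityʳ (ι s) ⟨
        ι s ℚ.* 1ℚ                               ≡⟨ cong (ι s ℚ.*_) (seq-crossing bip k) ⟨
        ι s ℚ.* seq (crossWeight (B h) A C) k    ∎
      where open ≡-Reasoning
    lower : ∀ v → FragCost (B h) (fromℚ (+ 1 ℚ./ 3)) S v → 1ℝ ≤ℝ v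
    lower v (A , C , bip , _ , _ , _ , ge) η 0<η = proj₁ (ge η 0<η) , λ k N≤k →
      ℚ.*-cancelʳ-≤-pos (ι s) {{ℚ.positive (0<ι 1≤s)}} (begin
        1ℚ ℚ.* ι s                                        ≡⟨ ℚ.*-comm 1ℚ (ι s) ⟩
        ι s ℚ.* 1ℚ                                        ≡⟨ cong (ι s ℚ.*_) (seq-crossing bip k) ⟨
        ι s ℚ.* seq (crossWeight (B h) A C) k             ≤⟨ proj₂ (ge η 0<η) k N≤k ⟩
        seq v k ℚ.* seq (innerWeight (B h) S) k ℚ.+ η
          ≡⟨ cong (λ w → seq v k ℚ.* w ℚ.+ η) (seq-inner k) ⟩
        seq v k ℚ.* ι s ℚ.+ η
          ≡⟨ cong (seq v k ℚ.* ι s ℚ.+_) (ℚ.*-identityʳ η) ⟨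
        seq v k ℚ.* ι s ℚ.+ η ℚ.* 1ℚ                      ≤⟨ ℚ.+-monoʳ-≤ (seq v k ℚ.* ι s)
                                                               (ℚ.*-monoˡ-≤-nonNeg η {{ℚ.nonNegative
                                                                   (ℚ.<⇒≤ 0<η)}} (ι-mono-≤ {1} {s} 1≤s)) ⟩
        seq v k ℚ.* ι s ℚ.+ η ℚ.* ι s                     ≡⟨ ℚ.*-distribʳ-+ (ι s) (seq v k) η ⟨
        (seq v k ℚ.+ η) ℚ.* ι s                           ∎)
      where open ℚ.≤-Reasoning

theorem14 : Σ (ℕ → Graph) λ B →
    (∀ h → 1 ≤ h → let open Graph (B h) in
    Acyclic ×
    Unweighted ×
    maxDegree ≤ 3 ×
    (2 ≤ h → maxDegree ≡ 3) ×
    order ≡ 2 ^ suc h ∸ 1) ×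
    (∃ λ c → ∃ λ C → 0ℝ <ℝ c × c ≤ℝ C ×
    (∀ h → 1 ≤ h →
    ∃ λ card → ∃ λ free → ∃ λ ratio →
    IsOPT-card (B h) card ×
    IsOPT-free (B h) free ×
    IsQuotient ratio card free ×
    c *ℝ log₂ (Graph.order (B h)) ≤ℝ ratio ×
    ratio ≤ℝ C *ℝ log₂ (Graph.order (B h)))) ×
    (∀ h → 1 ≤ h → (S : Subset (Graph.order (B h))) →
    2 ≤ ∣ S ∣ → InducesConnected (Graph.Adj (B h)) S →
    ∃ λ (v : ℝ ⁺) → IsFrag (B h) (fromℚ (+ 1 / 3)) S v × v ≤⁺ [ 1ℝ ])
theorem14 = B , structure ,
  (fromℚ (+ 1 / 8) , fromℕ 3 , 0<c , c≤C , ratio-bounds) ,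
  λ h _ S 2≤ conn → [ 1ℝ ] , frag≡1 h S 2≤ conn , ≤⁺.[ ≤ℝ-refl {1ℝ} ]
  where
  structure : ∀ h → 1 ≤ h → let open Graph (B h) in
    Acyclic × Unweighted × maxDegree ≤ 3 × (2 ≤ h → maxDegree ≡ 3) × order ≡ 2 ^ suc h ∸ 1
  structure h _ = acyclic h , (λ _ → ≃-refl {1ℝ}) , maxDegree≤3 h ,
    (λ 2≤h → ℕ.≤-antisym (maxDegree≤3 h) (maxDegree≥3 h 2≤h)) , cong (_∸ 1) (N-power h)
  0<c : 0ℝ <ℝ fromℚ (+ 1 / 8)
  0<c = + 1 / 8 , ℚ.positive⁻¹ (+ 1 / 8) , 0 , λ _ _ → ℚ.≤-reflexive (ℚ.+-identityˡ (+ 1 / 8))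
  c≤C : fromℚ (+ 1 / 8) ≤ℝ fromℕ 3
  c≤C = pointwise-≤ {fromℚ (+ 1 / 8)} {fromℕ 3} λ _ → /-mono-≤ 1 3 7 0 (s≤s z≤n)
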